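{- Let $p>3$ be a prime and let $t\in\mathbb{Z}_p$ with $3t\not\equiv \pm 5\pmod p$. Then $$\sum_{k=0}^{(p-1)/2}\binom{2k}k^2\binom{4k}{2k}\Big(\frac{1-t^2}{256}\Big)^k \equiv \Big(\frac{10+6t}p\Big)\sum_{k=0}^{\lfloor p/6\rfloor}\binom{2k}k\binom{3k}k\binom{6k}{3k}\Big(\frac{(t-1)^2(t+1)} {64(3t+5)^3}\Big)^k \equiv \Big(\frac{10-6t}p\Big)\sum_{k=0}^{\lfloor p/6\rfloor}\binom{2k}k\binom{3k}k\binom{6k}{3k}\Big(\frac{(t+1)^2(t-1)} {64(3t-5)^3}\Big)^k \pmod p.$$
   Context: For a prime $p$, $\mathbb{Z}_p$ denotes the set of rational numbers whose denominator is not divisible by $p$; congruences modulo $p$ are taken in $\mathbb{Z}_p$. For $a\in\mathbb{Z}_p$, $\big(\frac ap\big)$ is the Legendre symbol of $a$ (i.e. of any integer congruent to $a$ modulo $p$). $\lfloor x\rfloor$ is the greatest integer not exceeding $x$. -}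

module Defs where

open import Data.Nat as ℕ using (ℕ; zero; suc)
open import Data.Nat.Combinatorics using (_C_)
open import Data.Integer as ℤ using (ℤ; +_; 0ℤ; 1ℤ; -1ℤ)
open import Data.Integer.Divisibility using (_∣_)
open import Data.Rational as ℚ using (ℚ; ↥_; ↧_; 0ℚ; 1ℚ; _+_; _*_; _-_; ≢-nonZero)
open import Data.Rational.Properties using (_≟_)
open import Data.Product using (_×_; ∃)
open import Data.Sum using (_⊎_)
open import Relation.Nullary using (¬_; yes; no)
open import Relation.Binary.PropositionalEquality using (_≡_)

ℕtoℚ : ℕ → ℚ
ℕtoℚ n = (+ n) ℚ./ 1

ℤtoℚ : ℤ → ℚ
ℤtoℚ z = z ℚ./ 1

pow : ℚ → ℕ → ℚ
pow q zero = 1ℚ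
pow q (suc n) = q * pow q n

-- total inverse (1/0 := 0); only used at nonzero arguments
inv : ℚ → ℚ
inv q with q ≟ 0ℚ
... | yes _ = 0ℚ
... | no q≢0 = ℚ.1/_ q {{≢-nonZero q≢0}}

sumTo : ℕ → (ℕ → ℚ) → ℚ
sumTo zero f = f 0
sumTo (suc n) f = sumTo n f + f (suc n)

-- a ≡ b (mod p) in ℤ_p : a - b ∈ pℤ_p, i.e. p divides the (reduced) numerator of a - b
infix 4 _≡_[mod_]
_≡_[mod_] : ℚ → ℚ → ℕ → Set
a ≡ b [mod p ] = (+ p) ∣ (↥ (a - b))

InZp : ℕ → ℚ → Set
InZp p a = ¬ ((+ p) ∣ (↧ a))

LegendreZ : ℕ → ℤ → ℤ → Set
LegendreZ p x ε =
  ((+ p) ∣ x × ε ≡ 0ℤ)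
  ⊎ (¬ ((+ p) ∣ x) × ∃ (λ y → (+ p) ∣ (y ℤ.* y ℤ.- x)) × ε ≡ 1ℤ)
  ⊎ (¬ ((+ p) ∣ x) × ¬ ∃ (λ y → (+ p) ∣ (y ℤ.* y ℤ.- x)) × ε ≡ -1ℤ)

Legendre : ℕ → ℚ → ℤ → Set
Legendre p a ε = ∃ (λ x → ℤtoℚ x ≡ a [mod p ] × LegendreZ p x ε)

{-# OPTIONS --safe #-}
module Submission where

-- Put m = (p − 1)/2 and u = t + 1. Modulo p the first sum is a polynomial in u, and so
-- is (10 + 6 t)ᵐ times the second one, because 3 ⌊p/6⌋ ≤ m clears its denominators.
-- Since m ≡ −1/2, both are annihilated by one third-order differential operator L with a
-- regular singular point at u = 0: applied to the sums, L telescopes by the recurrences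
-- for their coefficients, and the last terms vanish because 2 m + 1 ≡ 0 and because
-- 6 n + 1 or 6 n + 5 is p for n = ⌊p/6⌋. The indicial polynomial of L is 16 n³, so modulo p
-- a solution of degree less than p is determined by its constant term; here both
-- constant terms are 1, as 4ᵐ ≡ 1. By Euler's criterion (10 + 6 t)ᵐ is the Legendre symbol.
-- The substitution t ↦ −t fixes the first sum and gives the other congruence.

open import Defs
open import Algebra.Bundles using (CommutativeRing)
import Algebra.Properties.CommutativeSemiring.Binomial as Binomial
import Algebra.Properties.CommutativeSemiring.Exp as CommutativeExp
import Algebra.Properties.Monoid.Sum as Sum
import Algebra.Properties.Ring as RingProperties
import Algebra.Properties.Semiring.Exp as Exp
import Algebra.Properties.Semiring.Mult as Mult
open import Data.Bool.Base using (T)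
open import Data.Empty using (⊥-elim)
open import Data.Fin.Base as Fin using (Fin; toℕ; inject₁; fromℕ)
import Data.Fin.Properties as Fin
open import Data.Integer as ℤ using (ℤ; +_; -[1+_]; 0ℤ; 1ℤ; -1ℤ)
open import Data.Integer.Divisibility.Signed using (_∣_; divides; ∣⇒∣ᵤ; ∣ᵤ⇒∣; ∣m∣n⇒∣m+n; ∣n⇒∣m*n)
import Data.Integer.Properties as ℤ
open import Data.Integer.Solver using (module +-*-Solver)
open import Data.Maybe.Base using (nothing)
open import Data.Nat as ℕ using (ℕ; zero; suc; _∸_; _!; _>_)
open import Data.Nat.Combinatorics using (_C_; nCk≡n!/k![n-k]!; [n∸k]!k!∣n!; nCn≡1)
import Data.Nat.Coprimality as Coprimality
import Data.Nat.Divisibility as ℕ∣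
open import Data.Nat.DivMod using (m/n*n≡m; m≡m%n+[m/n]*n; m%n<n)
open import Data.Nat.Primality using (Prime; euclidsLemma; prime⇒nonTrivial; prime⇒irreducible)
import Data.Nat.Properties as ℕ
open import Data.Nat.Tactic.RingSolver using (solve-∀)
open import Data.Product using (_×_; _,_; proj₁; proj₂; ∃-syntax)
open import Data.Rational as ℚ using (ℚ; mkℚ; 0ℚ; 1ℚ; ↥_; ↧_; toℚᵘ)
import Data.Rational.Properties as ℚ
open import Data.Rational.Unnormalised.Base as ℚᵘ using (mkℚᵘ)
import Data.Rational.Unnormalised.Properties as ℚᵘ
open import Data.Sum using (_⊎_; inj₁; inj₂; [_,_]′)
open import Data.Vec.N-ary using (N-ary; curryⁿ; Eq; curryⁿ-cong)
open import Function using (_∘_)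
open import Level using (_⊔_; Lift; lift; lower)
open import Relation.Binary.PropositionalEquality as ≡ using (_≡_)
import Relation.Binary.Reasoning.Setoid as ≈-Reasoning
import Relation.Binary.Reflection as Reflection
open import Relation.Nullary using (¬_; yes; no; does)
open import Tactic.RingSolver.Core.AlmostCommutativeRing using (_-Raw-AlmostCommutative⟶_; fromCommutativeRing)
open import Tactic.RingSolver.Core.Expression using (Expr; Κ; Ι; _⊕_; _⊗_; _⊛_; ⊝_; module Eval)
import Tactic.RingSolver.Core.Polynomial.Base as Base
import Tactic.RingSolver.Core.Polynomial.Homomorphism as Hom
open import Tactic.RingSolver.Core.Polynomial.Parameters using (Homomorphism)
import Tactic.RingSolver.Core.Polynomial.Semantics as Semantics

-- The congruence truncates a classical identity modulo p. Over the complex numbers the sums become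
-- 3F2(1/4, 1/2, 3/4; 1, 1; 1 - t²) and 3F2(1/6, 1/2, 5/6; 1, 1; 27 (t - 1)² (t + 1) / (3 t + 5)³),
-- and near t = -1, where both arguments vanish, the first is ((3 t + 5) / 2) to the power -1/2
-- times the second. Replacing -1/2 by m turns the square root into a polynomial. The price is
-- characteristic p: the Euler operator θ = u d/du kills uᵖ, so a differential equation says nothing
-- beyond degree p - 1, and degree bounds have to accompany every evaluation. No quotient of series
-- is formed. Logarithmic derivatives are kept as relations q θ f = r f, and the factor q³ that they
-- introduce is cancelled at the end because its constant term is a unit. All rings are abstract and
-- receive a map from ℤ, so every algebraic step is a polynomial identity over ℤ.

IntegersTo : ∀ {c ℓ} → CommutativeRing c ℓ → Set _
IntegersTo R = ℤ.+-*-rawRing -Raw-AlmostCommutative⟶ fromCommutativeRing R (λ _ → nothing)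

-- A ring solver with integer coefficients. The library's solvers compare the
-- meanings of normal forms in R; this one only normalises l − r to the
-- constant 0, so that checking a use never unfolds the operations of R.
module IntegerSolver {c ℓ} (R : CommutativeRing c ℓ) (φ : IntegersTo R) where

  open CommutativeRing R
  open _-Raw-AlmostCommutative⟶_ φ using (⟦_⟧; 0-homo)
  open RingProperties ring using (x∙y⁻¹≈ε⇒x≈y)

  private
    0≟⇒0≈ : ∀ x → T (does (x ℤ.≟ ℤ.0ℤ)) → 0# ≈ ⟦ x ⟧
    0≟⇒0≈ (ℤ.+ 0) _ = sym 0-homo

    homo : Homomorphism _ _ _ _
    homo = record
      { from = record { rawRing = ℤ.+-*-rawRing ; isZero = λ x → does (x ℤ.≟ ℤ.0ℤ) }
      ; to = fromCommutativeRing R (λ _ → nothing)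
      ; morphism = φ
      ; Zero-C⟶Zero-R = 0≟⇒0≈ }

    open Base (Homomorphism.from homo)
    open Hom homo
    open Semantics homo renaming (⟦_⟧ to ⟦_⟧ₚ)
    open Eval (Homomorphism.rawRing homo) ⟦_⟧ renaming (⟦_⟧ to ⟦_⟧ₑ)

    normalise : ∀ {n} → Expr ℤ n → Poly n
    normalise (Κ x)   = κ x
    normalise (Ι i)   = ι i
    normalise (x ⊕ y) = normalise x ⊞ normalise y
    normalise (x ⊗ y) = normalise x ⊠ normalise y
    normalise (⊝ x)   = ⊟ normalise x
    normalise (x ⊛ i) = normalise x ⊡ i

    correct : ∀ {n} (e : Expr ℤ n) ρ → ⟦ normalise e ⟧ₚ ρ ≈ ⟦ e ⟧ₑ ρ
    correct (Κ x)   ρ = κ-hom x ρ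
    correct (Ι i)   ρ = ι-hom i ρ
    correct (x ⊕ y) ρ = trans (⊞-hom (normalise x) (normalise y) ρ) (+-cong (correct x ρ) (correct y ρ))
    correct (x ⊗ y) ρ = trans (⊠-hom (normalise x) (normalise y) ρ) (*-cong (correct x ρ) (correct y ρ))
    correct (⊝ x)   ρ = trans (⊟-hom (normalise x) ρ) (-‿cong (correct x ρ))
    correct (x ⊛ i) ρ = trans (⊡-hom (normalise x) i ρ) (^-congˡ i (correct x ρ))
      where open import Algebra.Properties.Semiring.Exp.TCOptimised semiring using (^-congˡ)

    Zero⇒≈0 : ∀ {n} (p : Poly n) ρ → T (does (zero? p)) → ⟦ p ⟧ₚ ρ ≈ 0#
    Zero⇒≈0 (Base.Κ (ℤ.+ 0) Base.⊐ _) ρ _ = 0-homo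

    open Reflection setoid Ι ⟦_⟧ₑ (λ e → ⟦ normalise e ⟧ₚ) correct using (close)

  infixl 6 _⊖_
  infix  4 _⊜_

  _⊖_ : ∀ {n} → Expr ℤ n → Expr ℤ n → Expr ℤ n
  x ⊖ y = x ⊕ ⊝ y

  _⊜_ : ∀ {n} → Expr ℤ n → Expr ℤ n → Expr ℤ n × Expr ℤ n
  _⊜_ = _,_

  :♯_ : ∀ {n} → ℕ → Expr ℤ n
  :♯ n = Κ (+ n)

  -- The type of `t` reduces to the unit type exactly when the normal form of the difference is
  -- zero, so it is filled in without a proof. An identity over ℤ holds in every ring that ℤ maps
  -- to, whatever its characteristic.
  solve : ∀ n (f : N-ary n (Expr ℤ n) (Expr ℤ n × Expr ℤ n)) →
          {t : T (does (zero? (normalise (proj₁ (close n f) ⊕ ⊝ proj₂ (close n f)))))} →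
          Eq n _≈_ (curryⁿ ⟦ proj₁ (close n f) ⟧ₑ) (curryⁿ ⟦ proj₂ (close n f) ⟧ₑ)
  solve n f {t} = curryⁿ-cong _≈_ ⟦ l ⟧ₑ ⟦ r ⟧ₑ λ ρ →
    x∙y⁻¹≈ε⇒x≈y _ _ (trans (sym (correct (l ⊕ ⊝ r) ρ)) (Zero⇒≈0 (normalise (l ⊕ ⊝ r)) ρ t))
    where
    l = proj₁ (close n f)
    r = proj₂ (close n f)

-- Formal power series over a commutative ring

module PowerSeries {c ℓ} (K : CommutativeRing c ℓ)
  (φ : IntegersTo K) where
  private
    module K = CommutativeRing K
    module φ = _-Raw-AlmostCommutative⟶_ φ
  open K using (Carrier)
  open IntegerSolver K φ
  open RingProperties K.ring using (-0#≈0#)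

  Series : Set c
  Series = ℕ → Carrier

  infix  4 _≈_
  infixl 6 _+_
  infixl 7 _*_ _∙_

  _≈_ : Series → Series → Set ℓ
  f ≈ g = ∀ n → f n K.≈ g n

  _+_ : Series → Series → Series
  (f + g) n = f n K.+ g n

  -_ : Series → Series
  (- f) n = K.- f n

  constant : Carrier → Series
  constant a zero    = a
  constant a (suc n) = K.0#

  tail : Series → Series
  tail f n = f (suc n)

  _∙_ : Carrier → Series → Series
  (a ∙ f) n = a K.* f n

  -- The Cauchy product, from f = f(0) + u · `tail f`; recursion on the index avoids convolution
  -- sums.
  _*_ : Series → Series → Series
  (f * g) zero    = f 0 K.* g 0
  (f * g) (suc n) = f 0 K.* g (suc n) K.+ (tail f * g) n

  *-cong : ∀ {f f′ g g′} → f ≈ f′ → g ≈ g′ → f * g ≈ f′ * g′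
  *-cong p q zero    = K.*-cong (p 0) (q 0)
  *-cong p q (suc n) = K.+-cong (K.*-cong (p 0) (q (suc n))) (*-cong (λ i → p (suc i)) q n)

  *-distribʳ : ∀ h f g → (f + g) * h ≈ f * h + g * h
  *-distribʳ h f g zero    = K.distribʳ (h 0) (f 0) (g 0)
  *-distribʳ h f g (suc n) = K.trans
    (K.+-congˡ (*-distribʳ h (tail f) (tail g) n))
    (solve 5 (λ f₀ g₀ hₙ x y → (f₀ ⊕ g₀) ⊗ hₙ ⊕ (x ⊕ y) ⊜ (f₀ ⊗ hₙ ⊕ x) ⊕ (g₀ ⊗ hₙ ⊕ y))
       (f 0) (g 0) (h (suc n)) ((tail f * h) n) ((tail g * h) n))

  ∙-* : ∀ a f g → (a ∙ f) * g ≈ a ∙ (f * g)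
  ∙-* a f g zero    = K.*-assoc a (f 0) (g 0)
  ∙-* a f g (suc n) = K.trans
    (K.+-congˡ (∙-* a (tail f) g n))
    (solve 4 (λ a f₀ gₙ x → a ⊗ f₀ ⊗ gₙ ⊕ a ⊗ x ⊜ a ⊗ (f₀ ⊗ gₙ ⊕ x))
       a (f 0) (g (suc n)) ((tail f * g) n))

  *-assoc : ∀ f g h → (f * g) * h ≈ f * (g * h)
  *-assoc f g h zero    = K.*-assoc (f 0) (g 0) (h 0)
  *-assoc f g h (suc n) = K.trans
    (K.+-congˡ (K.trans (*-distribʳ h (f 0 ∙ tail g) (tail f * g) n)
      (K.+-cong (∙-* (f 0) (tail g) h n) (*-assoc (tail f) g h n))))
    (solve 5 (λ f₀ g₀ hₙ x y → f₀ ⊗ g₀ ⊗ hₙ ⊕ (f₀ ⊗ x ⊕ y) ⊜ f₀ ⊗ (g₀ ⊗ hₙ ⊕ x) ⊕ y)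
       (f 0) (g 0) (h (suc n)) ((tail g * h) n) ((tail f * (g * h)) n))

  -- The mirror image of the defining recursion: it peels off the constant term of `g` instead of
  -- that of `f`, which makes commutativity a plain induction.
  *-suc : ∀ f g n → (f * g) (suc n) K.≈ (f * tail g) n K.+ f (suc n) K.* g 0
  *-suc f g zero    = K.refl
  *-suc f g (suc n) = K.trans (K.+-congˡ (*-suc (tail f) g n)) (K.sym (K.+-assoc _ _ _))

  *-comm : ∀ f g → f * g ≈ g * f
  *-comm f g zero    = K.*-comm (f 0) (g 0)
  *-comm f g (suc n) = K.trans (K.+-congˡ (*-comm (tail f) g n))
    (K.trans (K.+-comm _ _) (K.trans (K.+-congˡ (K.*-comm (f 0) (g (suc n)))) (K.sym (*-suc g f n))))

  *-zeroˡ : ∀ f g → (∀ n → f n K.≈ K.0#) → ∀ n → (f * g) n K.≈ K.0#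
  *-zeroˡ f g f≈0 zero    = K.trans (K.*-congʳ (f≈0 0)) (K.zeroˡ _)
  *-zeroˡ f g f≈0 (suc n) = K.trans
    (K.+-cong (K.trans (K.*-congʳ (f≈0 0)) (K.zeroˡ _)) (*-zeroˡ (tail f) g (λ i → f≈0 (suc i)) n))
    (K.+-identityˡ _)

  constant-* : ∀ a g → constant a * g ≈ a ∙ g
  constant-* a g zero    = K.refl
  constant-* a g (suc n) = K.trans (K.+-congˡ (*-zeroˡ (tail (constant a)) g (λ _ → K.refl) n)) (K.+-identityʳ _)

  *-identityˡ : ∀ f → constant K.1# * f ≈ f
  *-identityˡ f n = K.trans (constant-* K.1# f n) (K.*-identityˡ (f n))

  ring : CommutativeRing c ℓ
  ring = record
    { Carrier = Series ; _≈_ = _≈_ ; _+_ = _+_ ; _*_ = _*_ ; -_ = -_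
    ; 0# = constant K.0# ; 1# = constant K.1#
    ; isCommutativeRing = record
      { isRing = record
        { +-isAbelianGroup = record
          { isGroup = record
            { isMonoid = record
              { isSemigroup = record
                { isMagma = record
                  { isEquivalence = record
                    { refl  = λ _ → K.refl
                    ; sym   = λ p n → K.sym (p n)
                    ; trans = λ p q n → K.trans (p n) (q n) }
                  ; ∙-cong = λ p q n → K.+-cong (p n) (q n) }
                ; assoc = λ f g h n → K.+-assoc (f n) (g n) (h n) }
              ; identity = (λ f n → K.trans (K.+-congʳ (zero≈ n)) (K.+-identityˡ (f n)))
                         , (λ f n → K.trans (K.+-congˡ (zero≈ n)) (K.+-identityʳ (f n))) }
            ; inverse = (λ f n → K.trans (K.-‿inverseˡ (f n)) (K.sym (zero≈ n)))
                      , (λ f n → K.trans (K.-‿inverseʳ (f n)) (K.sym (zero≈ n)))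
            ; ⁻¹-cong = λ p n → K.-‿cong (p n) }
          ; comm = λ f g n → K.+-comm (f n) (g n) }
        ; *-cong = *-cong
        ; *-assoc = *-assoc
        ; *-identity = *-identityˡ , λ f n → K.trans (*-comm f (constant K.1#) n) (*-identityˡ f n)
        ; distrib = (λ h f g n → K.trans (*-comm h (f + g) n) (K.trans (*-distribʳ h f g n)
                       (K.+-cong (*-comm f h n) (*-comm g h n))))
                  , *-distribʳ }
      ; *-comm = *-comm } }
    where
    zero≈ : ∀ n → constant K.0# n K.≈ K.0#
    zero≈ zero    = K.refl
    zero≈ (suc n) = K.refl

  constants : IntegersTo ring
  constants = record
    { ⟦_⟧    = λ x → constant φ.⟦ x ⟧
    ; +-homo = λ { x y zero → φ.+-homo x y ; x y (suc n) → K.sym (K.+-identityˡ K.0#) }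
    ; *-homo = λ { x y zero → φ.*-homo x y
                 ; x y (suc n) → K.sym (K.trans (constant-* φ.⟦ x ⟧ (constant φ.⟦ y ⟧) (suc n)) (K.zeroʳ _)) }
    ; -‿homo = λ { x zero → φ.-‿homo x ; x (suc n) → K.sym -0#≈0# }
    ; 0-homo = λ { zero → φ.0-homo ; (suc n) → K.refl }
    ; 1-homo = λ { zero → φ.1-homo ; (suc n) → K.refl }
    }

module FiniteSums {c ℓ} (R : CommutativeRing c ℓ) where

  open CommutativeRing R

  sum≤ : ℕ → (ℕ → Carrier) → Carrier
  sum≤ zero    f = f 0
  sum≤ (suc n) f = sum≤ n f + f (suc n)

  sum≤-cong : ∀ n {f g} → (∀ k → k ℕ.≤ n → f k ≈ g k) → sum≤ n f ≈ sum≤ n g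
  sum≤-cong zero    f≈g = f≈g 0 ℕ.≤-refl
  sum≤-cong (suc n) f≈g = +-cong (sum≤-cong n (λ k k≤n → f≈g k (ℕ.m≤n⇒m≤1+n k≤n))) (f≈g (suc n) ℕ.≤-refl)

  *-distribˡ-sum≤ : ∀ n a f → a * sum≤ n f ≈ sum≤ n (λ k → a * f k)
  *-distribˡ-sum≤ zero    a f = refl
  *-distribˡ-sum≤ (suc n) a f = trans (distribˡ a _ _) (+-congʳ (*-distribˡ-sum≤ n a f))

-- Differential rings with an Euler derivation θ = u d/du, and the operator L on them

record Derivation {c ℓ} (A : CommutativeRing c ℓ) (φ : IntegersTo A) : Set (c ⊔ ℓ) where
  open CommutativeRing A
  open _-Raw-AlmostCommutative⟶_ φ renaming (⟦_⟧ to #_)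
  field
    θ         : Carrier → Carrier
    θ-cong    : ∀ {f g} → f ≈ g → θ f ≈ θ g
    θ-+       : ∀ f g → θ (f + g) ≈ θ f + θ g
    θ-*       : ∀ f g → θ (f * g) ≈ θ f * g + f * θ g
    θ-integer : ∀ x → θ (# x) ≈ 0#
    u         : Carrier
    θu≈u      : θ u ≈ u

module DifferentialRing {c ℓ} (A : CommutativeRing c ℓ) (φ : IntegersTo A) (derivation : Derivation A φ) where

  open CommutativeRing A
  open Derivation derivation
  open _-Raw-AlmostCommutative⟶_ φ renaming (⟦_⟧ to #_)
  open IntegerSolver A φ
  open FiniteSums A using (sum≤)
  open Exp semiring using (_^_)
  open ≈-Reasoning setoid

  infix 9 ♯_
  ♯_ : ℕ → Carrier
  ♯ n = # (+ n)

  ♯-suc : ∀ n → ♯ suc n ≈ ♯ 1 + ♯ n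
  ♯-suc n = +-homo (+ 1) (+ n)

  Constant : Carrier → Set ℓ
  Constant a = θ a ≈ 0#

  Constant-* : ∀ {a b} → Constant a → Constant b → Constant (a * b)
  Constant-* {a} {b} ca cb = trans (θ-* a b)
    (trans (+-cong (trans (*-congʳ ca) (zeroˡ b)) (trans (*-congˡ cb) (zeroʳ a))) (+-identityˡ 0#))

  θ-monomial : ∀ {a f g} → Constant a → θ f ≈ g → θ (a * f) ≈ a * g
  θ-monomial {a} {f} ca e = trans (θ-* a f)
    (trans (+-cong (trans (*-congʳ ca) (zeroˡ f)) (*-congˡ e)) (+-identityˡ _))

  θ-quadratic : ∀ {a b c} → Constant a → Constant b → Constant c →
                θ (a + b * u + c * (u * u)) ≈ b * u + ♯ 2 * c * (u * u)
  θ-quadratic {a} {b} {c} ca cb cc = begin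
    θ (a + b * u + c * (u * u))
      ≈⟨ trans (θ-+ _ _) (+-congʳ (θ-+ _ _)) ⟩
    θ a + θ (b * u) + θ (c * (u * u))
      ≈⟨ +-cong (+-cong ca (θ-monomial cb θu≈u))
                (θ-monomial cc (trans (θ-* u u) (+-cong (*-congʳ θu≈u) (*-congˡ θu≈u)))) ⟩
    0# + b * u + c * (u * u + u * u)
      ≈⟨ +-cong (+-identityˡ _) (solve 2 (λ u c → c ⊗ (u ⊗ u ⊕ u ⊗ u) ⊜ :♯ 2 ⊗ c ⊗ (u ⊗ u)) u c) ⟩
    b * u + ♯ 2 * c * (u * u) ∎

  -- If f has logarithmic derivative ν / q, then fⁿ has n ν / q.
  θ-^ : ∀ {q ν} f → q * θ f ≈ ν * f → ∀ n → q * θ (f ^ n) ≈ ♯ n * ν * f ^ n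
  θ-^ {q} {ν} f eq zero = begin
    q * θ 1#           ≈⟨ *-congˡ (trans (θ-cong (sym 1-homo)) (θ-integer 1ℤ)) ⟩
    q * 0#             ≈⟨ zeroʳ q ⟩
    0#                 ≈⟨ 0-homo ⟨
    ♯ 0                ≈⟨ solve 2 (λ ν x → :♯ 0 ⊜ :♯ 0 ⊗ ν ⊗ x) ν 1# ⟩
    ♯ 0 * ν * 1#       ∎
  θ-^ {q} {ν} f eq (suc n) = begin
    q * θ (f * f ^ n)                         ≈⟨ *-congˡ (θ-* f (f ^ n)) ⟩
    q * (θ f * f ^ n + f * θ (f ^ n))
      ≈⟨ solve 5 (λ q d x f e → q ⊗ (d ⊗ x ⊕ f ⊗ e) ⊜ q ⊗ d ⊗ x ⊕ f ⊗ (q ⊗ e)) q (θ f) (f ^ n) f (θ (f ^ n)) ⟩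
    q * θ f * f ^ n + f * (q * θ (f ^ n))     ≈⟨ +-cong (*-congʳ eq) (*-congˡ (θ-^ f eq n)) ⟩
    ν * f * f ^ n + f * (♯ n * ν * f ^ n)
      ≈⟨ solve 4 (λ ν f x n → ν ⊗ f ⊗ x ⊕ f ⊗ (n ⊗ ν ⊗ x) ⊜ (:♯ 1 ⊕ n) ⊗ ν ⊗ (f ⊗ x)) ν f (f ^ n) (♯ n) ⟩
    (♯ 1 + ♯ n) * ν * (f * f ^ n)             ≈⟨ *-congʳ (*-congʳ (♯-suc n)) ⟨
    ♯ suc n * ν * (f * f ^ n)                 ∎

  -- The third-order operator (times u) annihilating the symmetric square of
  -- (1 − t²) y″ − 2 t y′ − (3/16) y = 0, in the coordinate u = t + 1 at the singular point t = −1.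
  operator : (f₀ f₁ f₂ f₃ : Carrier) → Carrier
  operator f₀ f₁ f₂ f₃ =
    ♯ 16 * f₃ - u * (♯ 16 * f₃ + ♯ 24 * f₂ + ♯ 14 * f₁ + ♯ 3 * f₀)
    + u * u * (♯ 4 * f₃ + ♯ 12 * f₂ + ♯ 11 * f₁ + ♯ 3 * f₀)

  L : Carrier → Carrier
  L f = operator f (θ f) (θ (θ f)) (θ (θ (θ f)))

  private
    :operator : ∀ {n} (u f₀ f₁ f₂ f₃ : Expr ℤ n) → Expr ℤ n
    :operator u f₀ f₁ f₂ f₃ =
      :♯ 16 ⊗ f₃ ⊖ u ⊗ (:♯ 16 ⊗ f₃ ⊕ :♯ 24 ⊗ f₂ ⊕ :♯ 14 ⊗ f₁ ⊕ :♯ 3 ⊗ f₀)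
      ⊕ u ⊗ u ⊗ (:♯ 4 ⊗ f₃ ⊕ :♯ 12 ⊗ f₂ ⊕ :♯ 11 ⊗ f₁ ⊕ :♯ 3 ⊗ f₀)

  operator-cong : ∀ {f₀ f₁ f₂ f₃ g₀ g₁ g₂ g₃} → f₀ ≈ g₀ → f₁ ≈ g₁ → f₂ ≈ g₂ → f₃ ≈ g₃ →
                  operator f₀ f₁ f₂ f₃ ≈ operator g₀ g₁ g₂ g₃
  operator-cong e₀ e₁ e₂ e₃ =
    +-cong (+-cong (*-congˡ e₃) (-‿cong (*-congˡ (+-cong (+-cong (+-cong (*-congˡ e₃) (*-congˡ e₂)) (*-congˡ e₁)) (*-congˡ e₀)))))
           (*-congˡ (+-cong (+-cong (+-cong (*-congˡ e₃) (*-congˡ e₂)) (*-congˡ e₁)) (*-congˡ e₀)))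

  L-+ : ∀ f g → L (f + g) ≈ L f + L g
  L-+ f g = trans
    (operator-cong refl (θ-+ f g) e₂ (trans (θ-cong e₂) (θ-+ _ _)))
    (solve 9 (λ u f₀ f₁ f₂ f₃ g₀ g₁ g₂ g₃ →
        :operator u (f₀ ⊕ g₀) (f₁ ⊕ g₁) (f₂ ⊕ g₂) (f₃ ⊕ g₃)
        ⊜ :operator u f₀ f₁ f₂ f₃ ⊕ :operator u g₀ g₁ g₂ g₃)
      u f (θ f) (θ (θ f)) (θ (θ (θ f))) g (θ g) (θ (θ g)) (θ (θ (θ g))))
    where
    e₂ = trans (θ-cong (θ-+ f g)) (θ-+ (θ f) (θ g))

  L-scale : ∀ {x} → Constant x → ∀ f → L (x * f) ≈ x * L f
  L-scale {x} cx f = trans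
    (operator-cong refl (θ-monomial cx refl) e₂ (trans (θ-cong e₂) (θ-monomial cx refl)))
    (solve 6 (λ u x f₀ f₁ f₂ f₃ →
        :operator u (x ⊗ f₀) (x ⊗ f₁) (x ⊗ f₂) (x ⊗ f₃) ⊜ x ⊗ :operator u f₀ f₁ f₂ f₃)
      u x f (θ f) (θ (θ f)) (θ (θ (θ f))))
    where
    e₂ = trans (θ-cong (θ-monomial cx refl)) (θ-monomial cx refl)

  private
    :symbol₂ : ∀ {n} (q q₁ r r₁ : Expr ℤ n) → Expr ℤ n
    :symbol₂ q q₁ r r₁ = q ⊗ r₁ ⊕ r ⊗ r ⊖ r ⊗ q₁

    :symbol₃ : ∀ {n} (q q₁ q₂ r r₁ r₂ : Expr ℤ n) → Expr ℤ n
    :symbol₃ q q₁ q₂ r r₁ r₂ =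
      q ⊗ q ⊗ r₂ ⊕ (:♯ 2 ⊗ r₁ ⊖ q₂) ⊗ (q ⊗ r) ⊕ (r ⊖ :♯ 2 ⊗ q₁) ⊗ :symbol₂ q q₁ r r₁

  -- If q θ f = r f, then q² θ² f and q³ θ³ f are `symbol₂` and `symbol₃` times f. Here `q₁`, `q₂`,
  -- `r₁`, `r₂` stand for θ q, θ² q, θ r, θ² r.
  symbol₂ : (q q₁ r r₁ : Carrier) → Carrier
  symbol₂ q q₁ r r₁ = q * r₁ + r * r - r * q₁

  symbol₃ : (q q₁ q₂ r r₁ r₂ : Carrier) → Carrier
  symbol₃ q q₁ q₂ r r₁ r₂ =
    q * q * r₂ + (♯ 2 * r₁ - q₂) * (q * r) + (r - ♯ 2 * q₁) * symbol₂ q q₁ r r₁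

  -- On an f with logarithmic derivative r / q, three differentiations cost the denominator q³;
  -- after clearing it, L acts as multiplication by a polynomial in q, r and their derivatives.
  -- Applying L to the terms of the sums thus becomes a task for the ring solver.
  L-logarithmic : ∀ {q q₁ q₂ r r₁ r₂} f → θ q ≈ q₁ → θ q₁ ≈ q₂ → θ r ≈ r₁ → θ r₁ ≈ r₂ →
    q * θ f ≈ r * f →
    q * q * q * L f ≈
      operator (q * q * q) (q * q * r) (q * symbol₂ q q₁ r r₁) (symbol₃ q q₁ q₂ r r₁ r₂) * f
  L-logarithmic {q} {q₁} {q₂} {r} {r₁} {r₂} f θq θq₁ θr θr₁ eq₁ = begin
    q * q * q * L f
      ≈⟨ solve 6 (λ q u f₀ f₁ f₂ f₃ → q ⊗ q ⊗ q ⊗ :operator u f₀ f₁ f₂ f₃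
           ⊜ :operator u (q ⊗ q ⊗ q ⊗ f₀) (q ⊗ q ⊗ (q ⊗ f₁)) (q ⊗ (q ⊗ q ⊗ f₂)) (q ⊗ q ⊗ q ⊗ f₃))
         q u f (θ f) (θ (θ f)) (θ (θ (θ f))) ⟩
    operator (q * q * q * f) (q * q * (q * θ f)) (q * (q * q * θ (θ f))) (q * q * q * θ (θ (θ f)))
      ≈⟨ operator-cong refl (*-congˡ eq₁) (*-congˡ eq₂) eq₃ ⟩
    operator (q * q * q * f) (q * q * (r * f)) (q * (symbol₂ q q₁ r r₁ * f)) (symbol₃ q q₁ q₂ r r₁ r₂ * f)
      ≈⟨ solve 6 (λ q u f r s₂ s₃ →
           :operator u (q ⊗ q ⊗ q ⊗ f) (q ⊗ q ⊗ (r ⊗ f)) (q ⊗ (s₂ ⊗ f)) (s₃ ⊗ f)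
           ⊜ :operator u (q ⊗ q ⊗ q) (q ⊗ q ⊗ r) (q ⊗ s₂) s₃ ⊗ f)
         q u f r (symbol₂ q q₁ r r₁) (symbol₃ q q₁ q₂ r r₁ r₂) ⟩
    operator (q * q * q) (q * q * r) (q * symbol₂ q q₁ r r₁) (symbol₃ q q₁ q₂ r r₁ r₂) * f ∎
    where
    differentiated : ∀ {a a′ g h} → θ a ≈ a′ → a * g ≈ h → a * θ g ≈ θ h - a′ * g
    differentiated {a} {a′} {g} {h} θa e = begin
      a * θ g                      ≈⟨ solve 3 (λ a′ g x → x ⊜ a′ ⊗ g ⊕ x ⊖ a′ ⊗ g) a′ g (a * θ g) ⟩
      a′ * g + a * θ g - a′ * g    ≈⟨ +-congʳ (+-congʳ (*-congʳ θa)) ⟨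
      θ a * g + a * θ g - a′ * g   ≈⟨ +-congʳ (trans (sym (θ-* a g)) (θ-cong e)) ⟩
      θ h - a′ * g                 ∎

    θ-sub : ∀ {a b a′ b′} → θ a ≈ a′ → θ b ≈ b′ → θ (a - b) ≈ a′ - b′
    θ-sub {a} {b} {a′} {b′} ea eb = begin
      θ (a - b)               ≈⟨ θ-cong (+-congˡ (solve 1 (λ b → ⊝ b ⊜ Κ -1ℤ ⊗ b) b)) ⟩
      θ (a + # -1ℤ * b)     ≈⟨ trans (θ-+ _ _) (+-cong ea (trans (θ-monomial (θ-integer _) refl) (*-congˡ eb))) ⟩
      a′ + # -1ℤ * b′       ≈⟨ solve 2 (λ a b → a ⊕ Κ -1ℤ ⊗ b ⊜ a ⊖ b) a′ b′ ⟩
      a′ - b′                 ∎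

    step₂ : q * θ (θ f) ≈ r₁ * f + (r - q₁) * θ f
    step₂ = begin
      q * θ (θ f)                      ≈⟨ differentiated θq eq₁ ⟩
      θ (r * f) - q₁ * θ f             ≈⟨ +-congʳ (trans (θ-* r f) (+-congʳ (*-congʳ θr))) ⟩
      r₁ * f + r * θ f - q₁ * θ f
        ≈⟨ solve 5 (λ r₁ f r d q₁ → r₁ ⊗ f ⊕ r ⊗ d ⊖ q₁ ⊗ d ⊜ r₁ ⊗ f ⊕ (r ⊖ q₁) ⊗ d) r₁ f r (θ f) q₁ ⟩
      r₁ * f + (r - q₁) * θ f          ∎

    eq₂ : q * q * θ (θ f) ≈ symbol₂ q q₁ r r₁ * f
    eq₂ = begin
      q * q * θ (θ f)                        ≈⟨ trans (*-assoc _ _ _) (*-congˡ step₂) ⟩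
      q * (r₁ * f + (r - q₁) * θ f)
        ≈⟨ solve 6 (λ q r₁ f r q₁ d → q ⊗ (r₁ ⊗ f ⊕ (r ⊖ q₁) ⊗ d) ⊜ q ⊗ r₁ ⊗ f ⊕ (r ⊖ q₁) ⊗ (q ⊗ d)) q r₁ f r q₁ (θ f) ⟩
      q * r₁ * f + (r - q₁) * (q * θ f)      ≈⟨ +-congˡ (*-congˡ eq₁) ⟩
      q * r₁ * f + (r - q₁) * (r * f)
        ≈⟨ solve 5 (λ q r₁ f r q₁ → q ⊗ r₁ ⊗ f ⊕ (r ⊖ q₁) ⊗ (r ⊗ f) ⊜ :symbol₂ q q₁ r r₁ ⊗ f) q r₁ f r q₁ ⟩
      symbol₂ q q₁ r r₁ * f                  ∎

    eq₃ : q * q * q * θ (θ (θ f)) ≈ symbol₃ q q₁ q₂ r r₁ r₂ * f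
    eq₃ = begin
      q * q * q * θ (θ (θ f))
        ≈⟨ trans (*-assoc _ _ _) (*-congˡ (differentiated θq step₂)) ⟩
      q * q * (θ (r₁ * f + (r - q₁) * θ f) - q₁ * θ (θ f))
        ≈⟨ *-congˡ (+-congʳ (trans (θ-+ _ _) (+-cong
             (trans (θ-* _ _) (+-congʳ (*-congʳ θr₁)))
             (trans (θ-* _ _) (+-congʳ (*-congʳ (θ-sub θr θq₁))))))) ⟩
      q * q * (r₂ * f + r₁ * θ f + ((r₁ - q₂) * θ f + (r - q₁) * θ (θ f)) - q₁ * θ (θ f))
        ≈⟨ solve 9 (λ q q₁ q₂ r r₁ r₂ f f₁ f₂ →
             q ⊗ q ⊗ (r₂ ⊗ f ⊕ r₁ ⊗ f₁ ⊕ ((r₁ ⊖ q₂) ⊗ f₁ ⊕ (r ⊖ q₁) ⊗ f₂) ⊖ q₁ ⊗ f₂)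
             ⊜ q ⊗ q ⊗ r₂ ⊗ f ⊕ (:♯ 2 ⊗ r₁ ⊖ q₂) ⊗ q ⊗ (q ⊗ f₁) ⊕ (r ⊖ :♯ 2 ⊗ q₁) ⊗ (q ⊗ q ⊗ f₂))
           q q₁ q₂ r r₁ r₂ f (θ f) (θ (θ f)) ⟩
      q * q * r₂ * f + (♯ 2 * r₁ - q₂) * q * (q * θ f) + (r - ♯ 2 * q₁) * (q * q * θ (θ f))
        ≈⟨ +-cong (+-congˡ (*-congˡ eq₁)) (*-congˡ eq₂) ⟩
      q * q * r₂ * f + (♯ 2 * r₁ - q₂) * q * (r * f) + (r - ♯ 2 * q₁) * (symbol₂ q q₁ r r₁ * f)
        ≈⟨ solve 7 (λ q q₁ q₂ r r₁ r₂ f →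
             q ⊗ q ⊗ r₂ ⊗ f ⊕ (:♯ 2 ⊗ r₁ ⊖ q₂) ⊗ q ⊗ (r ⊗ f) ⊕ (r ⊖ :♯ 2 ⊗ q₁) ⊗ (:symbol₂ q q₁ r r₁ ⊗ f)
             ⊜ :symbol₃ q q₁ q₂ r r₁ r₂ ⊗ f)
           q q₁ q₂ r r₁ r₂ f ⟩
      symbol₃ q q₁ q₂ r r₁ r₂ * f ∎

  -- With t = u − 1: 1 − t² = z, (t − 1)² (t + 1) = N, 2 (3 t + 5) = M.
  z N M : Carrier
  z = u * (♯ 2 - u)
  N = u * ((u - ♯ 2) * (u - ♯ 2))
  M = ♯ 4 + ♯ 6 * u

  -- The numerators of the ratios of consecutive coefficients: a₂(k + 1) / a₂(k) = 8 κ₂(k) / (k +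
  -- 1)³, and likewise for a₃ and κ₃.
  κ₂ κ₃ : Carrier → Carrier
  κ₂ k = (♯ 2 * k + ♯ 1) * (♯ 4 * k + ♯ 1) * (♯ 4 * k + ♯ 3)
  κ₃ k = ♯ 3 * (♯ 2 * k + ♯ 1) * (♯ 6 * k + ♯ 1) * (♯ 6 * k + ♯ 5)

  private
    :z :N :M : ∀ {n} → Expr ℤ n → Expr ℤ n
    :z u = u ⊗ (:♯ 2 ⊖ u)
    :N u = u ⊗ ((u ⊖ :♯ 2) ⊗ (u ⊖ :♯ 2))
    :M u = :♯ 4 ⊕ :♯ 6 ⊗ u

    :κ₂ :κ₃ : ∀ {n} → Expr ℤ n → Expr ℤ n
    :κ₂ k = (:♯ 2 ⊗ k ⊕ :♯ 1) ⊗ (:♯ 4 ⊗ k ⊕ :♯ 1) ⊗ (:♯ 4 ⊗ k ⊕ :♯ 3)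
    :κ₃ k = :♯ 3 ⊗ (:♯ 2 ⊗ k ⊕ :♯ 1) ⊗ (:♯ 6 ⊗ k ⊕ :♯ 1) ⊗ (:♯ 6 ⊗ k ⊕ :♯ 5)

  quadratic : (a b c : Carrier) → Carrier
  quadratic a b c = a + b * u + c * (u * u)

  private
    :quadratic : ∀ {n} (u a b c : Expr ℤ n) → Expr ℤ n
    :quadratic u a b c = a ⊕ b ⊗ u ⊕ c ⊗ (u ⊗ u)

  θ-quadratic² : ∀ {b c} → Constant b → Constant c →
                 θ (b * u + ♯ 2 * c * (u * u)) ≈ b * u + ♯ 4 * c * (u * u)
  θ-quadratic² {b} {c} cb cc = begin
    θ (b * u + ♯ 2 * c * (u * u))
      ≈⟨ θ-cong (solve 3 (λ u b c → b ⊗ u ⊕ :♯ 2 ⊗ c ⊗ (u ⊗ u) ⊜ :quadratic u (:♯ 0) b (:♯ 2 ⊗ c)) u b c) ⟩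
    θ (quadratic (♯ 0) b (♯ 2 * c))
      ≈⟨ θ-quadratic (θ-integer _) cb (Constant-* (θ-integer _) cc) ⟩
    b * u + ♯ 2 * (♯ 2 * c) * (u * u)
      ≈⟨ solve 3 (λ u b c → b ⊗ u ⊕ :♯ 2 ⊗ (:♯ 2 ⊗ c) ⊗ (u ⊗ u) ⊜ b ⊗ u ⊕ :♯ 4 ⊗ c ⊗ (u ⊗ u)) u b c ⟩
    b * u + ♯ 4 * c * (u * u) ∎

  -- Both `z ^ n` and `N ^ i * M ^ j` have logarithmic derivatives r / q with q and r of degree at
  -- most 2 in u, so all derivatives of q and r can be read off from their coefficients.
  L-quadratic : ∀ {q r} a b c a′ b′ c′ f →
    Constant a → Constant b → Constant c → Constant a′ → Constant b′ → Constant c′ →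
    q ≈ quadratic a b c → r ≈ quadratic a′ b′ c′ → q * θ f ≈ r * f →
    let q₁ = b * u + ♯ 2 * c * (u * u) ; r₁ = b′ * u + ♯ 2 * c′ * (u * u)
        q₂ = b * u + ♯ 4 * c * (u * u) ; r₂ = b′ * u + ♯ 4 * c′ * (u * u) in
    q * q * q * L f ≈ operator (q * q * q) (q * q * r) (q * symbol₂ q q₁ r r₁) (symbol₃ q q₁ q₂ r r₁ r₂) * f
  L-quadratic a b c a′ b′ c′ f ca cb cc ca′ cb′ cc′ q≈ r≈ eq = L-logarithmic f
    (trans (θ-cong q≈) (θ-quadratic ca cb cc)) (θ-quadratic² cb cc)
    (trans (θ-cong r≈) (θ-quadratic ca′ cb′ cc′)) (θ-quadratic² cb′ cc′) eq

  θz : (♯ 2 - u) * θ z ≈ (♯ 2 - ♯ 2 * u) * z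
  θz = begin
    (♯ 2 - u) * θ z
      ≈⟨ *-congˡ (trans (θ-cong (solve 1 (λ u → :z u ⊜ :quadratic u (:♯ 0) (:♯ 2) (Κ -1ℤ)) u))
                        (θ-quadratic (θ-integer _) (θ-integer _) (θ-integer _))) ⟩
    (♯ 2 - u) * (♯ 2 * u + ♯ 2 * # -1ℤ * (u * u))
      ≈⟨ solve 1 (λ u → (:♯ 2 ⊖ u) ⊗ (:♯ 2 ⊗ u ⊕ :♯ 2 ⊗ Κ -1ℤ ⊗ (u ⊗ u)) ⊜ (:♯ 2 ⊖ :♯ 2 ⊗ u) ⊗ :z u) u ⟩
    (♯ 2 - ♯ 2 * u) * z ∎

  -- L behaves like a hypergeometric operator in the variable z: it produces two consecutive powers
  -- of z, up to a factor that does not depend on n. The constant 32 is 256 / 8, with 256 from the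
  -- denominator of the argument and 8 from the recurrence for a₂.
  L-z^ : ∀ n → let q = ♯ 2 - u ; k = ♯ n in
    q * q * q * L (z ^ n) ≈
      (♯ 1 - u) * (q * q) * (♯ 32 * (k * k * k) * z ^ n - κ₂ k * z ^ suc n)
  L-z^ n = trans
    (L-quadratic (♯ 2) (# -1ℤ) (♯ 0) (♯ 2 * ♯ n) (# -[1+ 1 ] * ♯ n) (♯ 0) (z ^ n)
      (θ-integer _) (θ-integer _) (θ-integer _)
      (Constant-* (θ-integer _) (θ-integer _)) (Constant-* (θ-integer _) (θ-integer _)) (θ-integer _)
      (solve 1 (λ u → :♯ 2 ⊖ u ⊜ :quadratic u (:♯ 2) (Κ -1ℤ) (:♯ 0)) u)
      (solve 2 (λ u k → k ⊗ (:♯ 2 ⊖ :♯ 2 ⊗ u)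
          ⊜ :quadratic u (:♯ 2 ⊗ k) (Κ -[1+ 1 ] ⊗ k) (:♯ 0)) u (♯ n))
      (θ-^ z θz n))
    (solve 3 (λ u k x →
       let q  = :♯ 2 ⊖ u
           q₁ = Κ -1ℤ ⊗ u ⊕ :♯ 2 ⊗ :♯ 0 ⊗ (u ⊗ u)
           q₂ = Κ -1ℤ ⊗ u ⊕ :♯ 4 ⊗ :♯ 0 ⊗ (u ⊗ u)
           r  = k ⊗ (:♯ 2 ⊖ :♯ 2 ⊗ u)
           r₁ = Κ -[1+ 1 ] ⊗ k ⊗ u ⊕ :♯ 2 ⊗ :♯ 0 ⊗ (u ⊗ u)
           r₂ = Κ -[1+ 1 ] ⊗ k ⊗ u ⊕ :♯ 4 ⊗ :♯ 0 ⊗ (u ⊗ u)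
       in :operator u (q ⊗ q ⊗ q) (q ⊗ q ⊗ r) (q ⊗ :symbol₂ q q₁ r r₁) (:symbol₃ q q₁ q₂ r r₁ r₂) ⊗ x
          ⊜ (:♯ 1 ⊖ u) ⊗ (q ⊗ q) ⊗ (:♯ 32 ⊗ (k ⊗ k ⊗ k) ⊗ x ⊖ :κ₂ k ⊗ (:z u ⊗ x)))
      u (♯ n) (z ^ n))

  -- Twice the common denominator of the logarithmic derivatives (3 u - 2) / (u - 2) of `N` and 3 u
  -- / (3 u + 2) of `M`. The factor 2 lets the exponent of `M` enter as 2 j only, so that -1/2 is
  -- never divided out.
  q₃ : Carrier
  q₃ = ♯ 2 * (u - ♯ 2) * (♯ 3 * u + ♯ 2)

  private
    :q₃ : ∀ {n} → Expr ℤ n → Expr ℤ n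
    :q₃ u = :♯ 2 ⊗ (u ⊖ :♯ 2) ⊗ (:♯ 3 ⊗ u ⊕ :♯ 2)

  -- The hypothesis says 3 i + j = −1/2, the exponent of 10 + 6 t in the transformation.
  θ[N^*M^] : ∀ i j → ♯ 2 * ♯ j ≈ - (♯ 1 + ♯ 6 * ♯ i) →
    q₃ * θ (N ^ i * M ^ j) ≈ (♯ i * (♯ 36 * u - ♯ 8) - ♯ 3 * u * (u - ♯ 2)) * (N ^ i * M ^ j)
  θ[N^*M^] i j 2j = begin
    q₃ * θ (N ^ i * M ^ j)
      ≈⟨ *-congˡ (θ-* _ _) ⟩
    q₃ * (θ (N ^ i) * M ^ j + N ^ i * θ (M ^ j))
      ≈⟨ solve 5 (λ q x′ y x y′ → q ⊗ (x′ ⊗ y ⊕ x ⊗ y′) ⊜ q ⊗ x′ ⊗ y ⊕ x ⊗ (q ⊗ y′))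
           q₃ (θ (N ^ i)) (M ^ j) (N ^ i) (θ (M ^ j)) ⟩
    q₃ * θ (N ^ i) * M ^ j + N ^ i * (q₃ * θ (M ^ j))
      ≈⟨ +-cong (*-congʳ (θ-^ N θN i)) (*-congˡ (θ-^ M θM j)) ⟩
    ♯ i * (♯ 2 * (♯ 3 * u - ♯ 2) * (♯ 3 * u + ♯ 2)) * N ^ i * M ^ j
      + N ^ i * (♯ j * (♯ 6 * u * (u - ♯ 2)) * M ^ j)
      ≈⟨ solve 5 (λ u i j x y →
           i ⊗ (:♯ 2 ⊗ (:♯ 3 ⊗ u ⊖ :♯ 2) ⊗ (:♯ 3 ⊗ u ⊕ :♯ 2)) ⊗ x ⊗ y ⊕ x ⊗ (j ⊗ (:♯ 6 ⊗ u ⊗ (u ⊖ :♯ 2)) ⊗ y)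
           ⊜ (i ⊗ (:♯ 2 ⊗ (:♯ 3 ⊗ u ⊖ :♯ 2) ⊗ (:♯ 3 ⊗ u ⊕ :♯ 2)) ⊕ :♯ 2 ⊗ j ⊗ (:♯ 3 ⊗ u ⊗ (u ⊖ :♯ 2))) ⊗ (x ⊗ y))
         u (♯ i) (♯ j) (N ^ i) (M ^ j) ⟩
    (♯ i * (♯ 2 * (♯ 3 * u - ♯ 2) * (♯ 3 * u + ♯ 2)) + ♯ 2 * ♯ j * (♯ 3 * u * (u - ♯ 2))) * (N ^ i * M ^ j)
      ≈⟨ *-congʳ (+-congˡ (*-congʳ 2j)) ⟩
    (♯ i * (♯ 2 * (♯ 3 * u - ♯ 2) * (♯ 3 * u + ♯ 2)) + - (♯ 1 + ♯ 6 * ♯ i) * (♯ 3 * u * (u - ♯ 2))) * (N ^ i * M ^ j)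
      ≈⟨ *-congʳ (solve 2 (λ u i →
           i ⊗ (:♯ 2 ⊗ (:♯ 3 ⊗ u ⊖ :♯ 2) ⊗ (:♯ 3 ⊗ u ⊕ :♯ 2)) ⊕ (⊝ (:♯ 1 ⊕ :♯ 6 ⊗ i)) ⊗ (:♯ 3 ⊗ u ⊗ (u ⊖ :♯ 2))
           ⊜ i ⊗ (:♯ 36 ⊗ u ⊖ :♯ 8) ⊖ :♯ 3 ⊗ u ⊗ (u ⊖ :♯ 2)) u (♯ i)) ⟩
    (♯ i * (♯ 36 * u - ♯ 8) - ♯ 3 * u * (u - ♯ 2)) * (N ^ i * M ^ j) ∎
    where
    θ[u-2]² : θ ((u - ♯ 2) * (u - ♯ 2)) ≈ ♯ 2 * u * (u - ♯ 2)
    θ[u-2]² = begin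
      θ ((u - ♯ 2) * (u - ♯ 2))
        ≈⟨ θ-cong (solve 1 (λ u → (u ⊖ :♯ 2) ⊗ (u ⊖ :♯ 2) ⊜ :quadratic u (:♯ 4) (Κ -[1+ 3 ]) (:♯ 1)) u) ⟩
      θ (quadratic (♯ 4) (# -[1+ 3 ]) (♯ 1))
        ≈⟨ θ-quadratic (θ-integer _) (θ-integer _) (θ-integer _) ⟩
      # -[1+ 3 ] * u + ♯ 2 * ♯ 1 * (u * u)
        ≈⟨ solve 1 (λ u → Κ -[1+ 3 ] ⊗ u ⊕ :♯ 2 ⊗ :♯ 1 ⊗ (u ⊗ u) ⊜ :♯ 2 ⊗ u ⊗ (u ⊖ :♯ 2)) u ⟩
      ♯ 2 * u * (u - ♯ 2) ∎

    θN : q₃ * θ N ≈ ♯ 2 * (♯ 3 * u - ♯ 2) * (♯ 3 * u + ♯ 2) * N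
    θN = begin
      q₃ * θ N
        ≈⟨ *-congˡ (trans (θ-* _ _) (+-cong (*-congʳ θu≈u) (*-congˡ θ[u-2]²))) ⟩
      q₃ * (N + u * (♯ 2 * u * (u - ♯ 2)))
        ≈⟨ solve 1 (λ u → :q₃ u ⊗ (:N u ⊕ u ⊗ (:♯ 2 ⊗ u ⊗ (u ⊖ :♯ 2)))
             ⊜ :♯ 2 ⊗ (:♯ 3 ⊗ u ⊖ :♯ 2) ⊗ (:♯ 3 ⊗ u ⊕ :♯ 2) ⊗ :N u) u ⟩
      ♯ 2 * (♯ 3 * u - ♯ 2) * (♯ 3 * u + ♯ 2) * N ∎

    θM : q₃ * θ M ≈ ♯ 6 * u * (u - ♯ 2) * M
    θM = begin
      q₃ * θ M
        ≈⟨ *-congˡ (trans (θ-+ _ _) (+-cong (θ-integer _) (θ-monomial (θ-integer _) θu≈u))) ⟩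
      q₃ * (0# + ♯ 6 * u)
        ≈⟨ *-congˡ (+-identityˡ _) ⟩
      q₃ * (♯ 6 * u)
        ≈⟨ solve 1 (λ u → :q₃ u ⊗ (:♯ 6 ⊗ u) ⊜ :♯ 6 ⊗ u ⊗ (u ⊖ :♯ 2) ⊗ :M u) u ⟩
      ♯ 6 * u * (u - ♯ 2) * M ∎

  -- Here the hypergeometric variable is N / M³: the second product in the bracket is M³ times the
  -- next term `N ^ suc i * M ^ (j − 3)`. The factor M³ stays multiplied in because j may be smaller
  -- than 3, as it is for the last term of the sum.
  L-N^*M^ : ∀ i j → ♯ 2 * ♯ j ≈ - (♯ 1 + ♯ 6 * ♯ i) → let k = ♯ i in
    q₃ * q₃ * q₃ * L (N ^ i * M ^ j) ≈
      ♯ 16 * ((u - ♯ 2) * (u - ♯ 2)) * (♯ 9 * u - ♯ 2)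
        * (♯ 1 * (k * k * k) * (M * M * M * (N ^ i * M ^ j)) - κ₃ k * (N * (N ^ i * M ^ j)))
  L-N^*M^ i j 2j = trans
    (L-quadratic (# -[1+ 7 ]) (# -[1+ 7 ]) (♯ 6) (# -[1+ 7 ] * ♯ i) (♯ 36 * ♯ i + ♯ 6) (# -[1+ 2 ]) (N ^ i * M ^ j)
      (θ-integer _) (θ-integer _) (θ-integer _)
      (Constant-* (θ-integer _) (θ-integer _))
      (trans (θ-+ _ _) (trans (+-cong (Constant-* (θ-integer _) (θ-integer _)) (θ-integer _)) (+-identityˡ _)))
      (θ-integer _)
      (solve 1 (λ u → :q₃ u ⊜ :quadratic u (Κ -[1+ 7 ]) (Κ -[1+ 7 ]) (:♯ 6)) u)
      (solve 2 (λ u k → k ⊗ (:♯ 36 ⊗ u ⊖ :♯ 8) ⊖ :♯ 3 ⊗ u ⊗ (u ⊖ :♯ 2)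
          ⊜ :quadratic u (Κ -[1+ 7 ] ⊗ k) (:♯ 36 ⊗ k ⊕ :♯ 6) (Κ -[1+ 2 ])) u (♯ i))
      (θ[N^*M^] i j 2j))
    (solve 3 (λ u k x →
       let q  = :q₃ u
           q₁ = Κ -[1+ 7 ] ⊗ u ⊕ :♯ 2 ⊗ :♯ 6 ⊗ (u ⊗ u)
           q₂ = Κ -[1+ 7 ] ⊗ u ⊕ :♯ 4 ⊗ :♯ 6 ⊗ (u ⊗ u)
           r  = k ⊗ (:♯ 36 ⊗ u ⊖ :♯ 8) ⊖ :♯ 3 ⊗ u ⊗ (u ⊖ :♯ 2)
           r₁ = (:♯ 36 ⊗ k ⊕ :♯ 6) ⊗ u ⊕ :♯ 2 ⊗ Κ -[1+ 2 ] ⊗ (u ⊗ u)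
           r₂ = (:♯ 36 ⊗ k ⊕ :♯ 6) ⊗ u ⊕ :♯ 4 ⊗ Κ -[1+ 2 ] ⊗ (u ⊗ u)
       in :operator u (q ⊗ q ⊗ q) (q ⊗ q ⊗ r) (q ⊗ :symbol₂ q q₁ r r₁) (:symbol₃ q q₁ q₂ r r₁ r₂) ⊗ x
          ⊜ :♯ 16 ⊗ ((u ⊖ :♯ 2) ⊗ (u ⊖ :♯ 2)) ⊗ (:♯ 9 ⊗ u ⊖ :♯ 2)
             ⊗ (:♯ 1 ⊗ (k ⊗ k ⊗ k) ⊗ (:M u ⊗ :M u ⊗ :M u ⊗ x) ⊖ :κ₃ k ⊗ (:N u ⊗ x)))
      u (♯ i) (N ^ i * M ^ j))

  -- The recurrence for c turns each q L(c k f k) into ρ times the difference of the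
  -- values of − κ k c k w k at k and k − 1.
  L-telescopes : ∀ n {q ρ α} (c κ f v w : ℕ → Carrier) →
    (∀ k → Constant (c k)) →
    (∀ k → k ℕ.≤ n → q * L (f k) ≈ ρ * (α * (♯ k * ♯ k * ♯ k) * v k - κ k * w k)) →
    (∀ k → k ℕ.< n → v (suc k) ≈ w k) →
    (∀ k → α * (♯ suc k * ♯ suc k * ♯ suc k) * c (suc k) ≈ κ k * c k) →
    κ n * c n ≈ 0# →
    q * L (sum≤ n (λ k → c k * f k)) ≈ 0#
  L-telescopes n {q} {ρ} {α} c κ f v w cc Lf v≈w rec last = begin
    q * L (sum≤ n (λ k → c k * f k))  ≈⟨ partial n ℕ.≤-refl ⟩
    - (ρ * (κ n * c n * w n))         ≈⟨ -‿cong (*-congˡ (*-congʳ last)) ⟩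
    - (ρ * (0# * w n))                ≈⟨ -‿cong (*-congˡ (*-congʳ 0-homo)) ⟨
    - (ρ * (♯ 0 * w n))               ≈⟨ solve 2 (λ ρ w → ⊝ (ρ ⊗ (:♯ 0 ⊗ w)) ⊜ :♯ 0) ρ (w n) ⟩
    ♯ 0                               ≈⟨ 0-homo ⟩
    0#                                ∎
    where
    term : ∀ k → k ℕ.≤ n → q * L (c k * f k) ≈ ρ * (α * (♯ k * ♯ k * ♯ k) * c k * v k - κ k * c k * w k)
    term k k≤n = begin
      q * L (c k * f k)     ≈⟨ *-congˡ (L-scale (cc k) (f k)) ⟩
      q * (c k * L (f k))   ≈⟨ solve 3 (λ q c x → q ⊗ (c ⊗ x) ⊜ c ⊗ (q ⊗ x)) q (c k) (L (f k)) ⟩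
      c k * (q * L (f k))   ≈⟨ *-congˡ (Lf k k≤n) ⟩
      c k * (ρ * (α * (♯ k * ♯ k * ♯ k) * v k - κ k * w k))
        ≈⟨ solve 7 (λ c ρ α k v κ w → c ⊗ (ρ ⊗ (α ⊗ (k ⊗ k ⊗ k) ⊗ v ⊖ κ ⊗ w))
             ⊜ ρ ⊗ (α ⊗ (k ⊗ k ⊗ k) ⊗ c ⊗ v ⊖ κ ⊗ c ⊗ w)) (c k) ρ α (♯ k) (v k) (κ k) (w k) ⟩
      ρ * (α * (♯ k * ♯ k * ♯ k) * c k * v k - κ k * c k * w k) ∎

    partial : ∀ j → j ℕ.≤ n → q * L (sum≤ j (λ k → c k * f k)) ≈ - (ρ * (κ j * c j * w j))
    -- At k = 0 the factor k³ removes the `v` term, so the telescoping sum has no lower boundary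
    -- contribution.
    partial zero    0≤n = trans (term 0 0≤n)
      (solve 6 (λ ρ α c v κ w → ρ ⊗ (α ⊗ (:♯ 0 ⊗ :♯ 0 ⊗ :♯ 0) ⊗ c ⊗ v ⊖ κ ⊗ c ⊗ w) ⊜ ⊝ (ρ ⊗ (κ ⊗ c ⊗ w)))
        ρ α (c 0) (v 0) (κ 0) (w 0))
    partial (suc j) j<n = begin
      q * L (sum≤ j (λ k → c k * f k) + c (suc j) * f (suc j))
        ≈⟨ trans (*-congˡ (L-+ _ _)) (distribˡ _ _ _) ⟩
      q * L (sum≤ j (λ k → c k * f k)) + q * L (c (suc j) * f (suc j))
        ≈⟨ +-cong (partial j (ℕ.<⇒≤ j<n)) (trans (term (suc j) j<n)
             (*-congˡ (+-congʳ (*-cong (rec j) (v≈w j j<n))))) ⟩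
      - (ρ * (κ j * c j * w j)) + ρ * (κ j * c j * w j - κ (suc j) * c (suc j) * w (suc j))
        ≈⟨ solve 3 (λ ρ x y → ⊝ (ρ ⊗ x) ⊕ ρ ⊗ (x ⊖ y) ⊜ ⊝ (ρ ⊗ y)) ρ (κ j * c j * w j) (κ (suc j) * c (suc j) * w (suc j)) ⟩
      - (ρ * (κ (suc j) * c (suc j) * w (suc j))) ∎

-- The Euler derivation on power series, the kernel of L, and values of polynomials

module SeriesDerivation {c ℓ} (K : CommutativeRing c ℓ) (φ : IntegersTo K) where
  private
    module K = CommutativeRing K
    module φ = _-Raw-AlmostCommutative⟶_ φ
  open K using (Carrier)
  open PowerSeries K φ public
  open IntegerSolver K φ
  open RingProperties K.ring using (-0#≈0#)
  open ≈-Reasoning K.setoid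

  θ : Series → Series
  θ f n = φ.⟦ + n ⟧ K.* f n

  u : Series
  u zero          = K.0#
  u (suc zero)    = K.1#
  u (suc (suc n)) = K.0#

  θ-cong : ∀ {f g} → f ≈ g → θ f ≈ θ g
  θ-cong f≈g n = K.*-congˡ (f≈g n)

  θ-+ : ∀ f g → θ (f + g) ≈ θ f + θ g
  θ-+ f g n = K.distribˡ φ.⟦ + n ⟧ (f n) (g n)

  tail-θ : ∀ f → tail (θ f) ≈ θ (tail f) + tail f
  tail-θ f n = K.trans (K.*-congʳ (φ.+-homo 1ℤ (+ n)))
    (solve 2 (λ n x → (Κ 1ℤ ⊕ n) ⊗ x ⊜ n ⊗ x ⊕ x) φ.⟦ + n ⟧ (f (suc n)))

  θ-* : ∀ f g → θ (f * g) ≈ θ f * g + f * θ g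
  θ-* f g zero = begin
    φ.⟦ 0ℤ ⟧ K.* (f 0 K.* g 0)
      ≈⟨ solve 2 (λ x y → Κ 0ℤ ⊗ (x ⊗ y) ⊜ Κ 0ℤ ⊗ x ⊗ y ⊕ x ⊗ (Κ 0ℤ ⊗ y)) (f 0) (g 0) ⟩
    φ.⟦ 0ℤ ⟧ K.* f 0 K.* g 0 K.+ f 0 K.* (φ.⟦ 0ℤ ⟧ K.* g 0) ∎
  θ-* f g (suc n) = begin
    φ.⟦ + suc n ⟧ K.* (f 0 K.* g (suc n) K.+ (tail f * g) n)
      ≈⟨ K.trans (K.distribˡ _ _ _) (K.+-congˡ (K.*-congʳ (φ.+-homo 1ℤ (+ n)))) ⟩
    φ.⟦ + suc n ⟧ K.* (f 0 K.* g (suc n)) K.+ (φ.⟦ 1ℤ ⟧ K.+ φ.⟦ + n ⟧) K.* (tail f * g) n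
      ≈⟨ solve 5 (λ s n x y z → s ⊗ (x ⊗ y) ⊕ (Κ 1ℤ ⊕ n) ⊗ z ⊜ x ⊗ (s ⊗ y) ⊕ (n ⊗ z ⊕ z))
           φ.⟦ + suc n ⟧ φ.⟦ + n ⟧ (f 0) (g (suc n)) ((tail f * g) n) ⟩
    f 0 K.* θ g (suc n) K.+ (θ (tail f * g) n K.+ (tail f * g) n)
      ≈⟨ K.+-congˡ (K.+-congʳ (θ-* (tail f) g n)) ⟩
    f 0 K.* θ g (suc n) K.+ ((θ (tail f) * g) n K.+ (tail f * θ g) n K.+ (tail f * g) n)
      ≈⟨ solve 5 (λ s x y z t → s ⊕ (x ⊕ y ⊕ z) ⊜ Κ 0ℤ ⊗ t ⊕ (x ⊕ z) ⊕ (s ⊕ y))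
           (f 0 K.* θ g (suc n)) ((θ (tail f) * g) n) ((tail f * θ g) n) ((tail f * g) n) (f 0 K.* g (suc n)) ⟩
    φ.⟦ 0ℤ ⟧ K.* (f 0 K.* g (suc n)) K.+ ((θ (tail f) * g) n K.+ (tail f * g) n) K.+ (f * θ g) (suc n)
      ≈⟨ K.+-congʳ (K.+-cong (K.sym (K.*-assoc _ _ _)) (K.sym (*-distribʳ g (θ (tail f)) (tail f) n))) ⟩
    θ f 0 K.* g (suc n) K.+ ((θ (tail f) + tail f) * g) n K.+ (f * θ g) (suc n)
      ≈⟨ K.+-congʳ (K.+-congˡ (*-cong (λ i → K.sym (tail-θ f i)) (λ _ → K.refl) n)) ⟩
    (θ f * g) (suc n) K.+ (f * θ g) (suc n) ∎

  θ-constant : ∀ a → θ (constant a) ≈ constant K.0#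
  θ-constant a zero    = K.trans (K.*-congʳ φ.0-homo) (K.zeroˡ a)
  θ-constant a (suc n) = K.zeroʳ _

  θu≈u : θ u ≈ u
  θu≈u zero          = K.zeroʳ _
  θu≈u (suc zero)    = K.trans (K.*-congʳ φ.1-homo) (K.*-identityʳ _)
  θu≈u (suc (suc n)) = K.zeroʳ _

  u*-zero : ∀ f → (u * f) 0 K.≈ K.0#
  u*-zero f = K.zeroˡ (f 0)

  u*-suc : ∀ f n → (u * f) (suc n) K.≈ f n
  u*-suc f n = K.trans (K.+-cong (K.zeroˡ _) (tail-u n)) (K.+-identityˡ _)
    where
    tail-u : tail u * f ≈ f
    tail-u n = K.trans (*-cong (λ { zero → K.refl ; (suc _) → K.refl }) (λ _ → K.refl) n) (*-identityˡ f n)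

  derivation : Derivation ring constants
  derivation = record
    { θ = θ ; θ-cong = λ {f} {g} → θ-cong {f} {g} ; θ-+ = θ-+ ; θ-* = θ-*
    ; θ-integer = λ x → θ-constant φ.⟦ x ⟧ ; u = u ; θu≈u = θu≈u }

  open DifferentialRing ring constants derivation public
    hiding (θ-quadratic; θ-quadratic²; θ-^; θ-monomial; quadratic)

  VanishesBelow : ℕ → Series → Set ℓ
  VanishesBelow n f = ∀ {i} → i ℕ.< n → f i K.≈ K.0#

  *-vanishes : ∀ n f g → VanishesBelow (suc n) g → (f * g) n K.≈ K.0#
  *-vanishes zero    f g g≈0 = K.trans (K.*-congˡ (g≈0 ℕ.≤-refl)) (K.zeroʳ _)
  *-vanishes (suc n) f g g≈0 = K.trans
    (K.+-cong (K.trans (K.*-congˡ (g≈0 ℕ.≤-refl)) (K.zeroʳ _)) (*-vanishes n (tail f) g (λ i<n → g≈0 (ℕ.m<n⇒m<1+n i<n))))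
    (K.+-identityˡ _)

  lowest-coefficient : ∀ n f g → VanishesBelow n g → (f * g) n K.≈ f 0 K.* g n
  lowest-coefficient zero    f g g≈0 = K.refl
  lowest-coefficient (suc n) f g g≈0 = K.trans (K.+-congˡ (*-vanishes n (tail f) g g≈0)) (K.+-identityʳ _)

  Regular : Carrier → Set _
  Regular a = ∀ x → a K.* x K.≈ K.0# → x K.≈ K.0#

  Regular-* : ∀ {a b} → Regular a → Regular b → Regular (a K.* b)
  Regular-* ra rb x abx≈0 = rb x (ra _ (K.trans (K.sym (K.*-assoc _ _ _)) abx≈0))

  vanishes-by-induction : ∀ {f N} → (∀ n → n ℕ.< N → VanishesBelow n f → f n K.≈ K.0#) → VanishesBelow N f
  vanishes-by-induction {f} {N} step {i} i<N = below (suc i) i<N ℕ.≤-refl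
    where
    below : ∀ n → n ℕ.≤ N → VanishesBelow n f
    below (suc n) n<N {i} i<1+n with ℕ.m≤n⇒m<n∨m≡n (ℕ.≤-pred i<1+n)
    ... | inj₁ i<n    = below n (ℕ.<⇒≤ n<N) i<n
    ... | inj₂ ≡.refl = step n n<N (below n (ℕ.<⇒≤ n<N))

  -- By strong induction: if `g` vanishes below n, the coefficient of `f * g` at n is `f 0 * g n`.
  -- This cancels the cubes that `L-z^` and `L-N^*M^` carry on the left.
  *-regular : ∀ f g → Regular (f 0) → f * g ≈ constant K.0# → g ≈ constant K.0#
  *-regular f g reg fg≈0 n = K.trans (vanishes-by-induction
    (λ n _ g≈0 → reg _ (K.trans (K.sym (lowest-coefficient n f g g≈0)) (K.trans (fg≈0 n) (constant0 n)))) (ℕ.n<1+n n))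
    (K.sym (constant0 n))
    where
    constant0 : ∀ n → constant K.0# n K.≈ K.0#
    constant0 zero    = K.refl
    constant0 (suc n) = K.refl

  -- The indicial polynomial of L at u = 0 is 16 n³.
  L-kernel : ∀ {p} → (∀ {n} → 0 ℕ.< n → n ℕ.< p → Regular φ.⟦ + n ⟧) → Regular φ.⟦ + 16 ⟧ →
    ∀ f → L f ≈ constant K.0# → f 0 K.≈ K.0# → VanishesBelow p f
  L-kernel {p} reg reg16 f Lf≈0 f0≈0 = vanishes-by-induction step
    where
    step : ∀ n → n ℕ.< p → VanishesBelow n f → f n K.≈ K.0#
    step zero    _   _   = f0≈0
    -- The parts of L with a factor u only see coefficients below `suc n`, which vanish already.
    -- What remains is 16 (n + 1)³ times the coefficient of f, cancelled one factor at a time; n + 1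
    -- < p is what makes this possible.
    step (suc n) n<p f≈0 = reg-n _ (reg-n _ (reg-n _ (reg16 _ (begin
      φ.⟦ + 16 ⟧ K.* θ³f (suc n)
        ≈⟨ constant-* _ θ³f (suc n) ⟨
      (♯ 16 * θ³f) (suc n)
        ≈⟨ solve 3 (λ x y z → x ⊜ x ⊖ y ⊕ z ⊕ (y ⊖ z)) _ ((u * A) (suc n)) ((u * u * B) (suc n)) ⟩
      L f (suc n) K.+ ((u * A) (suc n) K.- (u * u * B) (suc n))
        ≈⟨ K.+-cong (Lf≈0 (suc n)) (K.+-cong (u*-vanishes A (combination _ _ _ _))
             (K.-‿cong (K.trans (*-assoc u u B (suc n)) (u*-vanishes (u * B) (λ {i} i<1+n → u*B i i<1+n))))) ⟩
      K.0# K.+ (K.0# K.- K.0#)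
        ≈⟨ K.trans (K.+-identityˡ _) (K.-‿inverseʳ _) ⟩
      K.0# ∎))))
      where
      reg-n = reg {suc n} (ℕ.s≤s ℕ.z≤n) n<p
      θ³f = θ (θ (θ f))
      A B : Series
      A = ♯ 16 * θ³f + ♯ 24 * θ (θ f) + ♯ 14 * θ f + ♯ 3 * f
      B = ♯ 4 * θ³f + ♯ 12 * θ (θ f) + ♯ 11 * θ f + ♯ 3 * f

      θ-vanishes : ∀ {g} → VanishesBelow (suc n) g → VanishesBelow (suc n) (θ g)
      θ-vanishes g≈0 i<n = K.trans (K.*-congˡ (g≈0 i<n)) (K.zeroʳ _)

      scaled : ∀ a {g} → VanishesBelow (suc n) g → VanishesBelow (suc n) (constant a * g)
      scaled a {g} g≈0 {i} i<n = K.trans (constant-* a g i) (K.trans (K.*-congˡ (g≈0 i<n)) (K.zeroʳ _))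

      sum : ∀ {g h} → VanishesBelow (suc n) g → VanishesBelow (suc n) h → VanishesBelow (suc n) (g + h)
      sum g≈0 h≈0 i<n = K.trans (K.+-cong (g≈0 i<n) (h≈0 i<n)) (K.+-identityˡ _)

      combination : ∀ a b c d → VanishesBelow (suc n) (♯ a * θ³f + ♯ b * θ (θ f) + ♯ c * θ f + ♯ d * f)
      combination a b c d = sum (sum (sum (scaled _ θ³) (scaled _ θ²)) (scaled _ θ¹)) (scaled _ f≈0)
        where
        θ¹ : VanishesBelow (suc n) (θ f)
        θ¹ = θ-vanishes {f} f≈0
        θ² : VanishesBelow (suc n) (θ (θ f))
        θ² = θ-vanishes {θ f} θ¹
        θ³ : VanishesBelow (suc n) θ³f
        θ³ = θ-vanishes {θ (θ f)} θ²

      u*-vanishes : ∀ g → VanishesBelow (suc n) g → (u * g) (suc n) K.≈ K.0#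
      u*-vanishes g g≈0 = K.trans (u*-suc g n) (g≈0 ℕ.≤-refl)

      u*B : ∀ i → i ℕ.< suc n → (u * B) i K.≈ K.0#
      u*B zero    _   = u*-zero B
      u*B (suc i) i<n = K.trans (u*-suc B i) (combination 4 12 11 3 (ℕ.<-trans (ℕ.n<1+n i) i<n))

  -- HasValue d f x y: f is a polynomial of degree < d, and f(x) = y.
  evaluate : ℕ → Series → Carrier → Carrier
  evaluate zero    f x = K.0#
  evaluate (suc d) f x = f 0 K.+ x K.* evaluate d (tail f) x

  record HasValue (d : ℕ) (f : Series) (x y : Carrier) : Set (c ⊔ ℓ) where
    constructor hasValue
    field
      bounded : ∀ {n} → d ℕ.≤ n → f n K.≈ K.0#
      value   : evaluate d f x K.≈ y
  open HasValue

  evaluate-cong : ∀ d {f g} x → f ≈ g → evaluate d f x K.≈ evaluate d g x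
  evaluate-cong zero    x f≈g = K.refl
  evaluate-cong (suc d) x f≈g = K.+-cong (f≈g 0) (K.*-congˡ (evaluate-cong d x (λ n → f≈g (suc n))))

  evaluate-+ : ∀ d f g x → evaluate d (f + g) x K.≈ evaluate d f x K.+ evaluate d g x
  evaluate-+ zero    f g x = K.sym (K.+-identityˡ _)
  evaluate-+ (suc d) f g x = K.trans (K.+-congˡ (K.*-congˡ (evaluate-+ d (tail f) (tail g) x)))
    (solve 5 (λ a b x s t → a ⊕ b ⊕ x ⊗ (s ⊕ t) ⊜ a ⊕ x ⊗ s ⊕ (b ⊕ x ⊗ t))
      (f 0) (g 0) x (evaluate d (tail f) x) (evaluate d (tail g) x))

  evaluate-∙ : ∀ d a f x → evaluate d (a ∙ f) x K.≈ a K.* evaluate d f x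
  evaluate-∙ zero    a f x = K.sym (K.zeroʳ a)
  evaluate-∙ (suc d) a f x = K.trans (K.+-congˡ (K.*-congˡ (evaluate-∙ d a (tail f) x)))
    (solve 4 (λ a f₀ x s → a ⊗ f₀ ⊕ x ⊗ (a ⊗ s) ⊜ a ⊗ (f₀ ⊕ x ⊗ s)) a (f 0) x (evaluate d (tail f) x))

  evaluate-vanishing : ∀ d f x → VanishesBelow d f → evaluate d f x K.≈ K.0#
  evaluate-vanishing zero    f x f≈0 = K.refl
  evaluate-vanishing (suc d) f x f≈0 = K.trans
    (K.+-cong (f≈0 (ℕ.s≤s ℕ.z≤n)) (K.trans (K.*-congˡ (evaluate-vanishing d (tail f) x (λ i<d → f≈0 (ℕ.s≤s i<d)))) (K.zeroʳ x)))
    (K.+-identityˡ _)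

  evaluate-suc : ∀ d f x → f d K.≈ K.0# → evaluate (suc d) f x K.≈ evaluate d f x
  evaluate-suc zero    f x f≈0 = K.trans (K.+-cong f≈0 (K.zeroʳ x)) (K.+-identityˡ _)
  evaluate-suc (suc d) f x f≈0 = K.+-congˡ (K.*-congˡ (evaluate-suc d (tail f) x f≈0))

  HasValue-cong : ∀ {d f g x y} → f ≈ g → HasValue d f x y → HasValue d g x y
  HasValue-cong {d} {x = x} f≈g (hasValue b v) = hasValue
    (λ {n} d≤n → K.trans (K.sym (f≈g n)) (b d≤n)) (K.trans (evaluate-cong d x (λ n → K.sym (f≈g n))) v)

  HasValue-≤ : ∀ {d e f x y} → d ℕ.≤ e → HasValue d f x y → HasValue e f x y
  HasValue-≤ {d} {e} {f} {x} {y} d≤e h = ≡.subst (λ e → HasValue e f x y) (ℕ.m∸n+n≡m d≤e) (raise (e ∸ d))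
    where
    raise : ∀ k → HasValue (k ℕ.+ d) f x y
    raise zero    = h
    raise (suc k) = hasValue (λ n≥ → bounded h (ℕ.≤-trans (ℕ.m≤n+m d (suc k)) n≥))
      (K.trans (evaluate-suc (k ℕ.+ d) f x (bounded h (ℕ.m≤n+m d k))) (value (raise k)))

  HasValue-+ : ∀ {d f g x y z} → HasValue d f x y → HasValue d g x z → HasValue d (f + g) x (y K.+ z)
  HasValue-+ {d} {f} {g} {x} h k = hasValue
    (λ d≤n → K.trans (K.+-cong (bounded h d≤n) (bounded k d≤n)) (K.+-identityˡ _))
    (K.trans (evaluate-+ d f g x) (K.+-cong (value h) (value k)))

  HasValue-scale : ∀ {d f x y} a → HasValue d f x y → HasValue d (constant a * f) x (a K.* y)
  HasValue-scale {d} {f} {x} a h = HasValue-cong (λ n → K.sym (constant-* a f n)) (hasValue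
    (λ d≤n → K.trans (K.*-congˡ (bounded h d≤n)) (K.zeroʳ a))
    (K.trans (evaluate-∙ d a f x) (K.*-congˡ (value h))))

  HasValue-1 : ∀ {x} → HasValue 1 (constant K.1#) x K.1#
  HasValue-1 {x} = hasValue (λ { {suc n} _ → K.refl }) (K.trans (K.+-congˡ (K.zeroʳ x)) (K.+-identityʳ _))

  HasValue-u* : ∀ {d f x y} → HasValue d f x y → HasValue (suc d) (u * f) x (x K.* y)
  HasValue-u* {d} {f} {x} h = hasValue
    (λ { {suc n} (ℕ.s≤s d≤n) → K.trans (u*-suc f n) (bounded h d≤n) })
    (K.trans (K.+-cong (u*-zero f) (K.*-congˡ (K.trans (evaluate-cong d x (u*-suc f)) (value h)))) (K.+-identityˡ _))

  value-cong : ∀ {d f x y z} → y K.≈ z → HasValue d f x y → HasValue d f x z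
  value-cong y≈z (hasValue b v) = hasValue b (K.trans v y≈z)

  -- General products need not be evaluated: `z`, `N` and `M` are products of u and linear factors,
  -- each of which raises the degree bound by one.
  HasValue-linear* : ∀ {d f x y} a b → HasValue d f x y →
    HasValue (suc d) ((constant a + constant b * u) * f) x ((a K.+ b K.* x) K.* y)
  HasValue-linear* {d} {f} {x} {y} a b h = HasValue-cong
    (λ n → K.trans (K.+-congˡ (K.sym (*-assoc (constant b) u f n))) (K.sym (*-distribʳ f (constant a) (constant b * u) n)))
    (value-cong (solve 4 (λ a b x y → a ⊗ y ⊕ b ⊗ (x ⊗ y) ⊜ (a ⊕ b ⊗ x) ⊗ y) a b x y)
      (HasValue-+ (HasValue-≤ (ℕ.n≤1+n d) (HasValue-scale a h)) (HasValue-scale b (HasValue-u* h))))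

  HasValue-sum≤ : ∀ {d x} n {f y} → (∀ k → k ℕ.≤ n → HasValue d (f k) x (y k)) →
    HasValue d (FiniteSums.sum≤ ring n f) x (FiniteSums.sum≤ K n y)
  HasValue-sum≤ zero    h = h 0 ℕ.≤-refl
  HasValue-sum≤ (suc n) h = HasValue-+ (HasValue-sum≤ n (λ k k≤n → h k (ℕ.m≤n⇒m≤1+n k≤n))) (h (suc n) ℕ.≤-refl)

  sum≤-head : ∀ n f → (∀ k → f (suc k) 0 K.≈ K.0#) → FiniteSums.sum≤ ring n f 0 K.≈ f 0 0
  sum≤-head zero    f f≈0 = K.refl
  sum≤-head (suc n) f f≈0 = K.trans (K.+-cong (sum≤-head n f f≈0) (f≈0 n)) (K.+-identityʳ _)

  -- Scalars of the series ring such as `κ₂ (♯ k)` are compound expressions and not of the form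
  -- `constant a`. With this predicate an equation between them is checked on constant terms, where
  -- series operations compute to those of the coefficient ring.
  record HasOnlyConstantTerm (f : Series) : Set ℓ where
    constructor onlyConstantTerm
    field higher : ∀ n → f (suc n) K.≈ K.0#
  open HasOnlyConstantTerm

  constant-only : ∀ a → HasOnlyConstantTerm (constant a)
  constant-only a = onlyConstantTerm (λ n → K.refl)

  +-only : ∀ {f g} → HasOnlyConstantTerm f → HasOnlyConstantTerm g → HasOnlyConstantTerm (f + g)
  +-only f₀ g₀ = onlyConstantTerm (λ n → K.trans (K.+-cong (higher f₀ n) (higher g₀ n)) (K.+-identityˡ _))

  neg-only : ∀ {f} → HasOnlyConstantTerm f → HasOnlyConstantTerm (- f)
  neg-only f₀ = onlyConstantTerm (λ n → K.trans (K.-‿cong (higher f₀ n)) -0#≈0#)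

  *-only : ∀ {f g} → HasOnlyConstantTerm f → HasOnlyConstantTerm g → HasOnlyConstantTerm (f * g)
  *-only {f} {g} f₀ g₀ = onlyConstantTerm (λ n → K.trans
    (K.+-cong (K.trans (K.*-congˡ (higher g₀ n)) (K.zeroʳ _)) (*-zeroˡ (tail f) g (higher f₀) n)) (K.+-identityˡ _))

  only-constant-terms : ∀ {f g} → HasOnlyConstantTerm f → HasOnlyConstantTerm g → f 0 K.≈ g 0 → f ≈ g
  only-constant-terms f₀ g₀ eq zero    = eq
  only-constant-terms f₀ g₀ eq (suc n) = K.trans (higher f₀ n) (K.sym (higher g₀ n))

-- Binomial coefficients at a prime, and the integers modulo p

nCk*k!*[n∸k]!≡n! : ∀ {n k} → k ℕ.≤ n → (n C k) ℕ.* (k ! ℕ.* (n ∸ k) !) ≡ n !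
nCk*k!*[n∸k]!≡n! {n} {k} k≤n = ≡.trans
  (≡.cong (ℕ._* (k ! ℕ.* (n ∸ k) !)) (nCk≡n!/k![n-k]! k≤n))
  (m/n*n≡m (≡.subst (ℕ∣._∣ n !) (ℕ.*-comm ((n ∸ k) !) (k !)) ([n∸k]!k!∣n! k≤n)))
  where instance _ = ℕ._!*_!≢0 k (n ∸ k)

module _ {p : ℕ} (p-prime : Prime p) where

  prime>1 : 1 ℕ.< p
  prime>1 = ℕ.nonTrivial⇒n>1 p {{prime⇒nonTrivial p-prime}}

  prime∤k! : ∀ {k} → k ℕ.< p → ¬ p ℕ∣.∣ k !
  prime∤k! {zero}  _   p∣1 = ℕ.<⇒≢ prime>1 (≡.sym (ℕ∣.∣1⇒≡1 p∣1))
  prime∤k! {suc k} k<p p∣k! with euclidsLemma (suc k) (k !) p-prime p∣k!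
  ... | inj₁ p∣1+k = ℕ.<⇒≱ k<p (ℕ∣.∣⇒≤ p∣1+k)
  ... | inj₂ p∣k!  = prime∤k! (ℕ.<-trans (ℕ.n<1+n k) k<p) p∣k!

  prime∣pCk : ∀ {k} → 0 ℕ.< k → k ℕ.< p → p ℕ∣.∣ p C k
  prime∣pCk {k} 0<k k<p with euclidsLemma (p C k) (k ! ℕ.* (p ∸ k) !) p-prime
                              (≡.subst (p ℕ∣.∣_) (≡.sym (nCk*k!*[n∸k]!≡n! (ℕ.<⇒≤ k<p))) (p∣p! (ℕ.<⇒≤ prime>1)))
    where
    p∣p! : ∀ {n} → 0 ℕ.< n → n ℕ∣.∣ n !
    p∣p! {suc n} _ = ℕ∣.m∣m*n (n !)
  ... | inj₁ p∣C = p∣C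
  ... | inj₂ p∣k![p-k]! with euclidsLemma (k !) ((p ∸ k) !) p-prime p∣k![p-k]!
  ...   | inj₁ p∣k!     = ⊥-elim (prime∤k! k<p p∣k!)
  ...   | inj₂ p∣[p-k]! = ⊥-elim (prime∤k! (ℕ.∸-monoʳ-< 0<k (ℕ.<⇒≤ k<p)) p∣[p-k]!)

module Modulo (p : ℕ) where

  infix 4 _≈_

  -- A record instead of bare divisibility, so that both sides of a congruence can be inferred from
  -- its type.
  record _≈_ (x y : ℤ) : Set where
    constructor congruent
    field p∣x-y : + p ∣ (x ℤ.- y)
  open _≈_ public

  private
    via : ∀ {a b} → + p ∣ a → a ≡ b → + p ∣ b
    via d eq = ≡.subst (+ p ∣_) eq d

    open +-*-Solver

  ≡⇒≈ : ∀ {x y} → x ≡ y → x ≈ y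
  ≡⇒≈ {x} ≡.refl = congruent (divides 0ℤ (ℤ.+-inverseʳ x))

  ≈-sym : ∀ {x y} → x ≈ y → y ≈ x
  ≈-sym {x} {y} (congruent d) = congruent (via (∣n⇒∣m*n -1ℤ d)
    (solve 2 (λ x y → con -1ℤ :* (x :- y) := y :- x) ≡.refl x y))

  ≈-trans : ∀ {x y z} → x ≈ y → y ≈ z → x ≈ z
  ≈-trans {x} {y} {z} (congruent d) (congruent e) = congruent (via (∣m∣n⇒∣m+n d e)
    (solve 3 (λ x y z → (x :- y) :+ (y :- z) := x :- z) ≡.refl x y z))

  +-cong : ∀ {x y u v} → x ≈ y → u ≈ v → x ℤ.+ u ≈ y ℤ.+ v
  +-cong {x} {y} {u} {v} (congruent d) (congruent e) = congruent (via (∣m∣n⇒∣m+n d e)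
    (solve 4 (λ x y u v → (x :- y) :+ (u :- v) := (x :+ u) :- (y :+ v)) ≡.refl x y u v))

  *-cong : ∀ {x y u v} → x ≈ y → u ≈ v → x ℤ.* u ≈ y ℤ.* v
  *-cong {x} {y} {u} {v} (congruent d) (congruent e) = congruent (via (∣m∣n⇒∣m+n (∣n⇒∣m*n u d) (∣n⇒∣m*n y e))
    (solve 4 (λ x y u v → u :* (x :- y) :+ y :* (u :- v) := x :* u :- y :* v) ≡.refl x y u v))

  neg-cong : ∀ {x y} → x ≈ y → ℤ.- x ≈ ℤ.- y
  neg-cong {x} {y} (congruent d) = congruent (via (∣n⇒∣m*n -1ℤ d)
    (solve 2 (λ x y → con -1ℤ :* (x :- y) := (:- x) :- (:- y)) ≡.refl x y))

  ring : CommutativeRing _ _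
  ring = record
    { Carrier = ℤ ; _≈_ = _≈_ ; _+_ = ℤ._+_ ; _*_ = ℤ._*_ ; -_ = ℤ.-_ ; 0# = 0ℤ ; 1# = 1ℤ
    ; isCommutativeRing = record
      { isRing = record
        { +-isAbelianGroup = record
          { isGroup = record
            { isMonoid = record
              { isSemigroup = record
                { isMagma = record
                  { isEquivalence = record { refl = ≡⇒≈ ≡.refl ; sym = ≈-sym ; trans = ≈-trans }
                  ; ∙-cong = +-cong }
                ; assoc = λ x y z → ≡⇒≈ (ℤ.+-assoc x y z) }
              ; identity = ≡⇒≈ ∘ ℤ.+-identityˡ , ≡⇒≈ ∘ ℤ.+-identityʳ }
            ; inverse = ≡⇒≈ ∘ ℤ.+-inverseˡ , ≡⇒≈ ∘ ℤ.+-inverseʳ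
            ; ⁻¹-cong = neg-cong }
          ; comm = λ x y → ≡⇒≈ (ℤ.+-comm x y) }
        ; *-cong = *-cong
        ; *-assoc = λ x y z → ≡⇒≈ (ℤ.*-assoc x y z)
        ; *-identity = ≡⇒≈ ∘ ℤ.*-identityˡ , ≡⇒≈ ∘ ℤ.*-identityʳ
        ; distrib = (λ x y z → ≡⇒≈ (ℤ.*-distribˡ-+ x y z)) , (λ x y z → ≡⇒≈ (ℤ.*-distribʳ-+ x y z)) }
      ; *-comm = λ x y → ≡⇒≈ (ℤ.*-comm x y) } }

  integers : IntegersTo ring
  integers = record
    { ⟦_⟧ = λ x → x
    ; +-homo = λ _ _ → ≡⇒≈ ≡.refl ; *-homo = λ _ _ → ≡⇒≈ ≡.refl ; -‿homo = λ _ → ≡⇒≈ ≡.refl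
    ; 0-homo = ≡⇒≈ ≡.refl ; 1-homo = ≡⇒≈ ≡.refl }

  ∣⇒≈0 : ∀ {x} → + p ∣ x → x ≈ 0ℤ
  ∣⇒≈0 {x} d = congruent (via d (≡.sym (ℤ.+-identityʳ x)))

  ≈0⇒∣ : ∀ {x} → x ≈ 0ℤ → + p ∣ x
  ≈0⇒∣ {x} (congruent d) = via d (ℤ.+-identityʳ x)

-- The field with p elements, presented as an image of ℤ with kernel p ℤ and without zero divisors.
-- Inverses are not among the data; Fermat's theorem provides them as powers x^(p - 2).
record PrimeField (p : ℕ) {c ℓ} (K : CommutativeRing c ℓ) (φ : IntegersTo K) : Set (c ⊔ ℓ) where
  open CommutativeRing K
  open _-Raw-AlmostCommutative⟶_ φ renaming (⟦_⟧ to #_)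
  field
    p-prime        : Prime p
    ∣⇒≈0           : ∀ {x} → + p ∣ x → # x ≈ 0#
    ≈0⇒∣           : ∀ {x} → # x ≈ 0# → + p ∣ x
    *-zero-divisor : ∀ x y → x * y ≈ 0# → x ≈ 0# ⊎ y ≈ 0#
    surjective     : ∀ z → ∃[ x ] # x ≈ z

-- Fermat's little theorem and Euler's criterion

module FiniteField {p : ℕ} {c ℓ} (K : CommutativeRing c ℓ) (φ : IntegersTo K) (𝔽 : PrimeField p K φ) where

  open CommutativeRing K
  open _-Raw-AlmostCommutative⟶_ φ renaming (⟦_⟧ to #_)
  open PrimeField 𝔽
  open IntegerSolver K φ
  open Exp semiring using (_^_; ^-congˡ; ^-assocʳ)
  open CommutativeExp commutativeSemiring using (^-distrib-*)
  open Mult semiring using () renaming (_×_ to _·_)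
  open RingProperties (CommutativeRing.ring K) using (x∙y⁻¹≈ε⇒x≈y; -‿distribʳ-*; -0#≈0#; -‿involutive)
  open ≈-Reasoning setoid

  infix 9 ♯_
  ♯_ : ℕ → Carrier
  ♯ n = # (+ n)

  *-cancel : ∀ {x y} → ¬ x ≈ 0# → x * y ≈ 0# → y ≈ 0#
  *-cancel {x} {y} x≉0 xy≈0 = [ ⊥-elim ∘ x≉0 , (λ y≈0 → y≈0) ]′ (*-zero-divisor x y xy≈0)

  p≈0 : ♯ p ≈ 0#
  p≈0 = ∣⇒≈0 (divides 1ℤ (≡.sym (ℤ.*-identityˡ (+ p))))

  0<n<p⇒n≉0 : ∀ {n} → 0 ℕ.< n → n ℕ.< p → ¬ ♯ n ≈ 0#
  0<n<p⇒n≉0 {suc n} _ n<p n≈0 = ℕ.<⇒≱ n<p (ℕ∣.∣⇒≤ (∣⇒∣ᵤ (≈0⇒∣ n≈0)))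

  1≉0 : ¬ 1# ≈ 0#
  1≉0 = 0<n<p⇒n≉0 (ℕ.s≤s ℕ.z≤n) (prime>1 p-prime) ∘ trans 1-homo

  1^n≈1 : ∀ n → 1# ^ n ≈ 1#
  1^n≈1 zero    = refl
  1^n≈1 (suc n) = trans (*-identityˡ (1# ^ n)) (1^n≈1 n)

  ^-≉0 : ∀ {x} n → ¬ x ≈ 0# → ¬ x ^ n ≈ 0#
  ^-≉0 zero    x≉0 = 1≉0
  ^-≉0 (suc n) x≉0 = ^-≉0 n x≉0 ∘ *-cancel x≉0

  n·y≈n*y : ∀ n y → n · y ≈ ♯ n * y
  n·y≈n*y zero    y = trans (sym (zeroˡ y)) (*-congʳ (sym 0-homo))
  n·y≈n*y (suc n) y = begin
    y + n · y         ≈⟨ +-congˡ (n·y≈n*y n y) ⟩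
    y + ♯ n * y       ≈⟨ solve 2 (λ n y → y ⊕ n ⊗ y ⊜ (Κ 1ℤ ⊕ n) ⊗ y) (♯ n) y ⟩
    (♯ 1 + ♯ n) * y   ≈⟨ *-congʳ (+-homo 1ℤ (+ n)) ⟨
    ♯ suc n * y       ∎

  frobenius : ∀ x → (x + 1#) ^ p ≈ x ^ p + 1#
  frobenius x = go p ≡.refl
    where
    go : ∀ n → n ≡ p → (x + 1#) ^ n ≈ x ^ n + 1#
    go zero        0≡p = ⊥-elim (ℕ.<⇒≱ (ℕ.<-trans (ℕ.s≤s ℕ.z≤n) (prime>1 p-prime)) (ℕ.≤-reflexive (≡.sym 0≡p)))
    go n@(suc n-1) ≡.refl = begin
      (x + 1#) ^ n
        ≈⟨ Binomial.theorem commutativeSemiring n x 1# ⟩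
      sum t
        ≈⟨ +-cong (trans (+-identityʳ _) (trans (*-identityˡ _) (1^n≈1 n))) (sum-init-last (t ∘ Fin.suc)) ⟩
      1# + (sum (t ∘ Fin.suc ∘ inject₁) + t (fromℕ n))
        ≈⟨ +-congˡ (+-cong (trans (sum-cong-≋ middle) (sum-replicate-zero n-1)) last) ⟩
      1# + (0# + x ^ n)
        ≈⟨ trans (+-congˡ (+-identityˡ _)) (+-comm 1# _) ⟩
      x ^ n + 1# ∎
      where
      open Sum +-monoid
      t : Fin (suc n) → Carrier
      t = Binomial.binomialTerm commutativeSemiring x 1# n

      middle : ∀ i → t (Fin.suc (inject₁ i)) ≈ 0#
      middle i = trans (n·y≈n*y (n C suc (toℕ (inject₁ i))) b) (trans (*-congʳ (∣⇒≈0 (∣ᵤ⇒∣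
        (prime∣pCk p-prime (ℕ.s≤s ℕ.z≤n) (ℕ.s≤s (≡.subst (ℕ._< n-1) (≡.sym (Fin.toℕ-inject₁ i)) (Fin.toℕ<n i))))))) (zeroˡ b))
        where b = Binomial.binomial commutativeSemiring x 1# n (Fin.suc (inject₁ i))

      last : t (fromℕ n) ≈ x ^ n
      last rewrite Fin.toℕ-fromℕ n-1 | nCn≡1 n | ℕ.n∸n≡0 n-1 =
        trans (+-identityʳ _) (*-identityʳ _)

  n^p≈n : ∀ n → (♯ n) ^ p ≈ ♯ n
  n^p≈n zero = 0^ (ℕ.<⇒≤ (prime>1 p-prime))
    where
    0^ : ∀ {n} → 0 ℕ.< n → (♯ 0) ^ n ≈ ♯ 0
    0^ {suc n} _ = trans (*-congʳ 0-homo) (trans (zeroˡ _) (sym 0-homo))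
  n^p≈n (suc n) = begin
    (♯ suc n) ^ p     ≈⟨ ^-congˡ p 1+n ⟩
    (♯ n + 1#) ^ p    ≈⟨ frobenius (♯ n) ⟩
    (♯ n) ^ p + 1#    ≈⟨ +-congʳ (n^p≈n n) ⟩
    ♯ n + 1#          ≈⟨ 1+n ⟨
    ♯ suc n           ∎
    where
    1+n : ♯ suc n ≈ ♯ n + 1#
    1+n = trans (+-homo 1ℤ (+ n)) (trans (+-congʳ 1-homo) (+-comm 1# _))

  x^p≈x : ∀ x → (# x) ^ p ≈ # x
  x^p≈x (+ n) = n^p≈n n
  -- A negative integer is congruent to a product of naturals, -(n + 1) ≡ (n + 1)(p - 1), so the
  -- parity of p does not enter.
  x^p≈x -[1+ n ] = begin
    (# -[1+ n ]) ^ p                    ≈⟨ ^-congˡ p -[1+n]≈ ⟩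
    (♯ suc n * ♯ (p ∸ 1)) ^ p           ≈⟨ ^-distrib-* (♯ suc n) _ p ⟩
    (♯ suc n) ^ p * ♯ (p ∸ 1) ^ p       ≈⟨ *-cong (n^p≈n (suc n)) (n^p≈n (p ∸ 1)) ⟩
    ♯ suc n * ♯ (p ∸ 1)                 ≈⟨ -[1+n]≈ ⟨
    # -[1+ n ]                          ∎
    where
    p-1 : ♯ p ≈ ♯ 1 + ♯ (p ∸ 1)
    p-1 = trans (reflexive (≡.cong ♯_ (≡.sym (ℕ.m+[n∸m]≡n (ℕ.<⇒≤ (prime>1 p-prime)))))) (+-homo 1ℤ (+ (p ∸ 1)))
    -[1+n]≈ : # -[1+ n ] ≈ ♯ suc n * ♯ (p ∸ 1)
    -[1+n]≈ = begin
      # (ℤ.- (+ suc n))                       ≈⟨ -‿homo (+ suc n) ⟩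
      - ♯ suc n
        ≈⟨ solve 2 (λ y r → ⊝ y ⊜ y ⊗ r ⊖ y ⊗ (Κ 1ℤ ⊕ r)) (♯ suc n) (♯ (p ∸ 1)) ⟩
      ♯ suc n * ♯ (p ∸ 1) - ♯ suc n * (♯ 1 + ♯ (p ∸ 1))
        ≈⟨ +-congˡ (-‿cong (*-congˡ (trans (sym p-1) (trans p≈0 (sym 0-homo))))) ⟩
      ♯ suc n * ♯ (p ∸ 1) - ♯ suc n * ♯ 0
        ≈⟨ solve 2 (λ y r → y ⊗ r ⊖ y ⊗ Κ 0ℤ ⊜ y ⊗ r) (♯ suc n) (♯ (p ∸ 1)) ⟩
      ♯ suc n * ♯ (p ∸ 1)                     ∎

  x^[p-1]≈1 : ∀ x → ¬ # x ≈ 0# → (# x) ^ (p ∸ 1) ≈ 1#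
  x^[p-1]≈1 x x≉0 = x∙y⁻¹≈ε⇒x≈y _ _ (*-cancel x≉0 (begin
    # x * ((# x) ^ (p ∸ 1) - 1#)
      ≈⟨ trans (distribˡ _ _ _) (+-congˡ (sym (-‿distribʳ-* _ _))) ⟩
    # x * (# x) ^ (p ∸ 1) - # x * 1#
      ≈⟨ +-cong (reflexive (≡.cong ((# x) ^_) (ℕ.m+[n∸m]≡n (ℕ.<⇒≤ (prime>1 p-prime))))) (-‿cong (*-identityʳ _)) ⟩
    (# x) ^ p - # x
      ≈⟨ +-congʳ (x^p≈x x) ⟩
    # x - # x
      ≈⟨ -‿inverseʳ _ ⟩
    0# ∎))

  -- Polynomial functions, by the condition that difference quotients have lower degree.
  Degree≤ : ℕ → (Carrier → Carrier) → Set (c ⊔ ℓ)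
  Degree≤ zero    f = ∀ x y → Lift c (f x ≈ f y)
  Degree≤ (suc d) f = ∀ a → ∃[ g ] Degree≤ d g × (∀ x → f x - f a ≈ (x - a) * g x)

  Degree≤-const : ∀ d a → Degree≤ d (λ _ → a)
  Degree≤-const zero    a x y = lift refl
  Degree≤-const (suc d) a b = (λ _ → 0#) , Degree≤-const d 0# ,
    λ x → trans (-‿inverseʳ a) (sym (zeroʳ _))

  Degree≤-+ : ∀ d {f g} → Degree≤ d f → Degree≤ d g → Degree≤ d (λ x → f x + g x)
  Degree≤-+ zero    p q x y = lift (+-cong (lower (p x y)) (lower (q x y)))
  Degree≤-+ (suc d) {f} {g} p q a with p a | q a
  ... | f′ , df , ef | g′ , dg , eg = (λ x → f′ x + g′ x) , Degree≤-+ d df dg , λ x → begin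
    f x + g x - (f a + g a)
      ≈⟨ solve 4 (λ u v s t → u ⊕ v ⊖ (s ⊕ t) ⊜ (u ⊖ s) ⊕ (v ⊖ t)) (f x) (g x) (f a) (g a) ⟩
    f x - f a + (g x - g a)              ≈⟨ +-cong (ef x) (eg x) ⟩
    (x - a) * f′ x + (x - a) * g′ x      ≈⟨ distribˡ _ _ _ ⟨
    (x - a) * (f′ x + g′ x)              ∎

  Degree≤-scale : ∀ d b {f} → Degree≤ d f → Degree≤ d (λ x → b * f x)
  Degree≤-scale zero    b p x y = lift (*-congˡ (lower (p x y)))
  Degree≤-scale (suc d) b {f} p a with p a
  ... | f′ , df , ef = (λ x → b * f′ x) , Degree≤-scale d b df , λ x → begin
    b * f x - b * f a         ≈⟨ solve 3 (λ b u v → b ⊗ u ⊖ b ⊗ v ⊜ b ⊗ (u ⊖ v)) b (f x) (f a) ⟩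
    b * (f x - f a)           ≈⟨ *-congˡ (ef x) ⟩
    b * ((x - a) * f′ x)      ≈⟨ solve 3 (λ b u v → b ⊗ (u ⊗ v) ⊜ u ⊗ (b ⊗ v)) b (x - a) (f′ x) ⟩
    (x - a) * (b * f′ x)      ∎

  Degree≤-suc : ∀ d {f} → Degree≤ d f → Degree≤ (suc d) f
  Degree≤-suc zero    p a = (λ _ → 0#) , Degree≤-const 0 0# ,
    λ x → trans (+-congʳ (lower (p x a))) (trans (-‿inverseʳ _) (sym (zeroʳ _)))
  Degree≤-suc (suc d) p a with p a
  ... | f′ , df , ef = f′ , Degree≤-suc d df , ef

  Degree≤-x* : ∀ d {f} → Degree≤ d f → Degree≤ (suc d) (λ x → x * f x)
  Degree≤-x* zero    {f} p a = f , p , λ x → trans (+-congˡ (-‿cong (*-congˡ (lower (p a x)))))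
    (solve 3 (λ x a u → x ⊗ u ⊖ a ⊗ u ⊜ (x ⊖ a) ⊗ u) x a (f x))
  Degree≤-x* (suc d) {f} p a with p a
  ... | g , dg , eg = (λ x → f x + a * g x) , Degree≤-+ (suc d) p (Degree≤-suc d (Degree≤-scale d a dg)) , λ x → begin
    x * f x - a * f a
      ≈⟨ solve 4 (λ x a u v → x ⊗ u ⊖ a ⊗ v ⊜ (x ⊖ a) ⊗ u ⊕ a ⊗ (u ⊖ v)) x a (f x) (f a) ⟩
    (x - a) * f x + a * (f x - f a)
      ≈⟨ +-congˡ (*-congˡ (eg x)) ⟩
    (x - a) * f x + a * ((x - a) * g x)
      ≈⟨ solve 4 (λ u v a g → u ⊗ v ⊕ a ⊗ (u ⊗ g) ⊜ u ⊗ (v ⊕ a ⊗ g)) (x - a) (f x) a (g x) ⟩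
    (x - a) * (f x + a * g x) ∎

  Degree≤-^ : ∀ n → Degree≤ n (_^ n)
  Degree≤-^ zero    = Degree≤-const 0 1#
  Degree≤-^ (suc n) = Degree≤-x* n (Degree≤-^ n)

  -- The difference quotient at `r 0` has lower degree and vanishes at the remaining roots, because
  -- the differences `r j - r 0` can be cancelled. Concluding that f vanishes as a function allows f
  -- to be tested at a point outside the list `r`.
  too-many-roots : ∀ d {f} → Degree≤ d f → (r : ℕ → Carrier) →
    (∀ {i j} → i ℕ.< j → j ℕ.≤ d → ¬ r j - r i ≈ 0#) →
    (∀ {i} → i ℕ.≤ d → f (r i) ≈ 0#) → ∀ x → f x ≈ 0#
  too-many-roots zero    p r distinct root x = trans (lower (p x (r 0))) (root ℕ.z≤n)
  too-many-roots (suc d) {f} p r distinct root x with p (r 0)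
  ... | g , dg , eg = begin
    f x                   ≈⟨ trans (+-congˡ (-‿cong (root ℕ.z≤n))) (trans (+-congˡ -0#≈0#) (+-identityʳ _)) ⟨
    f x - f (r 0)         ≈⟨ eg x ⟩
    (x - r 0) * g x       ≈⟨ *-congˡ (too-many-roots d dg (r ∘ suc) (λ i<j j≤d → distinct (ℕ.s≤s i<j) (ℕ.s≤s j≤d)) g-root x) ⟩
    (x - r 0) * 0#        ≈⟨ zeroʳ _ ⟩
    0#                    ∎
    where
    g-root : ∀ {i} → i ℕ.≤ d → g (r (suc i)) ≈ 0#
    g-root {i} i≤d = *-cancel (distinct (ℕ.s≤s ℕ.z≤n) (ℕ.s≤s i≤d)) (trans (sym (eg (r (suc i))))
      (trans (+-cong (root (ℕ.s≤s i≤d)) (-‿cong (root ℕ.z≤n))) (-‿inverseʳ 0#)))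

  module Euler {m : ℕ} (p≡1+2m : p ≡ suc (2 ℕ.* m)) (0<m : 0 ℕ.< m) where

    x²^m≈1 : ∀ x → ¬ # x ≈ 0# → (# x * # x) ^ m ≈ 1#
    x²^m≈1 x x≉0 = begin
      (# x * # x) ^ m            ≈⟨ ^-congˡ m (*-congˡ (*-identityʳ _)) ⟨
      ((# x) ^ 2) ^ m            ≈⟨ ^-assocʳ (# x) 2 m ⟩
      (# x) ^ (2 ℕ.* m)          ≡⟨ ≡.cong (λ n → (# x) ^ (n ∸ 1)) p≡1+2m ⟨
      (# x) ^ (p ∸ 1)            ≈⟨ x^[p-1]≈1 x x≉0 ⟩
      1#                         ∎

    residue : ∀ {x y} → ¬ # x ≈ 0# → # y * # y ≈ # x → (# x) ^ m ≈ 1#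
    residue {x} {y} x≉0 y²≈x = trans (^-congˡ m (sym y²≈x))
      (x²^m≈1 y (λ y≈0 → x≉0 (trans (sym y²≈x) (trans (*-congʳ y≈0) (zeroˡ _)))))

    -- The m nonzero squares are roots of Xᵐ − 1, so a nonsquare is not.
    nonresidue : ∀ {x} → ¬ # x ≈ 0# → (∀ y → ¬ # y * # y ≈ # x) → (# x) ^ m ≈ - 1#
    nonresidue {x} x≉0 nonsquare = [ ⊥-elim ∘ x^m≉1 , x∙y⁻¹≈ε⇒x≈y _ _ ∘ trans (+-congˡ (-‿involutive 1#)) ]′
      (*-zero-divisor ((# x) ^ m - 1#) ((# x) ^ m + 1#) (begin
        ((# x) ^ m - 1#) * ((# x) ^ m + 1#)
          ≈⟨ *-cong (+-congˡ (-‿cong (sym 1-homo))) (+-congˡ (sym 1-homo)) ⟩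
        ((# x) ^ m - ♯ 1) * ((# x) ^ m + ♯ 1)
          ≈⟨ solve 1 (λ y → (y ⊖ Κ 1ℤ) ⊗ (y ⊕ Κ 1ℤ) ⊜ y ⊗ y ⊖ Κ 1ℤ) ((# x) ^ m) ⟩
        (# x) ^ m * (# x) ^ m - ♯ 1
          ≈⟨ +-cong (trans (sym (^-distrib-* (# x) (# x) m)) (x²^m≈1 x x≉0)) (-‿cong 1-homo) ⟩
        1# - 1#
          ≈⟨ -‿inverseʳ 1# ⟩
        0# ∎))
      where
      -- The m + 1 points x, 1², ..., m², one more than the degree of Xᵐ - 1.
      r : ℕ → Carrier
      r zero    = # x
      r (suc i) = ♯ suc i * ♯ suc i

      ≤m⇒<p : ∀ {i} → i ℕ.≤ m → i ℕ.< p
      ≤m⇒<p {i} i≤m = ℕ.≤-<-trans i≤m (≡.subst (m ℕ.<_) (≡.sym p≡1+2m) (ℕ.s≤s (ℕ.m≤m+n m _)))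

      x^m≉1 : ¬ (# x) ^ m - 1# ≈ 0#
      -- Otherwise Xᵐ - 1 would vanish at 0 as well, where its value is -1 because m > 0.
      x^m≉1 x^m≈1 = 1≉0 (begin
        1#                 ≈⟨ -‿involutive 1# ⟨
        - - 1#             ≈⟨ -‿cong (trans (sym (+-identityˡ _)) (+-congʳ (sym (0^ 0<m)))) ⟩
        - (0# ^ m - 1#)    ≈⟨ -‿cong (too-many-roots m (Degree≤-+ m (Degree≤-^ m) (Degree≤-const m (- 1#))) r distinct root 0#) ⟩
        - 0#               ≈⟨ -0#≈0# ⟩
        0#                 ∎)
        where
        0^ : ∀ {n} → 0 ℕ.< n → 0# ^ n ≈ 0#
        0^ {suc n} _ = zeroˡ _

        root : ∀ {i} → i ℕ.≤ m → r i ^ m - 1# ≈ 0#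
        root {zero}  _   = x^m≈1
        root {suc i} i≤m = trans (+-congʳ (x²^m≈1 (+ suc i) (0<n<p⇒n≉0 (ℕ.s≤s ℕ.z≤n) (≤m⇒<p i≤m)))) (-‿inverseʳ 1#)

        distinct : ∀ {i j} → i ℕ.< j → j ℕ.≤ m → ¬ r j - r i ≈ 0#
        distinct {zero}  {suc j} _ _ j²-x≈0 = nonsquare (+ suc j) (x∙y⁻¹≈ε⇒x≈y _ _ j²-x≈0)
        -- Factor j² - i² = (j + i)(j - i): both factors lie strictly between 0 and p, since j + i ≤
        -- 2 m < p.
        distinct {suc i} {suc j} i<j j≤m j²-i²≈0 =
          0<n<p⇒n≉0 {k} (ℕ.m<n⇒0<n∸m i<j) (ℕ.≤-<-trans (ℕ.m∸n≤m (suc j) (suc i)) (≤m⇒<p j≤m))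
            (*-cancel (0<n<p⇒n≉0 {suc j ℕ.+ suc i} (ℕ.s≤s ℕ.z≤n) j+i<p) (begin
              ♯ (suc j ℕ.+ suc i) * ♯ k       ≈⟨ *-congʳ (trans (+-homo _ _) (+-congʳ j≈i+k)) ⟩
              (♯ suc i + ♯ k + ♯ suc i) * ♯ k
                ≈⟨ solve 2 (λ i k → (i ⊕ k ⊕ i) ⊗ k ⊜ (i ⊕ k) ⊗ (i ⊕ k) ⊖ i ⊗ i) (♯ suc i) (♯ k) ⟩
              (♯ suc i + ♯ k) * (♯ suc i + ♯ k) - ♯ suc i * ♯ suc i
                ≈⟨ +-congʳ (*-cong j≈i+k j≈i+k) ⟨
              ♯ suc j * ♯ suc j - ♯ suc i * ♯ suc i ≈⟨ j²-i²≈0 ⟩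
              0# ∎))
          where
          k = suc j ∸ suc i
          j≈i+k : ♯ suc j ≈ ♯ suc i + ♯ k
          j≈i+k = trans (reflexive (≡.cong ♯_ (≡.sym (ℕ.m+[n∸m]≡n (ℕ.<⇒≤ i<j))))) (+-homo (+ suc i) (+ k))
          j+i<p : suc j ℕ.+ suc i ℕ.< p
          j+i<p = ≡.subst (suc j ℕ.+ suc i ℕ.<_) (≡.sym p≡1+2m) (ℕ.s≤s (ℕ.+-mono-≤ j≤m
            (ℕ.≤-trans (ℕ.≤-trans (ℕ.<⇒≤ i<j) j≤m) (ℕ.m≤m+n m 0))))

modulo-prime : ∀ {p} → Prime p → PrimeField p (Modulo.ring p) (Modulo.integers p)
modulo-prime {p} p-prime = record
  { p-prime = p-prime ; ∣⇒≈0 = ∣⇒≈0 ; ≈0⇒∣ = ≈0⇒∣ ; *-zero-divisor = zero-divisor ; surjective = λ z → z , ≡⇒≈ ≡.refl }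
  where
  open Modulo p
  zero-divisor : ∀ x y → x ℤ.* y ≈ 0ℤ → x ≈ 0ℤ ⊎ y ≈ 0ℤ
  zero-divisor x y xy≈0
    with euclidsLemma ℤ.∣ x ∣ ℤ.∣ y ∣ p-prime (≡.subst (p ℕ∣.∣_) (ℤ.abs-* x y) (∣⇒∣ᵤ (≈0⇒∣ xy≈0)))
  ... | inj₁ p∣x = inj₁ (∣⇒≈0 (∣ᵤ⇒∣ p∣x))
  ... | inj₂ p∣y = inj₂ (∣⇒≈0 (∣ᵤ⇒∣ p∣y))

-- Recurrences for the products of binomial coefficients

module FactorialRatios where
  open import Data.Nat using (_+_; _*_)

  binomial*factorials : ∀ a b → ((a + b) C a) * (a ! * b !) ≡ (a + b) !
  binomial*factorials a b = ≡.trans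
    (≡.cong (λ n → ((a + b) C a) * (a ! * n !)) (≡.sym (ℕ.m+n∸m≡n a b)))
    (nCk*k!*[n∸k]!≡n! (ℕ.m≤m+n a b))

  a₂ a₃ : ℕ → ℕ
  a₂ k = ((2 * k) C k) * ((2 * k) C k) * ((4 * k) C (2 * k))
  a₃ k = ((2 * k) C k) * ((3 * k) C k) * ((6 * k) C (3 * k))

  2kCk : ∀ k → ((2 * k) C k) * (k ! * k !) ≡ (2 * k) !
  2kCk k = ≡.subst (λ n → (n C k) * (k ! * k !) ≡ n !) (eq k) (binomial*factorials k k)
    where
    eq : ∀ k → k + k ≡ 2 * k
    eq = solve-∀

  3kCk : ∀ k → ((3 * k) C k) * (k ! * (2 * k) !) ≡ (3 * k) !
  3kCk k = binomial*factorials k (2 * k)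

  a₂-factorials : ∀ k → a₂ k * (k ! * k ! * (k ! * k !)) ≡ (4 * k) !
  a₂-factorials k = begin
    x * x * y * (f * (k ! * k !))       ≡⟨ shuffle x y f ⟩
    y * (x * f * (x * f))               ≡⟨ ≡.cong (λ z → y * (z * z)) (2kCk k) ⟩
    y * ((2 * k) ! * (2 * k) !)
      ≡⟨ ≡.subst (λ n → (n C (2 * k)) * ((2 * k) ! * (2 * k) !) ≡ n !) (eq k) (binomial*factorials (2 * k) (2 * k)) ⟩
    (4 * k) ! ∎
    where
    open ≡.≡-Reasoning
    x = (2 * k) C k
    y = (4 * k) C (2 * k)
    f = k ! * k !
    eq : ∀ k → 2 * k + 2 * k ≡ 4 * k
    eq = solve-∀
    shuffle : ∀ x y f → x * x * y * (f * f) ≡ y * (x * f * (x * f))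
    shuffle = solve-∀

  a₃-factorials : ∀ k → a₃ k * (k ! * k ! * k ! * (3 * k) !) ≡ (6 * k) !
  -- The extra (2 k)! and (3 k)! are the factorials needed to clear the denominators of all three
  -- binomial coefficients at once.
  a₃-factorials k = ℕ.*-cancelʳ-≡ _ _ ((2 * k) ! * (3 * k) !) (begin
    x * y * z * (f * f * f * h) * (g * h)       ≡⟨ shuffle x y z f g h ⟩
    z * (x * (f * f) * (y * (f * g)) * (h * h)) ≡⟨ ≡.cong₂ (λ a b → z * (a * b * (h * h))) (2kCk k) (3kCk k) ⟩
    z * (g * h * (h * h))                       ≡⟨ shuffle′ z g h ⟩
    z * (h * h) * (g * h)
      ≡⟨ ≡.cong (_* (g * h)) (≡.subst (λ n → (n C (3 * k)) * (h * h) ≡ n !) (eq k) (binomial*factorials (3 * k) (3 * k))) ⟩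
    (6 * k) ! * (g * h) ∎)
    where
    open ≡.≡-Reasoning
    instance
      _ = ℕ._!*_!≢0 (2 * k) (3 * k)
    x = (2 * k) C k
    y = (3 * k) C k
    z = (6 * k) C (3 * k)
    f = k !
    g = (2 * k) !
    h = (3 * k) !
    eq : ∀ k → 3 * k + 3 * k ≡ 6 * k
    eq = solve-∀
    shuffle : ∀ x y z f g h → x * y * z * (f * f * f * h) * (g * h) ≡ z * (x * (f * f) * (y * (f * g)) * (h * h))
    shuffle = solve-∀
    shuffle′ : ∀ z g h → z * (g * h * (h * h)) ≡ z * (h * h) * (g * h)
    shuffle′ = solve-∀

  -- The quotient of (4 k)! / k!⁴ at k + 1 and k. The 8 comes from (4 k + 4)(4 k + 2) = 8 (k + 1)(2
  -- k + 1), whose factor k + 1 cancels against one of the four in the denominator.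
  a₂-recurrence : ∀ k → suc k * suc k * suc k * a₂ (suc k) ≡
                        8 * ((2 * k + 1) * (4 * k + 1) * (4 * k + 3)) * a₂ k
  a₂-recurrence k = ℕ.*-cancelʳ-≡ _ _ (suc k * f) (begin
    suc k * suc k * suc k * a₂ (suc k) * (suc k * f)
      ≡⟨ shuffle (a₂ (suc k)) (k !) k ⟩
    a₂ (suc k) * (suc k ! * suc k ! * (suc k ! * suc k !))
      ≡⟨ a₂-factorials (suc k) ⟩
    (4 * suc k) !
      ≡⟨ ≡.cong _! (ℕ.*-suc 4 k) ⟩
    (4 + 4 * k) * ((3 + 4 * k) * ((2 + 4 * k) * ((1 + 4 * k) * (4 * k) !)))
      ≡⟨ ≡.cong (λ n → (4 + 4 * k) * ((3 + 4 * k) * ((2 + 4 * k) * ((1 + 4 * k) * n)))) (a₂-factorials k) ⟨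
    (4 + 4 * k) * ((3 + 4 * k) * ((2 + 4 * k) * ((1 + 4 * k) * (a₂ k * f))))
      ≡⟨ shuffle′ (a₂ k) f k ⟩
    8 * ((2 * k + 1) * (4 * k + 1) * (4 * k + 3)) * a₂ k * (suc k * f) ∎)
    where
    open ≡.≡-Reasoning
    f = k ! * k ! * (k ! * k !)
    instance
      _ = k ℕ.!≢0
      _ = ℕ.m*n≢0 (k !) (k !)
      _ = ℕ.m*n≢0 (k ! * k !) (k ! * k !)
      _ = ℕ.m*n≢0 (suc k) f
    shuffle : ∀ a f k → suc k * suc k * suc k * a * (suc k * (f * f * (f * f))) ≡
              a * (suc k * f * (suc k * f) * (suc k * f * (suc k * f)))
    shuffle = solve-∀
    shuffle′ : ∀ a f k → (4 + 4 * k) * ((3 + 4 * k) * ((2 + 4 * k) * ((1 + 4 * k) * (a * f)))) ≡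
               8 * ((2 * k + 1) * (4 * k + 1) * (4 * k + 3)) * a * (suc k * f)
    shuffle′ = solve-∀

  -- The quotient of (6 k)! / (k!³ (3 k)!) at k + 1 and k. The even factors (6 k + 6)(6 k + 4)(6 k +
  -- 2) are 8 times the three new factors of (3 k + 3)!, and the odd ones give the rest, with 6 k +
  -- 3 = 3 (2 k + 1).
  a₃-recurrence : ∀ k → suc k * suc k * suc k * a₃ (suc k) ≡
                        8 * (3 * (2 * k + 1) * (6 * k + 1) * (6 * k + 5)) * a₃ k
  a₃-recurrence k = ℕ.*-cancelʳ-≡ _ _ (d * (k ! * k ! * k ! * h)) (begin
    suc k * suc k * suc k * a₃ (suc k) * (d * (k ! * k ! * k ! * h))
      ≡⟨ shuffle (a₃ (suc k)) (k !) h k ⟩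
    a₃ (suc k) * (suc k ! * suc k ! * suc k ! * ((3 + 3 * k) * ((2 + 3 * k) * ((1 + 3 * k) * h))))
      ≡⟨ ≡.cong (λ n → a₃ (suc k) * (suc k ! * suc k ! * suc k ! * n !)) (ℕ.*-suc 3 k) ⟨
    a₃ (suc k) * (suc k ! * suc k ! * suc k ! * (3 * suc k) !)
      ≡⟨ a₃-factorials (suc k) ⟩
    (6 * suc k) !
      ≡⟨ ≡.cong _! (ℕ.*-suc 6 k) ⟩
    product ((6 * k) !)
      ≡⟨ ≡.cong product (a₃-factorials k) ⟨
    product (a₃ k * (k ! * k ! * k ! * h))
      ≡⟨ shuffle′ (a₃ k) (k ! * k ! * k ! * h) k ⟩
    8 * (3 * (2 * k + 1) * (6 * k + 1) * (6 * k + 5)) * a₃ k * (d * (k ! * k ! * k ! * h)) ∎)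
    where
    open ≡.≡-Reasoning
    h = (3 * k) !
    d = (3 + 3 * k) * ((2 + 3 * k) * (1 + 3 * k))
    product : ℕ → ℕ
    product n = (6 + 6 * k) * ((5 + 6 * k) * ((4 + 6 * k) * ((3 + 6 * k) * ((2 + 6 * k) * ((1 + 6 * k) * n)))))
    instance
      _ = k ℕ.!≢0
      _ = (3 * k) ℕ.!≢0
      _ = ℕ.m*n≢0 (k !) (k !)
      _ = ℕ.m*n≢0 (k ! * k !) (k !)
      _ = ℕ.m*n≢0 (k ! * k ! * k !) h
      _ = ℕ.m*n≢0 d (k ! * k ! * k ! * h)
    shuffle : ∀ a f h k → suc k * suc k * suc k * a * ((3 + 3 * k) * ((2 + 3 * k) * (1 + 3 * k)) * (f * f * f * h)) ≡
              a * (suc k * f * (suc k * f) * (suc k * f) * ((3 + 3 * k) * ((2 + 3 * k) * ((1 + 3 * k) * h))))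
    shuffle = solve-∀
    shuffle′ : ∀ a f k → (6 + 6 * k) * ((5 + 6 * k) * ((4 + 6 * k) * ((3 + 6 * k) * ((2 + 6 * k) * ((1 + 6 * k) * (a * f)))))) ≡
               8 * (3 * (2 * k + 1) * (6 * k + 1) * (6 * k + 5)) * a * ((3 + 3 * k) * ((2 + 3 * k) * (1 + 3 * k)) * f)
    shuffle′ = solve-∀

open FactorialRatios using (a₂; a₃; a₂-recurrence; a₃-recurrence)

-- The identity between the two sums as polynomials over the prime field

module Transformation {p : ℕ} {c ℓ} (K : CommutativeRing c ℓ) (φ : IntegersTo K) (𝔽 : PrimeField p K φ)
  {m n : ℕ} (p≡1+2m : p ≡ suc (2 ℕ.* m)) (0<m : 0 ℕ.< m)
  (p≡6n+1∨5 : p ≡ 6 ℕ.* n ℕ.+ 1 ⊎ p ≡ 6 ℕ.* n ℕ.+ 5) where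

  open CommutativeRing K
  open _-Raw-AlmostCommutative⟶_ φ renaming (⟦_⟧ to #_)
  open PrimeField 𝔽
  open FiniteField K φ 𝔽
  open Euler p≡1+2m 0<m
  open IntegerSolver K φ
  open Exp semiring using (_^_; ^-congˡ; ^-homo-*; ^-assocʳ)
  open CommutativeExp commutativeSemiring using (^-distrib-*)
  open FiniteSums K
  open RingProperties (CommutativeRing.ring K) using (x∙y⁻¹≈ε⇒x≈y; -0#≈0#)
  open ≈-Reasoning setoid

  ♯-* : ∀ a b → ♯ (a ℕ.* b) ≈ ♯ a * ♯ b
  ♯-* a b = trans (reflexive (≡.cong #_ (ℤ.pos-* a b))) (*-homo (+ a) (+ b))

  ♯-linear : ∀ a b k → ♯ (a ℕ.* k ℕ.+ b) ≈ ♯ a * ♯ k + ♯ b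
  ♯-linear a b k = trans (+-homo (+ (a ℕ.* k)) (+ b)) (+-congʳ (♯-* a k))

  2<p : 2 ℕ.< p
  2<p = ≡.subst (2 ℕ.<_) (≡.sym p≡1+2m) (ℕ.s≤s (ℕ.*-monoʳ-≤ 2 0<m))

  ♯2≉0 : ¬ ♯ 2 ≈ 0#
  ♯2≉0 = 0<n<p⇒n≉0 (ℕ.s≤s ℕ.z≤n) 2<p

  -- The power computes to a literal, so this one lemma makes 8, 16, 64 and 256 cancellable.
  ♯2^≉0 : ∀ k → ¬ ♯ (2 ℕ.^ k) ≈ 0#
  ♯2^≉0 zero    = 1≉0 ∘ trans (sym 1-homo)
  ♯2^≉0 (suc k) = ♯2^≉0 k ∘ *-cancel ♯2≉0 ∘ trans (sym (♯-* 2 (2 ℕ.^ k)))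

  2m+1≈0 : ♯ 2 * ♯ m + ♯ 1 ≈ 0#
  2m+1≈0 = begin
    ♯ 2 * ♯ m + ♯ 1       ≈⟨ ♯-linear 2 1 m ⟨
    ♯ (2 ℕ.* m ℕ.+ 1)     ≡⟨ ≡.cong ♯_ (≡.trans (ℕ.+-comm _ 1) (≡.sym p≡1+2m)) ⟩
    ♯ p                   ≈⟨ p≈0 ⟩
    0#                    ∎

  3n≤m : 3 ℕ.* n ℕ.≤ m
  3n≤m = ℕ.*-cancelˡ-≤ 2 (ℕ.≤-pred (ℕ.≤-trans (ℕ.s≤s (ℕ.≤-reflexive (≡.sym (ℕ.*-assoc 2 3 n))))
    (≡.subst (suc (6 ℕ.* n) ℕ.≤_) p≡1+2m ([ one , five ]′ p≡6n+1∨5))))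
    where
    one : p ≡ 6 ℕ.* n ℕ.+ 1 → suc (6 ℕ.* n) ℕ.≤ p
    one eq = ℕ.≤-reflexive (≡.trans (ℕ.+-comm 1 _) (≡.sym eq))
    five : p ≡ 6 ℕ.* n ℕ.+ 5 → suc (6 ℕ.* n) ℕ.≤ p
    five eq = ℕ.≤-trans (ℕ.s≤s (ℕ.m≤m+n (6 ℕ.* n) 4)) (ℕ.≤-reflexive (≡.trans (≡.sym (ℕ.+-suc (6 ℕ.* n) 4)) (≡.sym eq)))

  module S = SeriesDerivation K φ
  module A = CommutativeRing S.ring
  module AExp = Exp A.semiring
  module Φ = _-Raw-AlmostCommutative⟶_ S.constants
  module ASolver = IntegerSolver S.ring S.constants
  open S using (Series; HasValue; HasOnlyConstantTerm; constant-only; +-only; neg-only; *-only; only-constant-terms; Regular)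

  regular : ∀ {a} → ¬ a ≈ 0# → Regular a
  regular a≉0 x = *-cancel a≉0

  ♯-only : ∀ k → HasOnlyConstantTerm (S.♯ k)
  ♯-only k = constant-only (♯ k)

  κ₂ κ₃ : Carrier → Carrier
  κ₂ k = (♯ 2 * k + ♯ 1) * (♯ 4 * k + ♯ 1) * (♯ 4 * k + ♯ 3)
  κ₃ k = ♯ 3 * (♯ 2 * k + ♯ 1) * (♯ 6 * k + ♯ 1) * (♯ 6 * k + ♯ 5)

  linear-only : ∀ a b k → HasOnlyConstantTerm (S.♯ a S.* S.♯ k S.+ S.♯ b)
  linear-only a b k = +-only (*-only (♯-only a) (♯-only k)) (♯-only b)

  κ₂-only : ∀ k → HasOnlyConstantTerm (S.κ₂ (S.♯ k))
  κ₂-only k = *-only (*-only (linear-only 2 1 k) (linear-only 4 1 k)) (linear-only 4 3 k)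

  κ₃-only : ∀ k → HasOnlyConstantTerm (S.κ₃ (S.♯ k))
  κ₃-only k = *-only (*-only (*-only (♯-only 3) (linear-only 2 1 k)) (linear-only 6 1 k)) (linear-only 6 5 k)

  cube-only : ∀ a k → HasOnlyConstantTerm (S.♯ a S.* (S.♯ k S.* S.♯ k S.* S.♯ k))
  cube-only a k = *-only (♯-only a)
    (*-only (*-only (♯-only k) (♯-only k)) (♯-only k))

  a₂-recurrence′ : ∀ k → ♯ suc k * ♯ suc k * ♯ suc k * ♯ a₂ (suc k) ≈ ♯ 8 * κ₂ (♯ k) * ♯ a₂ k
  a₂-recurrence′ k = begin
    ♯ suc k * ♯ suc k * ♯ suc k * ♯ a₂ (suc k)
      ≈⟨ trans (♯-* (suc k ℕ.* suc k ℕ.* suc k) (a₂ (suc k)))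
           (*-congʳ (trans (♯-* (suc k ℕ.* suc k) (suc k)) (*-congʳ (♯-* (suc k) (suc k))))) ⟨
    ♯ (suc k ℕ.* suc k ℕ.* suc k ℕ.* a₂ (suc k))
      ≡⟨ ≡.cong ♯_ (a₂-recurrence k) ⟩
    ♯ (8 ℕ.* (l₁ ℕ.* l₂ ℕ.* l₃) ℕ.* a₂ k)
      ≈⟨ trans (♯-* (8 ℕ.* (l₁ ℕ.* l₂ ℕ.* l₃)) (a₂ k)) (*-congʳ (trans (♯-* 8 (l₁ ℕ.* l₂ ℕ.* l₃))
           (*-congˡ (trans (♯-* (l₁ ℕ.* l₂) l₃) (*-cong (trans (♯-* l₁ l₂)
             (*-cong (♯-linear 2 1 k) (♯-linear 4 1 k))) (♯-linear 4 3 k)))))) ⟩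
    ♯ 8 * κ₂ (♯ k) * ♯ a₂ k ∎
    where
    l₁ = 2 ℕ.* k ℕ.+ 1
    l₂ = 4 ℕ.* k ℕ.+ 1
    l₃ = 4 ℕ.* k ℕ.+ 3

  a₃-recurrence′ : ∀ k → ♯ suc k * ♯ suc k * ♯ suc k * ♯ a₃ (suc k) ≈ ♯ 8 * κ₃ (♯ k) * ♯ a₃ k
  a₃-recurrence′ k = begin
    ♯ suc k * ♯ suc k * ♯ suc k * ♯ a₃ (suc k)
      ≈⟨ trans (♯-* (suc k ℕ.* suc k ℕ.* suc k) (a₃ (suc k)))
           (*-congʳ (trans (♯-* (suc k ℕ.* suc k) (suc k)) (*-congʳ (♯-* (suc k) (suc k))))) ⟨
    ♯ (suc k ℕ.* suc k ℕ.* suc k ℕ.* a₃ (suc k))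
      ≡⟨ ≡.cong ♯_ (a₃-recurrence k) ⟩
    ♯ (8 ℕ.* (3 ℕ.* l₁ ℕ.* l₂ ℕ.* l₃) ℕ.* a₃ k)
      ≈⟨ trans (♯-* (8 ℕ.* (3 ℕ.* l₁ ℕ.* l₂ ℕ.* l₃)) (a₃ k)) (*-congʳ (trans (♯-* 8 (3 ℕ.* l₁ ℕ.* l₂ ℕ.* l₃))
           (*-congˡ (trans (♯-* (3 ℕ.* l₁ ℕ.* l₂) l₃) (*-cong (trans (♯-* (3 ℕ.* l₁) l₂)
             (*-cong (trans (♯-* 3 l₁) (*-congˡ (♯-linear 2 1 k))) (♯-linear 6 1 k))) (♯-linear 6 5 k)))))) ⟩
    ♯ 8 * κ₃ (♯ k) * ♯ a₃ k ∎
    where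
    l₁ = 2 ℕ.* k ℕ.+ 1
    l₂ = 6 ℕ.* k ℕ.+ 1
    l₃ = 6 ℕ.* k ℕ.+ 5

  -- Moving the numerical denominators of the arguments into the coefficients leaves pure powers of
  -- z and of N / M³. The first argument is z / 256 with 256 = 8 · 32, the second is N / (8 M³)
  -- since M = 2 (3 t + 5); hence α is 32 or 1, and ι is the inverse of 8 α.
  scaled-recurrence : ∀ {b e ι x} α k → ♯ 8 * α * ι ≈ ♯ 1 →
    ♯ suc k * ♯ suc k * ♯ suc k * b ≈ ♯ 8 * x * e →
    α * (♯ suc k * ♯ suc k * ♯ suc k) * (b * ι ^ suc k) ≈ x * (e * ι ^ k)
  scaled-recurrence {b} {e} {ι} {x} α k 8αι≈1 rec = begin
    α * (♯ suc k * ♯ suc k * ♯ suc k) * (b * (ι * ι ^ k))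
      ≈⟨ solve 5 (λ α s b ι y → α ⊗ (s ⊗ s ⊗ s) ⊗ (b ⊗ (ι ⊗ y)) ⊜ α ⊗ ι ⊗ y ⊗ (s ⊗ s ⊗ s ⊗ b)) α (♯ suc k) b ι (ι ^ k) ⟩
    α * ι * ι ^ k * (♯ suc k * ♯ suc k * ♯ suc k * b)
      ≈⟨ *-congˡ rec ⟩
    α * ι * ι ^ k * (♯ 8 * x * e)
      ≈⟨ solve 5 (λ α ι y x e → α ⊗ ι ⊗ y ⊗ (:♯ 8 ⊗ x ⊗ e) ⊜ :♯ 8 ⊗ α ⊗ ι ⊗ (x ⊗ (e ⊗ y))) α ι (ι ^ k) x e ⟩
    ♯ 8 * α * ι * (x * (e * ι ^ k))
      ≈⟨ trans (*-congʳ (trans 8αι≈1 1-homo)) (*-identityˡ _) ⟩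
    x * (e * ι ^ k) ∎

  coefficient₂ coefficient₃ : Carrier → ℕ → Carrier
  coefficient₂ ι k = ♯ a₂ k * ι ^ k
  coefficient₃ ι k = ♯ a₃ k * ι ^ k

  -- The k-th power of N / M³ multiplied by Mᵐ. The truncated subtraction is exact for k ≤ n because
  -- 3 n ≤ m.
  term₃ : ℕ → Series
  term₃ k = S.N AExp.^ k S.* S.M AExp.^ (m ∸ 3 ℕ.* k)

  left right : Carrier → Series
  left  ι = FiniteSums.sum≤ S.ring m (λ k → S.constant (coefficient₂ ι k) S.* S.z AExp.^ k)
  right ι = FiniteSums.sum≤ S.ring n (λ k → S.constant (coefficient₃ ι k) S.* term₃ k)

  regular-cube : ∀ {a} → ¬ a ≈ 0# → Regular (a * a * a)
  regular-cube {a} a≉0 = S.Regular-* (S.Regular-* {a} {a} (regular a≉0) (regular a≉0)) (regular a≉0)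

  L-left : ∀ {ι} → ♯ 256 * ι ≈ ♯ 1 → S.L (left ι) S.≈ A.0#
  L-left {ι} 256ι≈1 = S.*-regular (q S.* q S.* q) (S.L (left ι))
    (regular-cube (♯2≉0 ∘ trans (sym (trans (+-congˡ -0#≈0#) (+-identityʳ _)))))
    (S.L-telescopes m {α = S.♯ 32} (λ k → S.constant (coefficient₂ ι k)) (λ k → S.κ₂ (S.♯ k))
      (S.z AExp.^_) (λ k → AExp._^_ S.z k) (λ k → S.z AExp.^ suc k)
      (λ k → S.θ-constant _) (λ k _ → S.L-z^ k) (λ k _ → A.refl)
      (λ k → only-constant-terms
        (*-only (cube-only 32 (suc k)) (constant-only (coefficient₂ ι (suc k))))
        (*-only (κ₂-only k) (constant-only (coefficient₂ ι k)))
        (scaled-recurrence (♯ 32) k (trans (*-congʳ (sym (♯-* 8 32))) 256ι≈1) (a₂-recurrence′ k)))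
      (only-constant-terms (*-only (κ₂-only m) (constant-only (coefficient₂ ι m))) (constant-only 0#)
        (trans (*-congʳ (*-congʳ (trans (*-congʳ 2m+1≈0) (zeroˡ _)))) (trans (*-congʳ (zeroˡ _)) (zeroˡ _)))))
    where
    q = S.♯ 2 S.+ S.- S.u

  m≈j+3k : ∀ {k} → k ℕ.≤ n → ♯ m ≈ ♯ (m ∸ 3 ℕ.* k) + ♯ 3 * ♯ k
  m≈j+3k {k} k≤n = begin
    ♯ m                                    ≡⟨ ≡.cong ♯_ (ℕ.m∸n+n≡m (ℕ.≤-trans (ℕ.*-monoʳ-≤ 3 k≤n) 3n≤m)) ⟨
    ♯ (m ∸ 3 ℕ.* k ℕ.+ 3 ℕ.* k)            ≈⟨ +-homo (+ (m ∸ 3 ℕ.* k)) (+ (3 ℕ.* k)) ⟩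
    ♯ (m ∸ 3 ℕ.* k) + ♯ (3 ℕ.* k)          ≈⟨ +-congˡ (♯-* 3 k) ⟩
    ♯ (m ∸ 3 ℕ.* k) + ♯ 3 * ♯ k            ∎

  2j≈ : ∀ {k} → k ℕ.≤ n → ♯ 2 * ♯ (m ∸ 3 ℕ.* k) ≈ - (♯ 1 + ♯ 6 * ♯ k)
  2j≈ {k} k≤n = begin
    ♯ 2 * ♯ j
      ≈⟨ solve 2 (λ j k → :♯ 2 ⊗ j ⊜ :♯ 2 ⊗ (j ⊕ :♯ 3 ⊗ k) ⊕ :♯ 1 ⊖ (:♯ 1 ⊕ :♯ 6 ⊗ k)) (♯ j) (♯ k) ⟩
    ♯ 2 * (♯ j + ♯ 3 * ♯ k) + ♯ 1 - (♯ 1 + ♯ 6 * ♯ k)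
      ≈⟨ +-congʳ (trans (+-congʳ (*-congˡ (sym (m≈j+3k k≤n)))) 2m+1≈0) ⟩
    0# - (♯ 1 + ♯ 6 * ♯ k)
      ≈⟨ +-identityˡ _ ⟩
    - (♯ 1 + ♯ 6 * ♯ k) ∎
    where j = m ∸ 3 ℕ.* k

  κ₃n≈0 : κ₃ (♯ n) ≈ 0#
  κ₃n≈0 = [ (λ eq → trans (*-congʳ (trans (*-congˡ (6n+b≈0 1 eq)) (zeroʳ _))) (zeroˡ _))
          , (λ eq → trans (*-congˡ (6n+b≈0 5 eq)) (zeroʳ _)) ]′ p≡6n+1∨5
    where
    6n+b≈0 : ∀ b → p ≡ 6 ℕ.* n ℕ.+ b → ♯ 6 * ♯ n + ♯ b ≈ 0#
    6n+b≈0 b eq = trans (sym (♯-linear 6 b n)) (trans (reflexive (≡.cong ♯_ (≡.sym eq))) p≈0)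

  -- From k < n it follows that 3 (k + 1) ≤ m, so the exponent of `M` really drops by 3 and is not
  -- cut off at 0.
  M³term₃ : ∀ k → k ℕ.< n → S.M S.* S.M S.* S.M S.* term₃ (suc k) S.≈ S.N S.* term₃ k
  M³term₃ k k<n = A.trans
    (ASolver.solve 4 (λ N M x y → M ⊗ M ⊗ M ⊗ (N ⊗ x ⊗ y) ⊜ N ⊗ (x ⊗ (M ⊗ (M ⊗ (M ⊗ y)))))
      S.N S.M (S.N AExp.^ k) (S.M AExp.^ (m ∸ 3 ℕ.* suc k)))
    (A.reflexive (≡.cong (λ j → S.N S.* (S.N AExp.^ k S.* S.M AExp.^ j)) (≡.sym j≡)))
    where
    j≡ : m ∸ 3 ℕ.* k ≡ 3 ℕ.+ (m ∸ 3 ℕ.* suc k)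
    j≡ = ≡.trans (≡.sym (ℕ.[m+n]∸[m+o]≡n∸o 3 m (3 ℕ.* k)))
      (≡.trans (≡.cong (3 ℕ.+ m ∸_) (≡.sym (ℕ.*-suc 3 k)))
        (ℕ.+-∸-assoc 3 (ℕ.≤-trans (ℕ.*-monoʳ-≤ 3 k<n) 3n≤m)))

  L-right : ∀ {ι} → ♯ 8 * ι ≈ ♯ 1 → S.L (right ι) S.≈ A.0#
  L-right {ι} 8ι≈1 = S.*-regular (S.q₃ S.* S.q₃ S.* S.q₃) (S.L (right ι))
    -- At u = 0 the polynomial `q₃` takes the value -8, which is nonzero for odd p.
    (regular-cube (♯2^≉0 3 ∘ λ q₃≈0 → begin
      ♯ 8                                             ≈⟨ solve 0 (:♯ 8 ⊜ ⊝ (:♯ 2 ⊗ (:♯ 0 ⊖ :♯ 2) ⊗ (:♯ 3 ⊗ :♯ 0 ⊕ :♯ 2))) ⟩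
      - (♯ 2 * (♯ 0 - ♯ 2) * (♯ 3 * ♯ 0 + ♯ 2))       ≈⟨ -‿cong (*-cong (*-congˡ (+-congʳ 0-homo)) (+-congʳ (*-congˡ 0-homo))) ⟩
      - (♯ 2 * (0# - ♯ 2) * (♯ 3 * 0# + ♯ 2))         ≈⟨ -‿cong q₃≈0 ⟩
      - 0#                                            ≈⟨ -0#≈0# ⟩
      0#                                              ∎))
    (S.L-telescopes n {α = S.♯ 1} (λ k → S.constant (coefficient₃ ι k)) (λ k → S.κ₃ (S.♯ k))
      term₃ (λ k → S.M S.* S.M S.* S.M S.* term₃ k) (λ k → S.N S.* term₃ k)
      (λ k → S.θ-constant _)
      (λ k k≤n → S.L-N^*M^ k (m ∸ 3 ℕ.* k) (only-constant-terms
         (*-only (♯-only 2) (♯-only (m ∸ 3 ℕ.* k)))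
         (neg-only (+-only (♯-only 1) (*-only (♯-only 6) (♯-only k)))) (2j≈ k≤n)))
      M³term₃
      (λ k → only-constant-terms
        (*-only (cube-only 1 (suc k)) (constant-only (coefficient₃ ι (suc k))))
        (*-only (κ₃-only k) (constant-only (coefficient₃ ι k)))
        (scaled-recurrence (♯ 1) k (trans (*-congʳ (sym (♯-* 8 1))) 8ι≈1) (a₃-recurrence′ k)))
      (only-constant-terms (*-only (κ₃-only n) (constant-only (coefficient₃ ι n))) (constant-only 0#)
        (trans (*-congʳ κ₃n≈0) (zeroˡ _))))

  ^-head : ∀ f k → (f AExp.^ k) 0 ≈ f 0 ^ k
  ^-head f zero    = refl
  ^-head f (suc k) = *-congˡ (^-head f k)

  left-head : ∀ ι → left ι 0 ≈ 1#
  left-head ι = trans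
    (S.sum≤-head m (λ k → S.constant (coefficient₂ ι k) S.* S.z AExp.^ k)
      (λ k → trans (*-congˡ (trans (*-congʳ (zeroˡ _)) (zeroˡ _))) (zeroʳ _)))
    (trans (*-identityʳ _) (trans (*-identityʳ _) 1-homo))

  right-head : ∀ ι → right ι 0 ≈ 1#
  right-head ι = begin
    right ι 0
      ≈⟨ S.sum≤-head n (λ k → S.constant (coefficient₃ ι k) S.* term₃ k)
           (λ k → trans (*-congˡ (trans (*-congʳ (trans (*-congʳ (zeroˡ _)) (zeroˡ _))) (zeroˡ _))) (zeroʳ _)) ⟩
    ♯ 1 * 1# * (1# * (S.M AExp.^ m) 0)
      ≈⟨ trans (*-congʳ (trans (*-identityʳ _) 1-homo)) (trans (*-identityˡ _) (*-identityˡ _)) ⟩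
    (S.M AExp.^ m) 0
      ≈⟨ ^-head S.M m ⟩
    (♯ 4 + ♯ 6 * 0#) ^ m
      ≈⟨ ^-congˡ m (trans (+-congˡ (zeroʳ _)) (trans (+-identityʳ _) (♯-* 2 2))) ⟩
    (♯ 2 * ♯ 2) ^ m
      ≈⟨ x²^m≈1 (+ 2) ♯2≉0 ⟩
    1# ∎

  z N M : Carrier → Carrier
  z x = x * (♯ 2 - x)
  N x = x * ((x - ♯ 2) * (x - ♯ 2))
  M x = ♯ 4 + ♯ 6 * x

  HasValue-z^ : ∀ x k → HasValue (suc (2 ℕ.* k)) (S.z AExp.^ k) x (z x ^ k)
  HasValue-z^ x zero    = S.HasValue-1
  HasValue-z^ x (suc k) = ≡.subst (λ d → HasValue (suc d) (S.z AExp.^ suc k) x (z x ^ suc k)) (≡.sym (ℕ.*-suc 2 k))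
    (S.HasValue-cong
      (ASolver.solve 2 (λ u y → u ⊗ ((:♯ 2 ⊕ Κ -1ℤ ⊗ u) ⊗ y) ⊜ u ⊗ (:♯ 2 ⊖ u) ⊗ y) S.u (S.z AExp.^ k))
      (S.value-cong (solve 2 (λ x y → x ⊗ ((:♯ 2 ⊕ Κ -1ℤ ⊗ x) ⊗ y) ⊜ x ⊗ (:♯ 2 ⊖ x) ⊗ y) x (z x ^ k))
        (S.HasValue-u* (S.HasValue-linear* (♯ 2) (# -1ℤ) (HasValue-z^ x k)))))

  HasValue-M^ : ∀ x j → HasValue (suc j) (S.M AExp.^ j) x (M x ^ j)
  HasValue-M^ x zero    = S.HasValue-1
  HasValue-M^ x (suc j) = S.HasValue-linear* (♯ 4) (♯ 6) (HasValue-M^ x j)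

  HasValue-N^M^ : ∀ x i j → HasValue (suc (3 ℕ.* i ℕ.+ j)) (S.N AExp.^ i S.* S.M AExp.^ j) x (N x ^ i * M x ^ j)
  HasValue-N^M^ x zero    j = S.HasValue-cong (A.sym (A.*-identityˡ (S.M AExp.^ j)))
    (S.value-cong (sym (*-identityˡ _)) (HasValue-M^ x j))
  HasValue-N^M^ x (suc i) j =
    ≡.subst (λ d → HasValue (suc (d ℕ.+ j)) (S.N AExp.^ suc i S.* S.M AExp.^ j) x (N x ^ suc i * M x ^ j)) (≡.sym (ℕ.*-suc 3 i))
    (S.HasValue-cong
      (ASolver.solve 3 (λ u y w → u ⊗ ((Κ -[1+ 1 ] ⊕ :♯ 1 ⊗ u) ⊗ ((Κ -[1+ 1 ] ⊕ :♯ 1 ⊗ u) ⊗ (y ⊗ w)))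
          ⊜ u ⊗ ((u ⊖ :♯ 2) ⊗ (u ⊖ :♯ 2)) ⊗ y ⊗ w) S.u (S.N AExp.^ i) (S.M AExp.^ j))
      (S.value-cong
        (solve 3 (λ u y w → u ⊗ ((Κ -[1+ 1 ] ⊕ :♯ 1 ⊗ u) ⊗ ((Κ -[1+ 1 ] ⊕ :♯ 1 ⊗ u) ⊗ (y ⊗ w)))
          ⊜ u ⊗ ((u ⊖ :♯ 2) ⊗ (u ⊖ :♯ 2)) ⊗ y ⊗ w) x (N x ^ i) (M x ^ j))
        (S.HasValue-u* (S.HasValue-linear* (# -[1+ 1 ]) (♯ 1) (S.HasValue-linear* (# -[1+ 1 ]) (♯ 1) (HasValue-N^M^ x i j))))))

  -- Subtraction is written as scaling by -1, so that the rules for sums and constant multiples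
  -- cover both L and evaluation.
  difference : Carrier → Carrier → Series
  difference ι₂ ι₃ = left ι₂ S.+ S.constant (# -1ℤ) S.* right ι₃

  -- The degree bound p is attained by the first sum: its terms have degree 2 k ≤ 2 m = p - 1. Those
  -- of the second have degree at most 3 k + (m - 3 k) = m.
  difference-value : ∀ ι₂ ι₃ x → HasValue p (difference ι₂ ι₃) x
    (sum≤ m (λ k → coefficient₂ ι₂ k * z x ^ k)
      + # -1ℤ * sum≤ n (λ k → coefficient₃ ι₃ k * (N x ^ k * M x ^ (m ∸ 3 ℕ.* k))))
  difference-value ι₂ ι₃ x = S.HasValue-+
    (S.HasValue-sum≤ m (λ k k≤m → S.HasValue-scale _ (S.HasValue-≤
      (≡.subst (suc (2 ℕ.* k) ℕ.≤_) (≡.sym p≡1+2m) (ℕ.s≤s (ℕ.*-monoʳ-≤ 2 k≤m))) (HasValue-z^ x k))))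
    (S.HasValue-scale _ (S.HasValue-sum≤ n (λ k k≤n → S.HasValue-scale _ (S.HasValue-≤
      (≡.subst (suc (3 ℕ.* k ℕ.+ (m ∸ 3 ℕ.* k)) ℕ.≤_) (≡.sym p≡1+2m) (ℕ.s≤s
        (ℕ.≤-trans (ℕ.≤-reflexive (ℕ.m+[n∸m]≡n (ℕ.≤-trans (ℕ.*-monoʳ-≤ 3 k≤n) 3n≤m))) (ℕ.m≤m+n m _))))
      (HasValue-N^M^ x k (m ∸ 3 ℕ.* k))))))

  sums-agree : ∀ {ι₂ ι₃} x → ♯ 256 * ι₂ ≈ ♯ 1 → ♯ 8 * ι₃ ≈ ♯ 1 →
    sum≤ m (λ k → coefficient₂ ι₂ k * z x ^ k) ≈
    sum≤ n (λ k → coefficient₃ ι₃ k * (N x ^ k * M x ^ (m ∸ 3 ℕ.* k)))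
  sums-agree {ι₂} {ι₃} x 256ι₂≈1 8ι₃≈1 = x∙y⁻¹≈ε⇒x≈y _ _ (begin
    l - r                               ≈⟨ solve 2 (λ l r → l ⊖ r ⊜ l ⊕ Κ -1ℤ ⊗ r) l r ⟩
    l + # -1ℤ * r                       ≈⟨ HasValue.value (difference-value ι₂ ι₃ x) ⟨
    S.evaluate p (difference ι₂ ι₃) x   ≈⟨ S.evaluate-vanishing p _ x vanishes ⟩
    0#                                  ∎)
    where
    open S using (module HasValue)
    l = sum≤ m (λ k → coefficient₂ ι₂ k * z x ^ k)
    r = sum≤ n (λ k → coefficient₃ ι₃ k * (N x ^ k * M x ^ (m ∸ 3 ℕ.* k)))

    L-difference : S.L (difference ι₂ ι₃) S.≈ A.0#
    L-difference = A.trans (S.L-+ (left ι₂) (S.constant (# -1ℤ) S.* right ι₃))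
      (A.trans (A.+-cong (L-left 256ι₂≈1) (A.trans (S.L-scale (S.θ-constant (# -1ℤ)) (right ι₃))
        (A.trans (A.*-congˡ {S.constant (# -1ℤ)} (L-right 8ι₃≈1)) (A.zeroʳ (S.constant (# -1ℤ))))))
        (A.+-identityˡ A.0#))

    vanishes : S.VanishesBelow p (difference ι₂ ι₃)
    vanishes = S.L-kernel (λ 0<k k<p → regular (0<n<p⇒n≉0 0<k k<p)) (regular (♯2^≉0 4)) (difference ι₂ ι₃) L-difference
      (begin
        left ι₂ 0 + # -1ℤ * right ι₃ 0   ≈⟨ +-cong (left-head ι₂) (*-congˡ (right-head ι₃)) ⟩
        1# + # -1ℤ * 1#                  ≈⟨ +-cong (sym 1-homo) (*-congˡ (sym 1-homo)) ⟩
        ♯ 1 + # -1ℤ * ♯ 1                ≈⟨ solve 0 (:♯ 1 ⊕ Κ -1ℤ ⊗ :♯ 1 ⊜ :♯ 0) ⟩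
        ♯ 0                              ≈⟨ 0-homo ⟩
        0#                               ∎)

  -- The inverse of 2 is m + 1, because 2 (m + 1) = p + 1.
  inverse-of-2^ : ∀ k → ♯ (2 ℕ.^ k) * (♯ suc m) ^ k ≈ ♯ 1
  inverse-of-2^ zero    = *-identityʳ _
  inverse-of-2^ (suc k) = begin
    ♯ (2 ℕ.* 2 ℕ.^ k) * (♯ suc m * (♯ suc m) ^ k)
      ≈⟨ *-cong (♯-* 2 (2 ℕ.^ k)) (*-congʳ (+-homo 1ℤ (+ m))) ⟩
    ♯ 2 * ♯ (2 ℕ.^ k) * ((♯ 1 + ♯ m) * (♯ suc m) ^ k)
      ≈⟨ solve 3 (λ a b m → :♯ 2 ⊗ a ⊗ ((:♯ 1 ⊕ m) ⊗ b) ⊜ (:♯ 2 ⊗ m ⊕ :♯ 1) ⊗ (a ⊗ b) ⊕ a ⊗ b) _ _ (♯ m) ⟩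
    (♯ 2 * ♯ m + ♯ 1) * (♯ (2 ℕ.^ k) * (♯ suc m) ^ k) + ♯ (2 ℕ.^ k) * (♯ suc m) ^ k
      ≈⟨ +-cong (trans (*-congʳ 2m+1≈0) (zeroˡ _)) (inverse-of-2^ k) ⟩
    0# + ♯ 1
      ≈⟨ +-identityˡ _ ⟩
    ♯ 1 ∎

  -- The arguments `v` and `w` are specified by equations cleared of denominators, which keeps
  -- inverses out of the polynomial identity; they are chosen only when the rationals are reduced.
  transformation : ∀ t v w →
    ♯ 256 * v ≈ ♯ 1 - t * t →
    ♯ 64 * ((♯ 3 * t + ♯ 5) * ((♯ 3 * t + ♯ 5) * (♯ 3 * t + ♯ 5))) * w ≈ (t - ♯ 1) * (t - ♯ 1) * (t + ♯ 1) →
    sum≤ m (λ k → ♯ a₂ k * v ^ k) ≈ (♯ 10 + ♯ 6 * t) ^ m * sum≤ n (λ k → ♯ a₃ k * w ^ k)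
  transformation t v w 256v≈ 64[3t+5]³w≈ = begin
    sum≤ m (λ k → ♯ a₂ k * v ^ k)
      ≈⟨ sum≤-cong m (λ k _ → left-term k) ⟨
    sum≤ m (λ k → coefficient₂ ι₂ k * z x ^ k)
      ≈⟨ sums-agree x (inverse-of-2^ 8) (inverse-of-2^ 3) ⟩
    sum≤ n (λ k → coefficient₃ ι₃ k * (N x ^ k * M x ^ (m ∸ 3 ℕ.* k)))
      ≈⟨ sum≤-cong n right-term ⟩
    sum≤ n (λ k → M x ^ m * (♯ a₃ k * w ^ k))
      ≈⟨ *-distribˡ-sum≤ n (M x ^ m) _ ⟨
    M x ^ m * sum≤ n (λ k → ♯ a₃ k * w ^ k)
      ≈⟨ *-congʳ (^-congˡ m (solve 1 (λ t → :♯ 4 ⊕ :♯ 6 ⊗ (:♯ 1 ⊕ t) ⊜ :♯ 10 ⊕ :♯ 6 ⊗ t) t)) ⟩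
    (♯ 10 + ♯ 6 * t) ^ m * sum≤ n (λ k → ♯ a₃ k * w ^ k) ∎
    where
    x  = ♯ 1 + t
    ι₂ = (♯ suc m) ^ 8
    ι₃ = (♯ suc m) ^ 3

    ι₂z≈v : ι₂ * z x ≈ v
    ι₂z≈v = begin
      ι₂ * z x           ≈⟨ *-congˡ (solve 1 (λ t → (:♯ 1 ⊕ t) ⊗ (:♯ 2 ⊖ (:♯ 1 ⊕ t)) ⊜ :♯ 1 ⊖ t ⊗ t) t) ⟩
      ι₂ * (♯ 1 - t * t) ≈⟨ *-congˡ 256v≈ ⟨
      ι₂ * (♯ 256 * v)   ≈⟨ solve 2 (λ i v → i ⊗ (:♯ 256 ⊗ v) ⊜ :♯ 256 ⊗ i ⊗ v) ι₂ v ⟩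
      ♯ 256 * ι₂ * v     ≈⟨ *-congʳ (trans (inverse-of-2^ 8) 1-homo) ⟩
      1# * v             ≈⟨ *-identityˡ v ⟩
      v                  ∎

    ι₃N≈ : ι₃ * N x ≈ w * M x ^ 3
    ι₃N≈ = begin
      ι₃ * N x
        ≈⟨ *-congˡ (solve 1 (λ t → (:♯ 1 ⊕ t) ⊗ ((:♯ 1 ⊕ t ⊖ :♯ 2) ⊗ (:♯ 1 ⊕ t ⊖ :♯ 2))
             ⊜ (t ⊖ :♯ 1) ⊗ (t ⊖ :♯ 1) ⊗ (t ⊕ :♯ 1)) t) ⟩
      ι₃ * ((t - ♯ 1) * (t - ♯ 1) * (t + ♯ 1))
        ≈⟨ *-congˡ 64[3t+5]³w≈ ⟨
      ι₃ * (♯ 64 * ((♯ 3 * t + ♯ 5) * ((♯ 3 * t + ♯ 5) * (♯ 3 * t + ♯ 5))) * w)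
        ≈⟨ solve 3 (λ i t w → i ⊗ (:♯ 64 ⊗ ((:♯ 3 ⊗ t ⊕ :♯ 5) ⊗ ((:♯ 3 ⊗ t ⊕ :♯ 5) ⊗ (:♯ 3 ⊗ t ⊕ :♯ 5))) ⊗ w)
             ⊜ :♯ 8 ⊗ i ⊗ (w ⊗ ((:♯ 4 ⊕ :♯ 6 ⊗ (:♯ 1 ⊕ t)) ⊗ ((:♯ 4 ⊕ :♯ 6 ⊗ (:♯ 1 ⊕ t)) ⊗ (:♯ 4 ⊕ :♯ 6 ⊗ (:♯ 1 ⊕ t)))))) ι₃ t w ⟩
      ♯ 8 * ι₃ * (w * (M x * (M x * M x)))
        ≈⟨ *-cong (trans (inverse-of-2^ 3) 1-homo) (*-congˡ (*-congˡ (*-congˡ (sym (*-identityʳ _))))) ⟩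
      1# * (w * M x ^ 3)
        ≈⟨ *-identityˡ _ ⟩
      w * M x ^ 3 ∎

    left-term : ∀ k → coefficient₂ ι₂ k * z x ^ k ≈ ♯ a₂ k * v ^ k
    left-term k = trans (*-assoc _ _ _) (*-congˡ (trans (sym (^-distrib-* ι₂ (z x) k)) (^-congˡ k ι₂z≈v)))

    right-term : ∀ k → k ℕ.≤ n →
      coefficient₃ ι₃ k * (N x ^ k * M x ^ (m ∸ 3 ℕ.* k)) ≈ M x ^ m * (♯ a₃ k * w ^ k)
    right-term k k≤n = begin
      ♯ a₃ k * ι₃ ^ k * (N x ^ k * M x ^ j)
        ≈⟨ solve 4 (λ a i y s → a ⊗ i ⊗ (y ⊗ s) ⊜ a ⊗ (i ⊗ y ⊗ s)) (♯ a₃ k) (ι₃ ^ k) (N x ^ k) (M x ^ j) ⟩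
      ♯ a₃ k * (ι₃ ^ k * N x ^ k * M x ^ j)
        -- Each power of ι₃ N = w M³ brings M³, and (M³)ᵏ recombines with the exponent m - 3 k to
        -- the factor Mᵐ common to all terms.
        ≈⟨ *-congˡ (*-congʳ (trans (sym (^-distrib-* ι₃ (N x) k)) (trans (^-congˡ k ι₃N≈) (^-distrib-* w (M x ^ 3) k)))) ⟩
      ♯ a₃ k * (w ^ k * (M x ^ 3) ^ k * M x ^ j)
        ≈⟨ *-congˡ (trans (*-assoc _ _ _) (*-congˡ (trans (*-congʳ (^-assocʳ (M x) 3 k)) (sym (^-homo-* (M x) (3 ℕ.* k) j))))) ⟩
      ♯ a₃ k * (w ^ k * M x ^ (3 ℕ.* k ℕ.+ j))
        ≡⟨ ≡.cong (λ e → ♯ a₃ k * (w ^ k * M x ^ e)) (ℕ.m+[n∸m]≡n (ℕ.≤-trans (ℕ.*-monoʳ-≤ 3 k≤n) 3n≤m)) ⟩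
      ♯ a₃ k * (w ^ k * M x ^ m)
        ≈⟨ solve 3 (λ a y s → a ⊗ (y ⊗ s) ⊜ s ⊗ (a ⊗ y)) (♯ a₃ k) (w ^ k) (M x ^ m) ⟩
      M x ^ m * (♯ a₃ k * w ^ k) ∎
      where j = m ∸ 3 ℕ.* k

  legendre : ∀ {x ε} → LegendreZ p x ε → # ε ≈ (# x) ^ m
  legendre (inj₁ (p∣x , ≡.refl)) = trans 0-homo (sym (0^ 0<m))
    where
    0^ : ∀ {k} → 0 ℕ.< k → (# _) ^ k ≈ 0#
    0^ {suc k} _ = trans (*-congʳ (∣⇒≈0 (∣ᵤ⇒∣ p∣x))) (zeroˡ _)
  legendre {x} (inj₂ (inj₁ (p∤x , (y , p∣y²-x) , ≡.refl))) =
    trans 1-homo (sym (residue {y = y} (p∤x ∘ ∣⇒∣ᵤ ∘ ≈0⇒∣) (x∙y⁻¹≈ε⇒x≈y _ _ (begin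
      # y * # y - # x           ≈⟨ trans (+-homo (y ℤ.* y) (ℤ.- x)) (+-cong (*-homo y y) (-‿homo x)) ⟨
      # (y ℤ.* y ℤ.- x)         ≈⟨ ∣⇒≈0 (∣ᵤ⇒∣ p∣y²-x) ⟩
      0#                        ∎))))
  legendre {x} (inj₂ (inj₂ (p∤x , nonsquare , ≡.refl))) =
    trans (-‿homo 1ℤ) (trans (-‿cong 1-homo) (sym (nonresidue (p∤x ∘ ∣⇒∣ᵤ ∘ ≈0⇒∣) (λ y y²≈x → nonsquare (y , ∣⇒∣ᵤ (≈0⇒∣ (begin
      # (y ℤ.* y ℤ.- x)         ≈⟨ trans (+-homo (y ℤ.* y) (ℤ.- x)) (+-cong (*-homo y y) (-‿homo x)) ⟩
      # y * # y - # x           ≈⟨ +-congʳ y²≈x ⟩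
      # x - # x                 ≈⟨ -‿inverseʳ _ ⟩
      0#                        ∎)))))))

-- Rational numbers and their reduction modulo p

open import Data.Rational using (_+_; _*_; _-_; -_)

toℚᵘ-ℤtoℚ : ∀ x → toℚᵘ (ℤtoℚ x) ℚᵘ.≃ mkℚᵘ x 0
toℚᵘ-ℤtoℚ x = ℚ.toℚᵘ-fromℚᵘ (mkℚᵘ x 0)

ℤtoℚ-+ : ∀ x y → ℤtoℚ (x ℤ.+ y) ≡ ℤtoℚ x + ℤtoℚ y
ℤtoℚ-+ x y = ℚ.toℚᵘ-injective (begin
  toℚᵘ (ℤtoℚ (x ℤ.+ y))                   ≈⟨ toℚᵘ-ℤtoℚ (x ℤ.+ y) ⟩
  mkℚᵘ (x ℤ.+ y) 0                        ≈⟨ ℚᵘ.*≡* (≡.cong (ℤ._* 1ℤ) (≡.cong₂ ℤ._+_ (ℤ.*-identityʳ x) (ℤ.*-identityʳ y))) ⟨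
  mkℚᵘ x 0 ℚᵘ.+ mkℚᵘ y 0                  ≈⟨ ℚᵘ.+-cong (toℚᵘ-ℤtoℚ x) (toℚᵘ-ℤtoℚ y) ⟨
  toℚᵘ (ℤtoℚ x) ℚᵘ.+ toℚᵘ (ℤtoℚ y)        ≈⟨ ℚ.toℚᵘ-homo-+ (ℤtoℚ x) (ℤtoℚ y) ⟨
  toℚᵘ (ℤtoℚ x + ℤtoℚ y)                  ∎)
  where open ≈-Reasoning ℚᵘ.≃-setoid

ℤtoℚ-* : ∀ x y → ℤtoℚ (x ℤ.* y) ≡ ℤtoℚ x * ℤtoℚ y
ℤtoℚ-* x y = ℚ.toℚᵘ-injective (begin
  toℚᵘ (ℤtoℚ (x ℤ.* y))                   ≈⟨ toℚᵘ-ℤtoℚ (x ℤ.* y) ⟩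
  mkℚᵘ x 0 ℚᵘ.* mkℚᵘ y 0                  ≈⟨ ℚᵘ.*-cong (toℚᵘ-ℤtoℚ x) (toℚᵘ-ℤtoℚ y) ⟨
  toℚᵘ (ℤtoℚ x) ℚᵘ.* toℚᵘ (ℤtoℚ y)        ≈⟨ ℚ.toℚᵘ-homo-* (ℤtoℚ x) (ℤtoℚ y) ⟨
  toℚᵘ (ℤtoℚ x * ℤtoℚ y)                  ∎)
  where open ≈-Reasoning ℚᵘ.≃-setoid

ℤtoℚ-injective : ∀ {x y} → ℤtoℚ x ≡ ℤtoℚ y → x ≡ y
ℤtoℚ-injective {x} {y} eq with ℚ.fromℚᵘ-injective {mkℚᵘ x 0} {mkℚᵘ y 0} eq
... | ℚᵘ.*≡* x*1≡y*1 = ≡.trans (≡.sym (ℤ.*-identityʳ x)) (≡.trans x*1≡y*1 (ℤ.*-identityʳ y))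

ℤtoℚ-neg : ∀ x → ℤtoℚ (ℤ.- x) ≡ - ℤtoℚ x
ℤtoℚ-neg x = begin
  ℤtoℚ (ℤ.- x)             ≡⟨ ≡.cong ℤtoℚ (ℤ.-1*i≡-i x) ⟨
  ℤtoℚ (-1ℤ ℤ.* x)         ≡⟨ ℤtoℚ-* -1ℤ x ⟩
  - 1ℚ * ℤtoℚ x            ≡⟨ ℚ.neg-distribˡ-* 1ℚ (ℤtoℚ x) ⟨
  - (1ℚ * ℤtoℚ x)          ≡⟨ ≡.cong -_ (ℚ.*-identityˡ (ℤtoℚ x)) ⟩
  - ℤtoℚ x                 ∎
  where open ≡.≡-Reasoning

q*↧q≡↥q : ∀ q → q * ℤtoℚ (↧ q) ≡ ℤtoℚ (↥ q)
q*↧q≡↥q q@record{} = ℚ.toℚᵘ-injective (begin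
  toℚᵘ (q * ℤtoℚ (↧ q))             ≈⟨ ℚ.toℚᵘ-homo-* q (ℤtoℚ (↧ q)) ⟩
  toℚᵘ q ℚᵘ.* toℚᵘ (ℤtoℚ (↧ q))     ≈⟨ ℚᵘ.*-congˡ {toℚᵘ q} (toℚᵘ-ℤtoℚ (↧ q)) ⟩
  toℚᵘ q ℚᵘ.* mkℚᵘ (↧ q) 0          ≈⟨ ℚᵘ.*≡* (≡.trans (ℤ.*-identityʳ _)
                                          (≡.cong (↥ q ℤ.*_) (≡.cong +_ (≡.sym (ℕ.*-identityʳ _))))) ⟩
  mkℚᵘ (↥ q) 0                      ≈⟨ toℚᵘ-ℤtoℚ (↥ q) ⟨
  toℚᵘ (ℤtoℚ (↥ q))                 ∎)
  where open ≈-Reasoning ℚᵘ.≃-setoid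

integersℚ : IntegersTo ℚ.+-*-commutativeRing
integersℚ = record
  { ⟦_⟧ = ℤtoℚ ; +-homo = ℤtoℚ-+ ; *-homo = ℤtoℚ-* ; -‿homo = ℤtoℚ-neg ; 0-homo = ≡.refl ; 1-homo = ≡.refl }

module Reduction {p : ℕ} {c ℓ} (K : CommutativeRing c ℓ) (φ : IntegersTo K) (𝔽 : PrimeField p K φ) where

  open CommutativeRing K hiding (_-_)
    renaming (_+_ to _+ᴷ_; _*_ to _*ᴷ_; -_ to -ᴷ_)
  open CommutativeRing K using () renaming (_-_ to _-ᴷ_)
  open _-Raw-AlmostCommutative⟶_ φ renaming (⟦_⟧ to #_)
  open PrimeField 𝔽
  open FiniteField K φ 𝔽
  open IntegerSolver K φ
  module ℚSolver = IntegerSolver ℚ.+-*-commutativeRing integersℚ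
  open Exp semiring using (_^_; ^-congˡ)
  open FiniteSums K
  open RingProperties (CommutativeRing.ring K) using (x∙y⁻¹≈ε⇒x≈y; x≈y⇒x∙y⁻¹≈ε)

  -- q ↦ z: the image of q ∈ ℤ_p under the homomorphism ℤ_p → K is z.
  infix 4 _↦_
  record _↦_ (q : ℚ) (z : Carrier) : Set ℓ where
    constructor reduces
    field
      num den    : ℤ
      den≉0      : ¬ # den ≈ 0#
      equation   : q * ℤtoℚ den ≡ ℤtoℚ num
      congruence : # num ≈ z *ᴷ # den

  ≉0-* : ∀ {x y} → ¬ # x ≈ 0# → ¬ # y ≈ 0# → ¬ # (x ℤ.* y) ≈ 0#
  ≉0-* {x} {y} x≉0 y≉0 xy≈0 = y≉0 (*-cancel x≉0 (trans (sym (*-homo x y)) xy≈0))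

  ↦-resp : ∀ {q z w} → z ≈ w → q ↦ z → q ↦ w
  ↦-resp z≈w (reduces n d d≉0 eq cg) = reduces n d d≉0 eq (trans cg (*-congʳ z≈w))

  ↦-ℤ : ∀ x → ℤtoℚ x ↦ # x
  ↦-ℤ x = reduces x 1ℤ (1≉0 ∘ trans (sym 1-homo)) (ℚ.*-identityʳ (ℤtoℚ x))
    (trans (sym (*-identityʳ (# x))) (*-congˡ (sym 1-homo)))

  ↦-+ : ∀ {q r z w} → q ↦ z → r ↦ w → q + r ↦ z +ᴷ w
  ↦-+ {q} {r} {z} {w} (reduces n d d≉0 eq cg) (reduces n′ d′ d′≉0 eq′ cg′) =
    reduces (n ℤ.* d′ ℤ.+ n′ ℤ.* d) (d ℤ.* d′) (≉0-* d≉0 d′≉0)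
      (begin
        (q + r) * ℤtoℚ (d ℤ.* d′)                           ≡⟨ ≡.cong ((q + r) *_) (ℤtoℚ-* d d′) ⟩
        (q + r) * (ℤtoℚ d * ℤtoℚ d′)
          ≡⟨ ℚSolver.solve 4 (λ q r d d′ → (q ⊕ r) ⊗ (d ⊗ d′) ⊜ q ⊗ d ⊗ d′ ⊕ r ⊗ d′ ⊗ d) q r (ℤtoℚ d) (ℤtoℚ d′) ⟩
        q * ℤtoℚ d * ℤtoℚ d′ + r * ℤtoℚ d′ * ℤtoℚ d         ≡⟨ ≡.cong₂ (λ x y → x * ℤtoℚ d′ + y * ℤtoℚ d) eq eq′ ⟩
        ℤtoℚ n * ℤtoℚ d′ + ℤtoℚ n′ * ℤtoℚ d                 ≡⟨ ≡.cong₂ _+_ (ℤtoℚ-* n d′) (ℤtoℚ-* n′ d) ⟨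
        ℤtoℚ (n ℤ.* d′) + ℤtoℚ (n′ ℤ.* d)                   ≡⟨ ℤtoℚ-+ (n ℤ.* d′) (n′ ℤ.* d) ⟨
        ℤtoℚ (n ℤ.* d′ ℤ.+ n′ ℤ.* d) ∎)
      (trans (+-homo _ _) (trans (+-cong (trans (*-homo n d′) (*-congʳ cg)) (trans (*-homo n′ d) (*-congʳ cg′)))
        (trans (solve 4 (λ z w d d′ → z ⊗ d ⊗ d′ ⊕ w ⊗ d′ ⊗ d ⊜ (z ⊕ w) ⊗ (d ⊗ d′)) z w (# d) (# d′))
          (*-congˡ (sym (*-homo d d′))))))
    where open ≡.≡-Reasoning

  ↦-* : ∀ {q r z w} → q ↦ z → r ↦ w → q * r ↦ z *ᴷ w
  ↦-* {q} {r} {z} {w} (reduces n d d≉0 eq cg) (reduces n′ d′ d′≉0 eq′ cg′) =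
    reduces (n ℤ.* n′) (d ℤ.* d′) (≉0-* d≉0 d′≉0)
      (begin
        q * r * ℤtoℚ (d ℤ.* d′)                ≡⟨ ≡.cong ((q * r) *_) (ℤtoℚ-* d d′) ⟩
        q * r * (ℤtoℚ d * ℤtoℚ d′)
          ≡⟨ ℚSolver.solve 4 (λ q r d d′ → q ⊗ r ⊗ (d ⊗ d′) ⊜ q ⊗ d ⊗ (r ⊗ d′)) q r (ℤtoℚ d) (ℤtoℚ d′) ⟩
        q * ℤtoℚ d * (r * ℤtoℚ d′)             ≡⟨ ≡.cong₂ _*_ eq eq′ ⟩
        ℤtoℚ n * ℤtoℚ n′                       ≡⟨ ℤtoℚ-* n n′ ⟨
        ℤtoℚ (n ℤ.* n′) ∎)
      (trans (*-homo n n′) (trans (*-cong cg cg′)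
        (trans (solve 4 (λ z w d d′ → z ⊗ d ⊗ (w ⊗ d′) ⊜ z ⊗ w ⊗ (d ⊗ d′)) z w (# d) (# d′))
          (*-congˡ (sym (*-homo d d′))))))
    where open ≡.≡-Reasoning

  ↦-neg : ∀ {q z} → q ↦ z → - q ↦ -ᴷ z
  ↦-neg {q} {z} (reduces n d d≉0 eq cg) = reduces (ℤ.- n) d d≉0
    (≡.trans (≡.sym (ℚ.neg-distribˡ-* q (ℤtoℚ d))) (≡.trans (≡.cong -_ eq) (≡.sym (ℤtoℚ-neg n))))
    (trans (-‿homo n) (trans (-‿cong cg) (solve 2 (λ z d → ⊝ (z ⊗ d) ⊜ (⊝ z) ⊗ d) z (# d))))

  ↦-- : ∀ {q r z w} → q ↦ z → r ↦ w → q - r ↦ z -ᴷ w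
  ↦-- q↦z r↦w = ↦-+ q↦z (↦-neg r↦w)

  ↦-pow : ∀ {q z} → q ↦ z → ∀ k → pow q k ↦ z ^ k
  ↦-pow q↦z zero    = ↦-resp 1-homo (↦-ℤ 1ℤ)
  ↦-pow q↦z (suc k) = ↦-* q↦z (↦-pow q↦z k)

  ↦-sumTo : ∀ k {f g} → (∀ i → f i ↦ g i) → sumTo k f ↦ sum≤ k g
  ↦-sumTo zero    f↦g = f↦g 0
  ↦-sumTo (suc k) f↦g = ↦-+ (↦-sumTo k f↦g) (f↦g (suc k))

  -- Numerator and denominator change places; the numerator is nonzero modulo p because `z` is. This
  -- also excludes the default value of `inv` at 0.
  ↦-inv : ∀ {q z y} → z *ᴷ y ≈ 1# → q ↦ z → inv q ↦ y
  ↦-inv {q} {z} {y} zy≈1 (reduces n d d≉0 eq cg) = reduces d n n≉0 inverted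
    (trans (sym (*-identityˡ (# d))) (trans (*-congʳ (sym zy≈1))
      (trans (solve 3 (λ z y d → z ⊗ y ⊗ d ⊜ y ⊗ (z ⊗ d)) z y (# d)) (*-congˡ (sym cg)))))
    where
    z≉0 : ¬ z ≈ 0#
    z≉0 z≈0 = 1≉0 (trans (sym zy≈1) (trans (*-congʳ z≈0) (zeroˡ y)))

    n≉0 : ¬ # n ≈ 0#
    n≉0 n≈0 = d≉0 (*-cancel z≉0 (trans (sym cg) n≈0))

    open ≡.≡-Reasoning
    inverted : inv q * ℤtoℚ n ≡ ℤtoℚ d
    inverted with q ℚ.≟ 0ℚ
    ... | yes ≡.refl = ⊥-elim (n≉0 (trans (reflexive (≡.cong #_ (ℤtoℚ-injective
                         (≡.trans (≡.sym eq) (ℚ.*-zeroˡ (ℤtoℚ d)))))) 0-homo))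
    ... | no q≢0 = begin
      ℚ.1/_ q {{ℚ.≢-nonZero q≢0}} * ℤtoℚ n          ≡⟨ ≡.cong (ℚ.1/_ q {{ℚ.≢-nonZero q≢0}} *_) eq ⟨
      ℚ.1/_ q {{ℚ.≢-nonZero q≢0}} * (q * ℤtoℚ d)    ≡⟨ ℚ.*-assoc (ℚ.1/_ q {{ℚ.≢-nonZero q≢0}}) q (ℤtoℚ d) ⟨
      ℚ.1/_ q {{ℚ.≢-nonZero q≢0}} * q * ℤtoℚ d      ≡⟨ ≡.cong (_* ℤtoℚ d) (ℚ.*-inverseˡ q {{ℚ.≢-nonZero q≢0}}) ⟩
      1ℚ * ℤtoℚ d                                   ≡⟨ ℚ.*-identityˡ (ℤtoℚ d) ⟩
      ℤtoℚ d                                        ∎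

  -- A witness of `q ↦ z` may be any fraction equal to q, whereas congruence of rationals is defined
  -- by the reduced numerator. Comparing the two fractions links these notions.
  cross-multiply : ∀ {q z} (r : q ↦ z) → # (↥ q) *ᴷ # (_↦_.den r) ≈ z *ᴷ # (_↦_.den r) *ᴷ # (↧ q)
  cross-multiply {q} (reduces n d d≉0 eq cg) =
    trans (sym (*-homo (↥ q) d)) (trans (reflexive (≡.cong #_ (ℤtoℚ-injective (begin
      ℤtoℚ (↥ q ℤ.* d)              ≡⟨ ℤtoℚ-* (↥ q) d ⟩
      ℤtoℚ (↥ q) * ℤtoℚ d           ≡⟨ ≡.cong (_* ℤtoℚ d) (q*↧q≡↥q q) ⟨
      q * ℤtoℚ (↧ q) * ℤtoℚ d       ≡⟨ ℚSolver.solve 3 (λ q a b → q ⊗ a ⊗ b ⊜ q ⊗ b ⊗ a) q (ℤtoℚ (↧ q)) (ℤtoℚ d) ⟩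
      q * ℤtoℚ d * ℤtoℚ (↧ q)       ≡⟨ ≡.cong (_* ℤtoℚ (↧ q)) eq ⟩
      ℤtoℚ n * ℤtoℚ (↧ q)           ≡⟨ ℤtoℚ-* n (↧ q) ⟨
      ℤtoℚ (n ℤ.* ↧ q)              ∎))))
    (trans (*-homo n (↧ q)) (*-congʳ cg)))
    where open ≡.≡-Reasoning

  -- The fraction is in lowest terms, so p cannot divide both parts. The coprimality proof stored in
  -- it is irrelevant, hence recomputed before use.
  ↧≉0 : ∀ {q} → # (↥ q) ≈ 0# → ¬ # (↧ q) ≈ 0#
  ↧≉0 {mkℚ n d-1 coprime} ↥≈0 ↧≈0 = ℕ.<⇒≢ (prime>1 p-prime)
    (≡.sym (Coprimality.recompute coprime (∣⇒∣ᵤ (≈0⇒∣ ↥≈0) , ∣⇒∣ᵤ (≈0⇒∣ ↧≈0))))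

  ≈⇒≡[mod] : ∀ {q r z w} → q ↦ z → r ↦ w → z ≈ w → q ≡ r [mod p ]
  ≈⇒≡[mod] {q} {r} q↦z r↦w z≈w = ∣⇒∣ᵤ (≈0⇒∣ (*-cancel (_↦_.den≉0 q-r)
    (trans (*-comm _ _) (trans (cross-multiply q-r)
      (trans (*-congʳ (trans (*-congʳ (x≈y⇒x∙y⁻¹≈ε z≈w)) (zeroˡ _))) (zeroˡ _))))))
    where q-r = ↦-- q↦z r↦w

  ≡[mod]⇒≈ : ∀ {q r z w} → q ↦ z → r ↦ w → q ≡ r [mod p ] → z ≈ w
  ≡[mod]⇒≈ {q} {r} q↦z r↦w p∣↥ = x∙y⁻¹≈ε⇒x≈y _ _ (*-cancel (_↦_.den≉0 q-r) (*-cancel (↧≉0 {q - r} ↥≈0)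
    (trans (*-congˡ (*-comm _ _)) (trans (*-comm _ _)
      (trans (sym (cross-multiply q-r)) (trans (*-congʳ ↥≈0) (zeroˡ _)))))))
    where
    q-r = ↦-- q↦z r↦w
    ↥≈0 = ∣⇒≈0 (∣ᵤ⇒∣ p∣↥)

  inverse : ∀ {z} → ¬ z ≈ 0# → ∃[ y ] z *ᴷ y ≈ 1#
  inverse {z} z≉0 with surjective z
  ... | x , x≈z = (# x) ^ (p ∸ 2) , trans (*-congʳ (sym x≈z))
    (trans (reflexive (≡.cong ((# x) ^_) (≡.sym (ℕ.+-∸-assoc 1 (prime>1 p-prime)))))
      (x^[p-1]≈1 x (z≉0 ∘ trans (sym x≈z))))

  integral⇒↦ : ∀ q → InZp p q → ∃[ z ] q ↦ z
  integral⇒↦ q p∤↧q with inverse {# (↧ q)} (p∤↧q ∘ ∣⇒∣ᵤ ∘ ≈0⇒∣)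
  ... | y , dy≈1 = # (↥ q) *ᴷ y , reduces (↥ q) (↧ q) (p∤↧q ∘ ∣⇒∣ᵤ ∘ ≈0⇒∣) (q*↧q≡↥q q)
    (trans (sym (*-identityʳ _)) (trans (*-congˡ (sym dy≈1))
      (solve 3 (λ n d y → n ⊗ (d ⊗ y) ⊜ n ⊗ y ⊗ d) (# (↥ q)) (# (↧ q)) y)))

  module _ {m n : ℕ} (p≡1+2m : p ≡ suc (2 ℕ.* m)) (0<m : 0 ℕ.< m)
    (p≡6n+1∨5 : p ≡ 6 ℕ.* n ℕ.+ 1 ⊎ p ≡ 6 ℕ.* n ℕ.+ 5) where

    open Transformation K φ 𝔽 {m} {n} p≡1+2m 0<m p≡6n+1∨5
      using (transformation; legendre; ♯-*; ♯2^≉0)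

    private
      F : ℚ → ℚ
      F t = sumTo m (λ k → ℕtoℚ ((2 ℕ.* k) C k) * ℕtoℚ ((2 ℕ.* k) C k) * ℕtoℚ ((4 ℕ.* k) C (2 ℕ.* k))
                         * pow ((1ℚ - t * t) * inv (ℕtoℚ 256)) k)

      G : ℚ → ℚ
      G w = sumTo n (λ k → ℕtoℚ ((2 ℕ.* k) C k) * ℕtoℚ ((3 ℕ.* k) C k) * ℕtoℚ ((6 ℕ.* k) C (3 ℕ.* k)) * pow w k)

    ↦-ℕ : ∀ k → ℕtoℚ k ↦ ♯ k
    ↦-ℕ k = ↦-ℤ (+ k)

    ↦-1 : 1ℚ ↦ ♯ 1
    ↦-1 = ↦-ℤ 1ℤ

    ↦-product : ∀ a b c → ℕtoℚ a * ℕtoℚ b * ℕtoℚ c ↦ ♯ (a ℕ.* b ℕ.* c)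
    ↦-product a b c = ↦-resp (sym (trans (♯-* (a ℕ.* b) c) (*-congʳ (♯-* a b))))
      (↦-* (↦-* (↦-ℕ a) (↦-ℕ b)) (↦-ℕ c))

    1/256 : Carrier
    1/256 = proj₁ (inverse (♯2^≉0 8))

    F̂ Ĝ : Carrier → Carrier
    F̂ τ = sum≤ m (λ k → ♯ a₂ k *ᴷ ((♯ 1 -ᴷ τ *ᴷ τ) *ᴷ 1/256) ^ k)
    Ĝ ω = sum≤ n (λ k → ♯ a₃ k *ᴷ ω ^ k)

    ↦-F : ∀ {t τ} → t ↦ τ → F t ↦ F̂ τ
    ↦-F t↦τ = ↦-sumTo m (λ k → ↦-* (↦-product ((2 ℕ.* k) C k) ((2 ℕ.* k) C k) ((4 ℕ.* k) C (2 ℕ.* k)))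
      (↦-pow (↦-* (↦-- ↦-1 (↦-* t↦τ t↦τ)) (↦-inv (proj₂ (inverse (♯2^≉0 8))) (↦-ℕ 256))) k))

    ↦-G : ∀ {w ω} → w ↦ ω → G w ↦ Ĝ ω
    ↦-G w↦ω = ↦-sumTo n (λ k → ↦-* (↦-product ((2 ℕ.* k) C k) ((3 ℕ.* k) C k) ((6 ℕ.* k) C (3 ℕ.* k))) (↦-pow w↦ω k))

    F̂≈εĜ : ∀ {τ ω x ε} →
      ♯ 64 *ᴷ ((♯ 3 *ᴷ τ +ᴷ ♯ 5) *ᴷ ((♯ 3 *ᴷ τ +ᴷ ♯ 5) *ᴷ (♯ 3 *ᴷ τ +ᴷ ♯ 5))) *ᴷ ω
        ≈ (τ -ᴷ ♯ 1) *ᴷ (τ -ᴷ ♯ 1) *ᴷ (τ +ᴷ ♯ 1) →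
      # x ≈ ♯ 10 +ᴷ ♯ 6 *ᴷ τ → LegendreZ p x ε → F̂ τ ≈ # ε *ᴷ Ĝ ω
    F̂≈εĜ {τ} {ω} 64[3τ+5]³ω≈ x≈ leg = trans
      (transformation τ ((♯ 1 -ᴷ τ *ᴷ τ) *ᴷ 1/256) ω
        (trans (solve 3 (λ a s y → a ⊗ (s ⊗ y) ⊜ a ⊗ y ⊗ s) (♯ 256) (♯ 1 -ᴷ τ *ᴷ τ) 1/256)
          (trans (*-congʳ (proj₂ (inverse (♯2^≉0 8)))) (*-identityˡ _)))
        64[3τ+5]³ω≈)
      (*-congʳ (sym (trans (legendre leg) (^-congˡ m x≈))))

    64e³≉0 : ∀ {e} → ¬ e ≈ 0# → ¬ ♯ 64 *ᴷ e ^ 3 ≈ 0#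
    64e³≉0 e≉0 = ^-≉0 3 e≉0 ∘ *-cancel (♯2^≉0 6)

    congruences : ∀ t → InZp p t →
      ¬ (ℕtoℚ 3 * t ≡ ℕtoℚ 5 [mod p ]) → ¬ (ℕtoℚ 3 * t ≡ - ℕtoℚ 5 [mod p ]) → ∀ {ε₁ ε₂} →
      Legendre p (ℕtoℚ 10 + ℕtoℚ 6 * t) ε₁ → Legendre p (ℕtoℚ 10 - ℕtoℚ 6 * t) ε₂ →
      let w₁ = (t - 1ℚ) * (t - 1ℚ) * (t + 1ℚ) * inv (ℕtoℚ 64 * pow (ℕtoℚ 3 * t + ℕtoℚ 5) 3)
          w₂ = (t + 1ℚ) * (t + 1ℚ) * (t - 1ℚ) * inv (ℕtoℚ 64 * pow (ℕtoℚ 3 * t - ℕtoℚ 5) 3) in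
      (F t ≡ ℤtoℚ ε₁ * G w₁ [mod p ]) × (ℤtoℚ ε₁ * G w₁ ≡ ℤtoℚ ε₂ * G w₂ [mod p ])
    congruences t t∈ℤp 3t≢5 3t≢-5 {ε₁} {ε₂} (x₁ , x₁≡ , leg₁) (x₂ , x₂≡ , leg₂) =
      ≈⇒≡[mod] (↦-F t↦τ) ↦εG₁ F≈εG₁ , ≈⇒≡[mod] ↦εG₁ ↦εG₂ (trans (sym F≈εG₁) F≈εG₂)
      where
      τ = proj₁ (integral⇒↦ t t∈ℤp)
      t↦τ = proj₂ (integral⇒↦ t t∈ℤp)
      e₁ = ♯ 3 *ᴷ τ +ᴷ ♯ 5
      e₂ = ♯ 3 *ᴷ τ -ᴷ ♯ 5

      e₁≉0 : ¬ e₁ ≈ 0#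
      e₁≉0 e₁≈0 = 3t≢-5 (≈⇒≡[mod] (↦-* (↦-ℕ 3) t↦τ) (↦-neg (↦-ℕ 5))
        (trans (solve 2 (λ a b → a ⊜ a ⊕ b ⊕ ⊝ b) (♯ 3 *ᴷ τ) (♯ 5)) (trans (+-congʳ e₁≈0) (+-identityˡ _))))

      e₂≉0 : ¬ e₂ ≈ 0#
      e₂≉0 e₂≈0 = 3t≢5 (≈⇒≡[mod] (↦-* (↦-ℕ 3) t↦τ) (↦-ℕ 5) (x∙y⁻¹≈ε⇒x≈y _ _ e₂≈0))

      inverse₁ = inverse (64e³≉0 e₁≉0)
      inverse₂ = inverse (64e³≉0 e₂≉0)
      ω₁ = (τ -ᴷ ♯ 1) *ᴷ (τ -ᴷ ♯ 1) *ᴷ (τ +ᴷ ♯ 1) *ᴷ proj₁ inverse₁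
      ω₂ = (τ +ᴷ ♯ 1) *ᴷ (τ +ᴷ ♯ 1) *ᴷ (τ -ᴷ ♯ 1) *ᴷ proj₁ inverse₂

      ↦εG₁ = ↦-* (↦-ℤ ε₁) (↦-G (↦-* (↦-* (↦-* (↦-- t↦τ ↦-1) (↦-- t↦τ ↦-1)) (↦-+ t↦τ ↦-1))
        (↦-inv (proj₂ inverse₁) (↦-* (↦-ℕ 64) (↦-pow (↦-+ (↦-* (↦-ℕ 3) t↦τ) (↦-ℕ 5)) 3)))))
      ↦εG₂ = ↦-* (↦-ℤ ε₂) (↦-G (↦-* (↦-* (↦-* (↦-+ t↦τ ↦-1) (↦-+ t↦τ ↦-1)) (↦-- t↦τ ↦-1))
        (↦-inv (proj₂ inverse₂) (↦-* (↦-ℕ 64) (↦-pow (↦-- (↦-* (↦-ℕ 3) t↦τ) (↦-ℕ 5)) 3)))))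

      cancel₁ : ∀ s → ♯ 64 *ᴷ (e₁ *ᴷ (e₁ *ᴷ e₁)) *ᴷ (s *ᴷ proj₁ inverse₁) ≈ s
      -- The cube inside `inverse₁` unfolds to a product ending in `1#`; it is matched with `♯ 1`,
      -- the form of one that the solver handles.
      cancel₁ s = trans (solve 3 (λ e s y → :♯ 64 ⊗ (e ⊗ (e ⊗ e)) ⊗ (s ⊗ y) ⊜ :♯ 64 ⊗ (e ⊗ (e ⊗ (e ⊗ :♯ 1))) ⊗ y ⊗ s) e₁ s (proj₁ inverse₁))
        (trans (*-congʳ (trans (*-congʳ (*-congˡ (*-congˡ (*-congˡ (*-congˡ 1-homo))))) (proj₂ inverse₁))) (*-identityˡ s))

      cancel₂ : ∀ s → ♯ 64 *ᴷ (e₂ *ᴷ (e₂ *ᴷ e₂)) *ᴷ (s *ᴷ proj₁ inverse₂) ≈ s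
      cancel₂ s = trans (solve 3 (λ e s y → :♯ 64 ⊗ (e ⊗ (e ⊗ e)) ⊗ (s ⊗ y) ⊜ :♯ 64 ⊗ (e ⊗ (e ⊗ (e ⊗ :♯ 1))) ⊗ y ⊗ s) e₂ s (proj₁ inverse₂))
        (trans (*-congʳ (trans (*-congʳ (*-congˡ (*-congˡ (*-congˡ (*-congˡ 1-homo))))) (proj₂ inverse₂))) (*-identityˡ s))

      F≈εG₁ : F̂ τ ≈ # ε₁ *ᴷ Ĝ ω₁
      F≈εG₁ = F̂≈εĜ (cancel₁ _)
        (≡[mod]⇒≈ (↦-ℤ x₁) (↦-+ (↦-ℕ 10) (↦-* (↦-ℕ 6) t↦τ)) x₁≡) leg₁

      F≈εG₂ : F̂ τ ≈ # ε₂ *ᴷ Ĝ ω₂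
      F≈εG₂ = trans
        (sum≤-cong m (λ k _ → *-congˡ (^-congˡ k (*-congʳ (solve 1 (λ τ → :♯ 1 ⊖ τ ⊗ τ ⊜ :♯ 1 ⊖ (⊝ τ) ⊗ (⊝ τ)) τ)))))
        -- Replacing τ by -τ changes the sign of both (τ - 1)² (τ + 1), up to exchanging the roles
        -- of 1 and -1, and the cube of the linear form: (5 - 3 τ)³ = -(3 τ - 5)³. The two signs
        -- cancel, so `ω₂` is the argument belonging to -τ.
        (F̂≈εĜ { -ᴷ τ}
          (trans
            (solve 2 (λ τ w → :♯ 64 ⊗ ((:♯ 3 ⊗ ⊝ τ ⊕ :♯ 5) ⊗ ((:♯ 3 ⊗ ⊝ τ ⊕ :♯ 5) ⊗ (:♯ 3 ⊗ ⊝ τ ⊕ :♯ 5))) ⊗ w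
               ⊜ ⊝ (:♯ 64 ⊗ ((:♯ 3 ⊗ τ ⊖ :♯ 5) ⊗ ((:♯ 3 ⊗ τ ⊖ :♯ 5) ⊗ (:♯ 3 ⊗ τ ⊖ :♯ 5))) ⊗ w)) τ ω₂)
            (trans (-‿cong (cancel₂ _))
              (solve 1 (λ τ → ⊝ ((τ ⊕ :♯ 1) ⊗ (τ ⊕ :♯ 1) ⊗ (τ ⊖ :♯ 1)) ⊜ (⊝ τ ⊖ :♯ 1) ⊗ (⊝ τ ⊖ :♯ 1) ⊗ (⊝ τ ⊕ :♯ 1)) τ)))
          (trans (≡[mod]⇒≈ (↦-ℤ x₂) (↦-- (↦-ℕ 10) (↦-* (↦-ℕ 6) t↦τ)) x₂≡)
            (solve 1 (λ τ → :♯ 10 ⊖ :♯ 6 ⊗ τ ⊜ :♯ 10 ⊕ :♯ 6 ⊗ ⊝ τ) τ))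
          leg₂)

-- Residues of a prime greater than 3 modulo 2 and modulo 6

prime>3⇒∤ : ∀ {p} → Prime p → p > 3 → ∀ {d} → 1 ℕ.< d → d ℕ.≤ 3 → ¬ d ℕ∣.∣ p
prime>3⇒∤ p-prime p>3 1<d d≤3 d∣p with prime⇒irreducible p-prime d∣p
... | inj₁ ≡.refl = ℕ.<-irrefl ≡.refl 1<d
... | inj₂ ≡.refl = ℕ.<⇒≱ p>3 d≤3

p≡1+2[[p-1]/2] : ∀ {p} → Prime p → p > 3 → p ≡ suc (2 ℕ.* ((p ∸ 1) ℕ./ 2))
p≡1+2[[p-1]/2] {suc q} p-prime p>3 with q ℕ.% 2 in r | m≡m%n+[m/n]*n q 2 | m%n<n q 2
... | 0           | eq | _ = ≡.cong suc (≡.trans eq (ℕ.*-comm (q ℕ./ 2) 2))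
... | 1           | eq | _ = ⊥-elim (prime>3⇒∤ p-prime p>3 (ℕ.s≤s (ℕ.s≤s ℕ.z≤n)) (ℕ.s≤s (ℕ.s≤s ℕ.z≤n))
                               (ℕ∣.divides (suc (q ℕ./ 2)) (≡.cong suc eq)))
... | suc (suc _) | _  | ℕ.s≤s (ℕ.s≤s ())

p≡6[p/6]+1∨5 : ∀ {p} → Prime p → p > 3 → p ≡ 6 ℕ.* (p ℕ./ 6) ℕ.+ 1 ⊎ p ≡ 6 ℕ.* (p ℕ./ 6) ℕ.+ 5
p≡6[p/6]+1∨5 {p} p-prime p>3 with p ℕ.% 6 | m≡m%n+[m/n]*n p 6 | m%n<n p 6
... | r | eq | r<6 = residue r eq r<6
  where
  multiple : ∀ {d r} → 1 ℕ.< d → d ℕ.≤ 3 → d ℕ∣.∣ 6 → d ℕ∣.∣ r → ¬ p ≡ r ℕ.+ (p ℕ./ 6) ℕ.* 6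
  multiple 1<d d≤3 d∣6 d∣r eq = prime>3⇒∤ p-prime p>3 1<d d≤3
    (≡.subst (_ ℕ∣.∣_) (≡.sym eq) (ℕ∣.∣m∣n⇒∣m+n d∣r (ℕ∣.∣n⇒∣m*n (p ℕ./ 6) d∣6)))

  even : ∀ {r} → 2 ℕ∣.∣ r → ¬ p ≡ r ℕ.+ (p ℕ./ 6) ℕ.* 6
  even = multiple (ℕ.s≤s (ℕ.s≤s ℕ.z≤n)) (ℕ.s≤s (ℕ.s≤s ℕ.z≤n)) (ℕ∣.divides 3 ≡.refl)

  residue : ∀ r → p ≡ r ℕ.+ (p ℕ./ 6) ℕ.* 6 → r ℕ.< 6 → p ≡ 6 ℕ.* (p ℕ./ 6) ℕ.+ 1 ⊎ p ≡ 6 ℕ.* (p ℕ./ 6) ℕ.+ 5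
  residue 0 eq _ = ⊥-elim (even (ℕ∣.divides 0 ≡.refl) eq)
  residue 1 eq _ = inj₁ (≡.trans eq (≡.trans (ℕ.+-comm 1 _) (≡.cong (ℕ._+ 1) (ℕ.*-comm (p ℕ./ 6) 6))))
  residue 2 eq _ = ⊥-elim (even (ℕ∣.divides 1 ≡.refl) eq)
  residue 3 eq _ = ⊥-elim (multiple (ℕ.s≤s (ℕ.s≤s ℕ.z≤n)) ℕ.≤-refl (ℕ∣.divides 2 ≡.refl) (ℕ∣.divides 1 ≡.refl) eq)
  residue 4 eq _ = ⊥-elim (even (ℕ∣.divides 2 ≡.refl) eq)
  residue 5 eq _ = inj₂ (≡.trans eq (≡.trans (ℕ.+-comm 5 _) (≡.cong (ℕ._+ 5) (ℕ.*-comm (p ℕ./ 6) 6))))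
  residue (suc (suc (suc (suc (suc (suc _)))))) _ (ℕ.s≤s (ℕ.s≤s (ℕ.s≤s (ℕ.s≤s (ℕ.s≤s (ℕ.s≤s ()))))))

theorem2p3 : (p : ℕ) → Prime p → p > 3 → (t : ℚ) → InZp p t
    → ¬ (ℕtoℚ 3 * t ≡ ℕtoℚ 5 [mod p ]) → ¬ (ℕtoℚ 3 * t ≡ - ℕtoℚ 5 [mod p ])
    → (ε₁ ε₂ : ℤ)
    → Legendre p (ℕtoℚ 10 + ℕtoℚ 6 * t) ε₁
    → Legendre p (ℕtoℚ 10 - ℕtoℚ 6 * t) ε₂
    → (sumTo ((p ∸ 1) ℕ./ 2) (λ k → ℕtoℚ ((2 ℕ.* k) C k) * ℕtoℚ ((2 ℕ.* k) C k) * ℕtoℚ ((4 ℕ.* k) C (2 ℕ.* k))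
    * pow ((1ℚ - t * t) * inv (ℕtoℚ 256)) k)
    ≡ ℤtoℚ ε₁ * sumTo (p ℕ./ 6) (λ k → ℕtoℚ ((2 ℕ.* k) C k) * ℕtoℚ ((3 ℕ.* k) C k) * ℕtoℚ ((6 ℕ.* k) C (3 ℕ.* k))
    * pow ((t - 1ℚ) * (t - 1ℚ) * (t + 1ℚ) * inv (ℕtoℚ 64 * pow (ℕtoℚ 3 * t + ℕtoℚ 5) 3)) k) [mod p ])
    × (ℤtoℚ ε₁ * sumTo (p ℕ./ 6) (λ k → ℕtoℚ ((2 ℕ.* k) C k) * ℕtoℚ ((3 ℕ.* k) C k) * ℕtoℚ ((6 ℕ.* k) C (3 ℕ.* k))
    * pow ((t - 1ℚ) * (t - 1ℚ) * (t + 1ℚ) * inv (ℕtoℚ 64 * pow (ℕtoℚ 3 * t + ℕtoℚ 5) 3)) k)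
    ≡ ℤtoℚ ε₂ * sumTo (p ℕ./ 6) (λ k → ℕtoℚ ((2 ℕ.* k) C k) * ℕtoℚ ((3 ℕ.* k) C k) * ℕtoℚ ((6 ℕ.* k) C (3 ℕ.* k))
    * pow ((t + 1ℚ) * (t + 1ℚ) * (t - 1ℚ) * inv (ℕtoℚ 64 * pow (ℕtoℚ 3 * t - ℕtoℚ 5) 3)) k) [mod p ])
theorem2p3 p p-prime p>3 t t∈ℤp 3t≢5 3t≢-5 ε₁ ε₂ leg₁ leg₂ =
  Reduction.congruences (Modulo.ring p) (Modulo.integers p) (modulo-prime p-prime)
    {(p ∸ 1) ℕ./ 2} {p ℕ./ 6} p≡1+2m (0<m p≡1+2m) (p≡6[p/6]+1∨5 p-prime p>3)
    t t∈ℤp 3t≢5 3t≢-5 leg₁ leg₂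
  where
  p≡1+2m = p≡1+2[[p-1]/2] p-prime p>3

  0<m : ∀ {m} → p ≡ suc (2 ℕ.* m) → 0 ℕ.< m
  0<m {zero}  p≡1 = ⊥-elim (ℕ.<⇒≱ p>3 (ℕ.≤-trans (ℕ.≤-reflexive p≡1) (ℕ.s≤s ℕ.z≤n)))
  0<m {suc _} _   = ℕ.s≤s ℕ.z≤n
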